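{- For a fixed positive integer $j$, let \[ \rho_j=\lim_{n\to\infty}\bigg((n+1)^{ -(n-1)}\sum_{i=1}^nq_n(i,j)\bigg) \] be the asymptotic probability, as $n\to\infty$, that the $j$-th spot is lucky in a uniformly random parking function of $1,\ldots,n$. Then the limit exists for $1\le j\le 5$ and \[ \rho_1=1,\quad \rho_2=\tfrac34-\tfrac14e^{ -2},\quad \rho_3=\tfrac23-\tfrac23e^{ -3},\quad \rho_4=\tfrac58-\tfrac{13}8e^{ -4},\quad \rho_5=\tfrac35-\tfrac{59}{15}e^{ -5}. \]
   Context: There are $n$ spots labeled $1,\ldots,n$ in order along a one-way street, and $n$ cars entering one after another, car $i$ having preference $a_i\in\{1,\ldots,n\}$. Each car drives to its preferred spot and parks there if it is available; otherwise it moves forward and parks in the first available later spot, if any (if none, it fails to park). A parking function of $1,\ldots,n$ is a sequence of preferences $(a_1,\ldots,a_n)$ such that all $n$ cars are able to park; there are $(n+1)^{n-1}$ of them. A car is lucky if it parks in its preferred spot; a spot is lucky if the car that parks in it prefers that spot. For $1\le i,j\le n$, $q_n(i,j)$ denotes the number of parking functions of $1,\ldots,n$ in which the $i$-th car prefers the $j$-th spot and the $i$-th car is lucky, so $\sum_{i=1}^n q_n(i,j)$ is the number of parking functions for which the $j$-th spot is lucky. -}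

module Defs where

open import Data.Fin.Base using (Fin; zero; suc; toℕ)
import Data.Fin.Properties as Fin
open import Data.Fin.Subset using (Subset; inside; outside) renaming (⊥ to ∅)
open import Data.Integer.Base using (+_; -[1+_])
import Data.Integer.Base as ℤ
import Data.Integer.Properties as ℤ
open import Data.List.Base using (List; []; _∷_; length; filter; map; allFin; cartesianProductWith)
open import Data.Maybe.Base using (Maybe; just; nothing)
open import Data.Maybe using (Is-just)
import Data.Maybe.Base as Maybe
import Data.Maybe.Properties as Maybe
import Data.Maybe.Relation.Unary.Any as MaybeAny
open import Data.Nat.Base as ℕ using (ℕ; zero; suc)
open import Data.Nat.ListAction using (sum)
import Data.Nat.Properties as ℕ
open import Data.Product.Base using (∃-syntax; _×_; _,_; proj₁; proj₂)
open import Data.Rational.Base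
open import Data.Rational.Properties
import Data.Rational.Unnormalised.Base as ℚᵘ
import Data.Rational.Unnormalised.Properties as ℚᵘ
open import Data.Rational.Solver using (module +-*-Solver)
open import Data.Sum.Base using (inj₁; inj₂)
open import Data.Vec.Base using (Vec; []; _∷_; lookup; _[_]≔_)
open import Data.Vec.Relation.Unary.All using (All; all?)
open import Relation.Binary.PropositionalEquality using (_≡_; refl; sym; trans; cong; cong₂; subst)
open import Relation.Nullary.Decidable using (Dec; yes; _×-dec_)

-- The element k of Fin n stands for the spot (or car) labelled toℕ k + 1.
label : ∀ {n} → Fin n → ℕ
label k = suc (toℕ k)

-- A state of the street is its set of occupied spots: 'inside' means
-- occupied, 'outside' means available.
firstAvailable : ∀ {n} → Subset n → Fin n → Maybe (Fin n)
firstAvailable               (outside ∷ occ) zero    = just zero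
firstAvailable {suc zero}    (inside  ∷ occ) zero    = nothing
firstAvailable {suc (suc n)} (inside  ∷ occ) zero    = Maybe.map suc (firstAvailable occ zero)
firstAvailable               (_       ∷ occ) (suc p) = Maybe.map suc (firstAvailable occ p)

occupy : ∀ {n} → Subset n → Maybe (Fin n) → Subset n
occupy occ (just s) = occ [ s ]≔ inside
occupy occ nothing  = occ

-- The spot taken by each of m successive cars, 'nothing' for a car that
-- fails to park.
parkFrom : ∀ {n m} → Subset n → Vec (Fin n) m → Vec (Maybe (Fin n)) m
parkFrom occ []       = []
parkFrom occ (p ∷ ps) = firstAvailable occ p ∷ parkFrom (occupy occ (firstAvailable occ p)) ps

park : ∀ {n m} → Vec (Fin n) m → Vec (Maybe (Fin n)) m
park = parkFrom ∅

IsParkingFunction : ∀ {n} → Vec (Fin n) n → Set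
IsParkingFunction a = All Is-just (park a)

isParkingFunction? : ∀ {n} (a : Vec (Fin n) n) → Dec (IsParkingFunction a)
isParkingFunction? a = all? (MaybeAny.dec (λ _ → yes _)) (park a)

LuckyCar : ∀ {n} → Vec (Fin n) n → Fin n → Set
LuckyCar a i = lookup (park a) i ≡ just (lookup a i)

luckyCar? : ∀ {n} (a : Vec (Fin n) n) (i : Fin n) → Dec (LuckyCar a i)
luckyCar? a i = Maybe.≡-dec Fin._≟_ (lookup (park a) i) (just (lookup a i))

preferences : ∀ n m → List (Vec (Fin n) m)
preferences n zero    = [] ∷ []
preferences n (suc m) = cartesianProductWith _∷_ (allFin n) (preferences n m)

-- The spot j is given by its label, so that it makes sense for a fixed j and
-- varying n; q n i j is 0 when j is not one of 1, …, n.
q : (n : ℕ) → Fin n → ℕ → ℕ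
q n i j = length (filter
  (λ a → isParkingFunction? a ×-dec (label (lookup a i) ℕ.≟ j) ×-dec luckyCar? a i)
  (preferences n n))

-- The truncated n ∸ 1 differs from n - 1 only at n = 0, irrelevant to the limit.
luckyProbability : (j n : ℕ) → ℚ
luckyProbability j n =
  (+ sum (map (λ i → q n i j) (allFin n)) / (suc n ℕ.^ (n ℕ.∸ 1)))
    {{ℕ.m^n≢0 (suc n) (n ℕ.∸ 1)}}

IsCauchy : (ℕ → ℚ) → Set
IsCauchy s = ∀ ε → 0ℚ < ε → ∃[ N ] (∀ m n → N ℕ.≤ m → N ℕ.≤ n → ∣ s m - s n ∣ < ε)

record ℝ : Set where
  constructor mkℝ
  field
    approx : ℕ → ℚ
    cauchy : IsCauchy approx

open ℝ public

module Halving where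
  0<½*ε : ∀ {ε} → 0ℚ < ε → 0ℚ < ½ * ε
  0<½*ε {ε} 0<ε = positive⁻¹ (½ * ε) {{pos*pos⇒pos ½ ε {{positive 0<ε}}}}

  halves : ∀ ε → ½ * ε + ½ * ε ≡ ε
  halves ε = trans (sym (*-distribʳ-+ ε ½ ½)) (*-identityˡ ε)

open Halving

fromℚ : ℚ → ℝ
fromℚ p = mkℝ (λ _ → p) λ ε 0<ε → 0 , λ _ _ _ _ →
  subst (_< ε) (sym (cong ∣_∣ (+-inverseʳ p))) 0<ε

infixl 6 _+ᴿ_ _-ᴿ_
infixr 7 _·_
infix  4 _<ᴿ_ _⟶_

_+ᴿ_ : ℝ → ℝ → ℝ
x +ᴿ y = mkℝ (λ n → approx x n + approx y n) c
  where
  open +-*-Solver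
  regroup : ∀ a b c d → (a + b) - (c + d) ≡ (a - c) + (b - d)
  regroup = solve 4 (λ a b c d → (a :+ b) :- (c :+ d) := (a :- c) :+ (b :- d)) refl
  c : IsCauchy (λ n → approx x n + approx y n)
  c ε 0<ε with cauchy x (½ * ε) (0<½*ε 0<ε) | cauchy y (½ * ε) (0<½*ε 0<ε)
  ... | M , hM | N , hN = M ℕ.⊔ N , λ m n hm hn →
    let xm = approx x m ; xn = approx x n ; ym = approx y m ; yn = approx y n
        open ≤-Reasoning in begin-strict
    ∣ (xm + ym) - (xn + yn) ∣   ≡⟨ cong ∣_∣ (regroup xm ym xn yn) ⟩
    ∣ (xm - xn) + (ym - yn) ∣   ≤⟨ ∣p+q∣≤∣p∣+∣q∣ (xm - xn) (ym - yn) ⟩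
    ∣ xm - xn ∣ + ∣ ym - yn ∣   <⟨ +-mono-< (hM m n (ℕ.m⊔n≤o⇒m≤o M N hm) (ℕ.m⊔n≤o⇒m≤o M N hn))
                                            (hN m n (ℕ.m⊔n≤o⇒n≤o M N hm) (ℕ.m⊔n≤o⇒n≤o M N hn)) ⟩
    ½ * ε + ½ * ε               ≡⟨ halves ε ⟩
    ε                           ∎

_·_ : ℚ → ℝ → ℝ
p · x = mkℝ (λ n → p * approx x n) c
  where
  b : ℚ
  b = 1ℚ + ∣ p ∣
  instance
    b>0 : Positive b
    b>0 = pos+nonNeg⇒pos 1ℚ ∣ p ∣ {{∣-∣-nonNeg p}}
    b≢0 : NonZero b
    b≢0 = pos⇒nonZero b
    b⁻¹>0 : Positive (1/ b)
    b⁻¹>0 = 1/pos⇒pos b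
  factor : ∀ a b → p * a - p * b ≡ p * (a - b)
  factor a b = solve 3 (λ p a b → p :* a :- p :* b := p :* (a :- b)) refl p a b
    where open +-*-Solver
  p≤b : ∣ p ∣ ≤ b
  p≤b = subst (_≤ b) (+-identityˡ ∣ p ∣) (+-monoˡ-≤ ∣ p ∣ (nonNegative⁻¹ 1ℚ))
  c : IsCauchy (λ n → p * approx x n)
  c ε 0<ε with cauchy x (1/ b * ε) (positive⁻¹ (1/ b * ε) {{pos*pos⇒pos (1/ b) ε {{positive 0<ε}}}})
  ... | N , h = N , λ m n hm hn →
    let xm = approx x m ; xn = approx x n
        open ≤-Reasoning in begin-strict
    ∣ p * xm - p * xn ∣    ≡⟨ cong ∣_∣ (factor xm xn) ⟩
    ∣ p * (xm - xn) ∣      ≡⟨ ∣p*q∣≡∣p∣*∣q∣ p (xm - xn) ⟩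
    ∣ p ∣ * ∣ xm - xn ∣    ≤⟨ *-monoʳ-≤-nonNeg ∣ xm - xn ∣ {{∣-∣-nonNeg (xm - xn)}} p≤b ⟩
    b * ∣ xm - xn ∣        <⟨ *-monoʳ-<-pos b (h m n hm hn) ⟩
    b * (1/ b * ε)         ≡⟨ sym (*-assoc b (1/ b) ε) ⟩
    b * 1/ b * ε           ≡⟨ cong (_* ε) (*-inverseʳ b) ⟩
    1ℚ * ε                 ≡⟨ *-identityˡ ε ⟩
    ε                      ∎

_-ᴿ_ : ℝ → ℝ → ℝ
x -ᴿ y = x +ᴿ (- 1ℚ) · y

∣_∣ᴿ : ℝ → ℝ
∣ x ∣ᴿ = mkℝ (λ n → ∣ approx x n ∣) λ ε 0<ε → let N , h = cauchy x ε 0<ε in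
  N , λ m n hm hn → ≤-<-trans (reverse (approx x m) (approx x n)) (h m n hm hn)
  where
  open +-*-Solver
  open ≤-Reasoning
  oneSide : ∀ a b → ∣ a ∣ - ∣ b ∣ ≤ ∣ a - b ∣
  oneSide a b = begin
    ∣ a ∣ - ∣ b ∣                ≡⟨ cong (λ z → ∣ z ∣ - ∣ b ∣) (solve 2 (λ a b → a := (a :- b) :+ b) refl a b) ⟩
    ∣ (a - b) + b ∣ - ∣ b ∣      ≤⟨ +-monoˡ-≤ (- ∣ b ∣) (∣p+q∣≤∣p∣+∣q∣ (a - b) b) ⟩
    (∣ a - b ∣ + ∣ b ∣) - ∣ b ∣  ≡⟨ solve 2 (λ u v → (u :+ v) :- v := u) refl ∣ a - b ∣ ∣ b ∣ ⟩
    ∣ a - b ∣                    ∎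
  neg-swap : ∀ a b → - (a - b) ≡ b - a
  neg-swap = solve 2 (λ a b → :- (a :- b) := b :- a) refl
  reverse : ∀ a b → ∣ ∣ a ∣ - ∣ b ∣ ∣ ≤ ∣ a - b ∣
  reverse a b with ∣p∣≡p∨∣p∣≡-p (∣ a ∣ - ∣ b ∣)
  ... | inj₁ e = subst (_≤ ∣ a - b ∣) (sym e) (oneSide a b)
  ... | inj₂ e = begin
    ∣ ∣ a ∣ - ∣ b ∣ ∣  ≡⟨ e ⟩
    - (∣ a ∣ - ∣ b ∣)  ≡⟨ neg-swap ∣ a ∣ ∣ b ∣ ⟩
    ∣ b ∣ - ∣ a ∣      ≤⟨ oneSide b a ⟩
    ∣ b - a ∣          ≡⟨ cong ∣_∣ (sym (neg-swap a b)) ⟩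
    ∣ - (a - b) ∣      ≡⟨ ∣-p∣≡∣p∣ (a - b) ⟩
    ∣ a - b ∣          ∎

_<ᴿ_ : ℝ → ℝ → Set
x <ᴿ y = ∃[ δ ] (0ℚ < δ × ∃[ N ] (∀ n → N ℕ.≤ n → approx x n + δ ≤ approx y n))

-- Rational ε suffice, since every positive real is bounded below by a
-- positive rational.
_⟶_ : (ℕ → ℝ) → ℝ → Set
s ⟶ L = ∀ ε → 0ℚ < ε → ∃[ N ] (∀ n → N ℕ.≤ n → ∣ s n -ᴿ L ∣ᴿ <ᴿ fromℚ ε)

-- x^k / k!
expTerm : ℚ → ℕ → ℚ
expTerm x zero    = 1ℚ
expTerm x (suc k) = expTerm x k * (x * (+ 1 / suc k))

-- Σ_{k < n} x^k / k!
expSum : ℚ → ℕ → ℚ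
expSum x zero    = 0ℚ
expSum x (suc n) = expSum x n + expTerm x n

module ExpLemmas where
  ι : ℕ → ℚ
  ι n = + n / 1

  ι-suc : ∀ n → ι (suc n) ≡ 1ℚ + ι n
  ι-suc n = toℚᵘ-injective (begin
    toℚᵘ (ι (suc n))                  ≈⟨ toℚᵘ-fromℚᵘ (ℚᵘ.mkℚᵘ (+ suc n) 0) ⟩
    ℚᵘ.mkℚᵘ (+ suc n) 0               ≈⟨ ℚᵘ.*≡* (cong (ℤ._* + 1) (cong (λ z → + 1 ℤ.+ z) (sym (ℤ.*-identityʳ (+ n))))) ⟩
    ℚᵘ.1ℚᵘ ℚᵘ.+ ℚᵘ.mkℚᵘ (+ n) 0       ≈⟨ ℚᵘ.+-congʳ ℚᵘ.1ℚᵘ (ℚᵘ.≃-sym (toℚᵘ-fromℚᵘ (ℚᵘ.mkℚᵘ (+ n) 0))) ⟩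
    toℚᵘ 1ℚ ℚᵘ.+ toℚᵘ (ι n)           ≈⟨ ℚᵘ.≃-sym (toℚᵘ-homo-+ 1ℚ (ι n)) ⟩
    toℚᵘ (1ℚ + ι n)                   ∎)
    where open ℚᵘ.≃-Reasoning

  ι-nonNeg : ∀ n → NonNegative (ι n)
  ι-nonNeg n = normalize-nonNeg n 1

  ι-pos : ∀ n → Positive (ι (suc n))
  ι-pos n = normalize-pos (suc n) 1

  ceil : ∀ p → ∃[ N ] p ≤ ι N
  ceil p = ℤ.∣ ↥ p ∣ , toℚᵘ-cancel-≤ (ℚᵘ.≤-respʳ-≃
    (ℚᵘ.≃-sym (toℚᵘ-fromℚᵘ (ℚᵘ.mkℚᵘ (+ ℤ.∣ ↥ p ∣) 0))) (bound p))
    where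
    i≤∣i∣ : ∀ i → i ℤ.≤ + ℤ.∣ i ∣
    i≤∣i∣ (+ n)      = ℤ.≤-refl
    i≤∣i∣ (-[1+ n ]) = ℤ.-≤+
    bound : ∀ p → toℚᵘ p ℚᵘ.≤ ℚᵘ.mkℚᵘ (+ ℤ.∣ ↥ p ∣) 0
    bound p@record{} = ℚᵘ.*≤* (begin
      ↥ p ℤ.* + 1             ≡⟨ ℤ.*-identityʳ (↥ p) ⟩
      ↥ p                     ≤⟨ i≤∣i∣ (↥ p) ⟩
      + ℤ.∣ ↥ p ∣             ≤⟨ ℤ.+≤+ (ℕ.m≤m*n ℤ.∣ ↥ p ∣ (↧ₙ p)) ⟩
      + (ℤ.∣ ↥ p ∣ ℕ.* ↧ₙ p)  ≡⟨ ℤ.pos-* ℤ.∣ ↥ p ∣ (↧ₙ p) ⟩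
      + ℤ.∣ ↥ p ∣ ℤ.* ↧ p     ∎)
      where open ℤ.≤-Reasoning

  archimedean : ∀ p ε → 0ℚ < ε → ∃[ d ] p < ι (suc d) * ε
  archimedean p ε 0<ε = let N , h = ceil (p * 1/ ε) in N , (begin-strict
    p               ≡⟨ sym (*-identityʳ p) ⟩
    p * 1ℚ          ≡⟨ cong (p *_) (sym (*-inverseˡ ε)) ⟩
    p * (1/ ε * ε)  ≡⟨ sym (*-assoc p (1/ ε) ε) ⟩
    p * 1/ ε * ε    ≤⟨ *-monoʳ-≤-nonNeg ε {{pos⇒nonNeg ε}} h ⟩
    ι N * ε         <⟨ *-monoˡ-<-pos ε (N<1+N N) ⟩
    ι (suc N) * ε   ∎)
    where
    open ≤-Reasoning
    instance
      ε>0 : Positive ε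
      ε>0 = positive 0<ε
      ε≢0 : NonZero ε
      ε≢0 = pos⇒nonZero ε
    N<1+N : ∀ N → ι N < ι (suc N)
    N<1+N N = subst (ι N <_) (sym (ι-suc N))
      (subst (_< 1ℚ + ι N) (+-identityˡ (ι N)) (+-monoˡ-< (ι N) (positive⁻¹ 1ℚ)))

  module ExpCauchy (x : ℚ) where
    open ≤-Reasoning

    t : ℕ → ℚ
    t k = ∣ expTerm x k ∣

    M K : ℕ
    M = proj₁ (ceil ∣ x ∣)
    K = M ℕ.* 2

    ratio : ∀ k → K ℕ.≤ k → ∣ x * (+ 1 / suc k) ∣ ≤ ½
    ratio k K≤k = begin
      ∣ x * (+ 1 / suc k) ∣      ≡⟨ ∣p*q∣≡∣p∣*∣q∣ x (+ 1 / suc k) ⟩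
      ∣ x ∣ * ∣ + 1 / suc k ∣    ≡⟨ cong (∣ x ∣ *_) (0≤p⇒∣p∣≡p (nonNegative⁻¹ r {{r≥0}})) ⟩
      ∣ x ∣ * r                  ≤⟨ *-monoʳ-≤-nonNeg r {{r≥0}} (proj₂ (ceil ∣ x ∣)) ⟩
      ι M * r                    ≤⟨ toℚᵘ-cancel-≤ unnormalised ⟩
      ½                          ∎
      where
      r : ℚ
      r = + 1 / suc k
      r≥0 : NonNegative r
      r≥0 = normalize-nonNeg 1 (suc k)
      cross : (+ M ℤ.* + 1) ℤ.* + 2 ℤ.≤ + 1 ℤ.* + suc (k ℕ.+ 0)
      cross = subst (ℤ._≤ _) (trans (ℤ.pos-* M 2) (cong (ℤ._* + 2) (sym (ℤ.*-identityʳ (+ M)))))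
        (subst (λ z → + K ℤ.≤ z) (sym (ℤ.*-identityˡ _))
          (ℤ.+≤+ (ℕ.m≤n⇒m≤1+n (subst (K ℕ.≤_) (sym (ℕ.+-identityʳ k)) K≤k))))
      unnormalised : toℚᵘ (ι M * r) ℚᵘ.≤ toℚᵘ ½
      unnormalised = ℚᵘ.≤-respˡ-≃ (ℚᵘ.≃-sym (ℚᵘ.≃-trans (toℚᵘ-homo-* (ι M) r)
        (ℚᵘ.*-cong (toℚᵘ-fromℚᵘ (ℚᵘ.mkℚᵘ (+ M) 0)) (toℚᵘ-fromℚᵘ (ℚᵘ.mkℚᵘ (+ 1) k)))))
        (ℚᵘ.*≤* cross)

    t-halves : ∀ k → K ℕ.≤ k → t (suc k) ≤ t k * ½
    t-halves k K≤k = begin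
      ∣ expTerm x k * (x * (+ 1 / suc k)) ∣   ≡⟨ ∣p*q∣≡∣p∣*∣q∣ (expTerm x k) (x * (+ 1 / suc k)) ⟩
      t k * ∣ x * (+ 1 / suc k) ∣             ≤⟨ *-monoˡ-≤-nonNeg (t k) {{∣-∣-nonNeg (expTerm x k)}} (ratio k K≤k) ⟩
      t k * ½                                 ∎

    t-bound : ∀ d → t (K ℕ.+ d) * ι (suc d) ≤ t K
    t-bound zero    = ≤-reflexive (trans (cong (λ k → t k * 1ℚ) (ℕ.+-identityʳ K)) (*-identityʳ (t K)))
    t-bound (suc d) = begin
      t (K ℕ.+ suc d) * ι (2 ℕ.+ d)        ≡⟨ cong (λ k → t k * ι (2 ℕ.+ d)) (ℕ.+-suc K d) ⟩
      t (suc k) * ι (2 ℕ.+ d)              ≤⟨ *-monoʳ-≤-nonNeg (ι (2 ℕ.+ d)) {{ι-nonNeg (2 ℕ.+ d)}} (t-halves k (ℕ.m≤m+n K d)) ⟩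
      t k * ½ * ι (2 ℕ.+ d)                ≡⟨ *-assoc (t k) ½ (ι (2 ℕ.+ d)) ⟩
      t k * (½ * ι (2 ℕ.+ d))              ≤⟨ *-monoˡ-≤-nonNeg (t k) {{∣-∣-nonNeg (expTerm x k)}} half ⟩
      t k * ι (suc d)                      ≤⟨ t-bound d ⟩
      t K                                  ∎
      where
      k : ℕ
      k = K ℕ.+ d
      1≤ : 1ℚ ≤ ι (suc d)
      1≤ = subst (1ℚ ≤_) (sym (ι-suc d))
        (subst (_≤ 1ℚ + ι d) (+-identityʳ 1ℚ) (+-monoʳ-≤ 1ℚ (nonNegative⁻¹ (ι d) {{ι-nonNeg d}})))
      half : ½ * ι (2 ℕ.+ d) ≤ ι (suc d)
      half = begin
        ½ * ι (2 ℕ.+ d)                    ≡⟨ cong (½ *_) (ι-suc (suc d)) ⟩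
        ½ * (1ℚ + ι (suc d))               ≤⟨ *-monoˡ-≤-nonNeg ½ (+-monoˡ-≤ (ι (suc d)) 1≤) ⟩
        ½ * (ι (suc d) + ι (suc d))        ≡⟨ *-distribˡ-+ ½ (ι (suc d)) (ι (suc d)) ⟩
        ½ * ι (suc d) + ½ * ι (suc d)      ≡⟨ halves (ι (suc d)) ⟩
        ι (suc d)                          ∎

    S : ℕ → ℚ
    S = expSum x

    tail : ∀ N → K ℕ.≤ N → ∀ d →
      ∣ S (N ℕ.+ d) - S N ∣ + (t (N ℕ.+ d) + t (N ℕ.+ d)) ≤ t N + t N
    tail N K≤N zero = ≤-reflexive (trans
      (cong (λ k → ∣ S k - S N ∣ + (t k + t k)) (ℕ.+-identityʳ N))
      (trans (cong (λ z → ∣ z ∣ + (t N + t N)) (+-inverseʳ (S N))) (+-identityˡ _)))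
    tail N K≤N (suc d) = begin
      ∣ S (N ℕ.+ suc d) - S N ∣ + (t (N ℕ.+ suc d) + t (N ℕ.+ suc d))
        ≡⟨ cong (λ k → ∣ S k - S N ∣ + (t k + t k)) (ℕ.+-suc N d) ⟩
      ∣ (S k + e) - S N ∣ + (t (suc k) + t (suc k))
        ≡⟨ cong (λ z → ∣ z ∣ + (t (suc k) + t (suc k))) (swap (S k) e (S N)) ⟩
      ∣ (S k - S N) + e ∣ + (t (suc k) + t (suc k))
        ≤⟨ +-mono-≤ (∣p+q∣≤∣p∣+∣q∣ (S k - S N) e) (+-mono-≤ h h) ⟩
      (∣ S k - S N ∣ + t k) + (t k * ½ + t k * ½)
        ≡⟨ cong (λ z → (∣ S k - S N ∣ + t k) + z) (trans (cong₂ _+_ (*-comm (t k) ½) (*-comm (t k) ½)) (halves (t k))) ⟩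
      (∣ S k - S N ∣ + t k) + t k
        ≡⟨ +-assoc ∣ S k - S N ∣ (t k) (t k) ⟩
      ∣ S k - S N ∣ + (t k + t k)
        ≤⟨ tail N K≤N d ⟩
      t N + t N ∎
      where
      k : ℕ
      k = N ℕ.+ d
      e : ℚ
      e = expTerm x k
      h : t (suc k) ≤ t k * ½
      h = t-halves k (ℕ.≤-trans K≤N (ℕ.m≤m+n N d))
      swap : ∀ a b c → (a + b) - c ≡ (a - c) + b
      swap = solve 3 (λ a b c → (a :+ b) :- c := (a :- c) :+ b) refl
        where open +-*-Solver

    tail′ : ∀ N → K ℕ.≤ N → ∀ n → N ℕ.≤ n → ∣ S n - S N ∣ ≤ t N + t N
    tail′ N K≤N n N≤n = begin
      ∣ S n - S N ∣                    ≡⟨ sym (+-identityʳ _) ⟩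
      ∣ S n - S N ∣ + 0ℚ               ≤⟨ +-monoʳ-≤ ∣ S n - S N ∣ (+-mono-≤ (0≤∣p∣ (expTerm x n)) (0≤∣p∣ (expTerm x n))) ⟩
      ∣ S n - S N ∣ + (t n + t n)      ≤⟨ subst (λ k → ∣ S k - S N ∣ + (t k + t k) ≤ t N + t N)
                                            (ℕ.m+[n∸m]≡n N≤n) (tail N K≤N (n ℕ.∸ N)) ⟩
      t N + t N                        ∎

    expCauchy : IsCauchy S
    expCauchy ε 0<ε = N , λ m n N≤m N≤n → begin-strict
      ∣ S m - S n ∣                        ≡⟨ cong ∣_∣ (via (S m) (S n) (S N)) ⟩
      ∣ (S m - S N) - (S n - S N) ∣        ≤⟨ ∣p-q∣≤∣p∣+∣q∣ (S m - S N) (S n - S N) ⟩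
      ∣ S m - S N ∣ + ∣ S n - S N ∣        ≤⟨ +-mono-≤ (tail′ N (ℕ.m≤m+n K d) m N≤m) (tail′ N (ℕ.m≤m+n K d) n N≤n) ⟩
      (t N + t N) + (t N + t N)            ≡⟨ four (t N) ⟩
      four′ * t N                          <⟨ *-cancelʳ-<-nonNeg (ι (suc d)) {{ι-nonNeg (suc d)}} small ⟩
      ε                                    ∎
      where
      four′ : ℚ
      four′ = + 4 / 1
      d N : ℕ
      d = proj₁ (archimedean (four′ * t K) ε 0<ε)
      N = K ℕ.+ d
      via : ∀ a b c → a - b ≡ (a - c) - (b - c)
      via = solve 3 (λ a b c → a :- b := (a :- c) :- (b :- c)) refl
        where open +-*-Solver
      four : ∀ a → (a + a) + (a + a) ≡ four′ * a
      four = solve 1 (λ a → (a :+ a) :+ (a :+ a) := con four′ :* a) refl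
        where open +-*-Solver
      small : four′ * t N * ι (suc d) < ε * ι (suc d)
      small = begin-strict
        four′ * t N * ι (suc d)      ≡⟨ *-assoc four′ (t N) (ι (suc d)) ⟩
        four′ * (t N * ι (suc d))    ≤⟨ *-monoˡ-≤-nonNeg four′ (t-bound d) ⟩
        four′ * t K                  <⟨ proj₂ (archimedean (four′ * t K) ε 0<ε) ⟩
        ι (suc d) * ε                ≡⟨ *-comm (ι (suc d)) ε ⟩
        ε * ι (suc d)                ∎

open ExpLemmas

exp : ℚ → ℝ
exp x = mkℝ (expSum x) (ExpCauchy.expCauchy x)

{-# OPTIONS --safe #-}
-- Put j = k + 1 and x = n - k. Which spots fill up, and how many cars overflow,
-- depends only on the content of a preference sequence. Cutting the street after
-- spot j, the number of parking functions of 1, …, n with spot j lucky is therefore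
--   Σ_s C(n, s) w(s) (s - k) x^(n - s - 1),
-- where w(s) counts the sequences of s preferences on 1, …, j that fill these spots
-- and make j lucky, and the last two factors count the ways to fill the remaining
-- n - j spots when s - j cars overflow. If filling is not required, there are
-- (j + 1)/(2j) · j^s sequences that make j lucky, provided s ≥ j. Those with a first
-- free spot i < j consist of a parking function of 1, …, i - 1 and a sequence on
-- i + 1, …, j that makes j lucky. When the resulting closed form of w(s), valid for
-- s ≥ j, is used for all s, the sequences with a free spot contribute 0 by the
-- binomial theorem, and the others contribute (j + 1)/(2j) · (n + 1)^(n - 1). The
-- terms with s < k, where w(s) is really 0, have to be taken back; relative to
-- (n + 1)^(n - 1) each of them is (1 - j/(n + 1))^(n - 1) → e^(-j) times a convergent
-- sequence.
module Submission where

open import Defs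
open import Data.Bool.Base using (Bool; true; false; _∧_; if_then_else_)
open import Data.Fin.Base using (Fin; zero; suc; _↑ʳ_)
import Data.Fin.Properties as Fin
open import Data.Fin.Subset using (Subset; inside; outside)
open import Data.Integer.Base using (+_)
import Data.Integer.Base as ℤ
import Data.Integer.Properties as ℤ
open import Data.List.Base as List using (List; []; _∷_; allFin; tabulate; filter; length; cartesianProductWith)
open import Data.Maybe.Base as Maybe using (Maybe; just; nothing)
import Data.Maybe.Properties as Maybe
import Data.Maybe.Relation.Unary.Any as MaybeAny
open import Data.Nat.Base as ℕ using (ℕ; zero; suc; z≤n; s≤s)
import Data.Nat.ListAction as ℕ
import Data.Nat.Properties as ℕ
open import Data.Product.Base using (_×_; _,_; ∃-syntax)
open import Data.Rational.Base
open import Data.Rational.Properties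
import Data.Rational.Unnormalised.Base as ℚᵘ
import Data.Rational.Unnormalised.Properties as ℚᵘ
open import Data.Sum.Base using (inj₁; inj₂)
open import Data.Unit.Base using (⊤)
open import Data.Vec.Base using (Vec; []; _∷_; _++_; replicate; lookup; _[_]≔_)
open import Data.Vec.Relation.Unary.All using (all?)
open import Algebra.Definitions.RawSemiring +-*-rawSemiring using (_^_)
open import Level using (0ℓ)
open import Relation.Binary.Definitions using (tri<; tri≈; tri>)
open import Relation.Binary.PropositionalEquality using (_≡_; _≢_; refl; sym; trans; cong; cong₂; subst; module ≡-Reasoning)
open import Relation.Nullary.Decidable using (yes; no; does; dec-true; dec-false; dec⇒maybe)
open import Relation.Unary using (Decidable)
open import Tactic.RingSolver using (solve-∀)
open import Tactic.RingSolver.Core.AlmostCommutativeRing using (AlmostCommutativeRing; fromCommutativeRing)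
open Halving using (0<½*ε; halves)
open ExpLemmas using (ι; ι-suc; ι-nonNeg; ι-pos; archimedean)

-- Filling a street depends only on the content of a sequence, but luckiness depends on the order of
-- the cars. So two kinds of recursion coexist. Recursions in time split off the first car with
-- `nextCar`; they define `parkings`, `lucky`, `luckyFill` and `luckyParkings` and match the parking
-- process. The recursion in space, `fill`, splits off the first spot; it can be cut at a spot and
-- summed by the binomial theorem. The bridge is `fill-time`: a space recursion also obeys the
-- recursion in time. The constant (j + 1)/(2j) arises as follows. Of l cars, some t come before the
-- first one that prefers j; they all park on the j - 1 spots before j, in (j - t) j^(t - 1) ways,
-- and the l - 1 - t cars after it are arbitrary. Summing over t < j gives (1 + ... + j) j^(l - 2).
-- In the limit, the claimed reals have approximations built from the very partial sums `expSum`
-- that approximate the probabilities, so the two sides are compared as rational sequences.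

ℚ-ring : AlmostCommutativeRing 0ℓ 0ℓ
ℚ-ring = fromCommutativeRing +-*-commutativeRing (λ x → dec⇒maybe (0ℚ ≟ x))

-- Natural numbers and fractions in ℚ

ι-+ : ∀ m n → ι (m ℕ.+ n) ≡ ι m + ι n
ι-+ zero    n = sym (+-identityˡ (ι n))
ι-+ (suc m) n = begin
  ι (suc (m ℕ.+ n))     ≡⟨ ι-suc (m ℕ.+ n) ⟩
  1ℚ + ι (m ℕ.+ n)      ≡⟨ cong (_+_ 1ℚ) (ι-+ m n) ⟩
  1ℚ + (ι m + ι n)      ≡⟨ +-assoc 1ℚ (ι m) (ι n) ⟨
  (1ℚ + ι m) + ι n      ≡⟨ cong (_+ ι n) (ι-suc m) ⟨
  ι (suc m) + ι n       ∎
  where open ≡-Reasoning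

ι-* : ∀ m n → ι (m ℕ.* n) ≡ ι m * ι n
ι-* zero    n = sym (*-zeroˡ (ι n))
ι-* (suc m) n = begin
  ι (n ℕ.+ m ℕ.* n)     ≡⟨ ι-+ n (m ℕ.* n) ⟩
  ι n + ι (m ℕ.* n)     ≡⟨ cong (_+_ (ι n)) (ι-* m n) ⟩
  ι n + ι m * ι n       ≡⟨ distrib (ι n) (ι m) ⟩
  (1ℚ + ι m) * ι n      ≡⟨ cong (_* ι n) (ι-suc m) ⟨
  ι (suc m) * ι n       ∎
  where
  open ≡-Reasoning
  distrib : ∀ n m → n + m * n ≡ (1ℚ + m) * n
  distrib = solve-∀ ℚ-ring

ι-^ : ∀ m n → ι (m ℕ.^ n) ≡ ι m ^ n
ι-^ m zero    = refl
ι-^ m (suc n) = trans (ι-* m (m ℕ.^ n)) (cong (ι m *_) (ι-^ m n))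

/-*-cancel : ∀ a b .{{_ : ℕ.NonZero b}} → (+ a / b) * ι b ≡ ι a
/-*-cancel a b@(suc b-1) = toℚᵘ-injective (begin
  toℚᵘ ((+ a / b) * ι b)                      ≈⟨ toℚᵘ-homo-* (+ a / b) (ι b) ⟩
  toℚᵘ (+ a / b) ℚᵘ.* toℚᵘ (ι b)              ≈⟨ ℚᵘ.*-cong (toℚᵘ-fromℚᵘ (ℚᵘ.mkℚᵘ (+ a) b-1)) (toℚᵘ-fromℚᵘ (ℚᵘ.mkℚᵘ (+ b) 0)) ⟩
  ℚᵘ.mkℚᵘ (+ a) b-1 ℚᵘ.* ℚᵘ.mkℚᵘ (+ b) 0      ≈⟨ ℚᵘ.*≡* (trans (ℤ.*-identityʳ _) (cong (λ d → + a ℤ.* + d) (sym (ℕ.*-identityʳ b)))) ⟩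
  ℚᵘ.mkℚᵘ (+ a) 0                             ≈⟨ toℚᵘ-fromℚᵘ (ℚᵘ.mkℚᵘ (+ a) 0) ⟨
  toℚᵘ (ι a)                                  ∎)
  where open ℚᵘ.≃-Reasoning

*-cancelˡ-pos : ∀ r .{{_ : Positive r}} {p q} → r * p ≡ r * q → p ≡ q
*-cancelˡ-pos r eq = ≤-antisym (*-cancelˡ-≤-pos r (≤-reflexive eq)) (*-cancelˡ-≤-pos r (≤-reflexive (sym eq)))

1^ : ∀ n → 1ℚ ^ n ≡ 1ℚ
1^ zero    = refl
1^ (suc n) = trans (*-identityˡ (1ℚ ^ n)) (1^ n)

-- Binomial sums

-- binSum m F = Σ_{a + b = m} (m choose a) F a b; this recursion is Pascal's rule.
binSum : ℕ → (ℕ → ℕ → ℚ) → ℚ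
binSum zero    F = F 0 0
binSum (suc m) F = binSum m (λ a b → F (suc a) b) + binSum m (λ a b → F a (suc b))

binSum-cong : ∀ m {F G} → (∀ a b → a ℕ.+ b ≡ m → F a b ≡ G a b) → binSum m F ≡ binSum m G
binSum-cong zero    F≡G = F≡G 0 0 refl
binSum-cong (suc m) F≡G = cong₂ _+_
  (binSum-cong m (λ a b e → F≡G (suc a) b (cong suc e)))
  (binSum-cong m (λ a b e → F≡G a (suc b) (trans (ℕ.+-suc a b) (cong suc e))))

+-interchange : ∀ a b c d → (a + b) + (c + d) ≡ (a + c) + (b + d)
+-interchange = solve-∀ ℚ-ring

binSum-+ : ∀ m F G → binSum m (λ a b → F a b + G a b) ≡ binSum m F + binSum m G
binSum-+ zero    F G = refl
binSum-+ (suc m) F G = trans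
  (cong₂ _+_ (binSum-+ m (λ a → F (suc a)) (λ a → G (suc a)))
             (binSum-+ m (λ a b → F a (suc b)) (λ a b → G a (suc b))))
  (+-interchange (binSum m (λ a → F (suc a))) _ _ _)

binSum-*ˡ : ∀ m c F → binSum m (λ a b → c * F a b) ≡ c * binSum m F
binSum-*ˡ zero    c F = refl
binSum-*ˡ (suc m) c F = trans
  (cong₂ _+_ (binSum-*ˡ m c (λ a → F (suc a))) (binSum-*ˡ m c (λ a b → F a (suc b))))
  (sym (*-distribˡ-+ c _ _))

binSum-*ʳ : ∀ m c F → binSum m (λ a b → F a b * c) ≡ binSum m F * c
binSum-*ʳ zero    c F = refl
binSum-*ʳ (suc m) c F = trans
  (cong₂ _+_ (binSum-*ʳ m c (λ a → F (suc a))) (binSum-*ʳ m c (λ a b → F a (suc b))))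
  (sym (*-distribʳ-+ c (binSum m (λ a → F (suc a))) _))

binSum-0 : ∀ m → binSum m (λ _ _ → 0ℚ) ≡ 0ℚ
binSum-0 zero    = refl
binSum-0 (suc m) = cong₂ _+_ (binSum-0 m) (binSum-0 m)

-- Both sides are the trinomial sum over a + c + d = m. This regroups the cars that prefer a
-- peeled-off spot with those to its right.
binSum-assoc : ∀ m (F : ℕ → ℕ → ℕ → ℚ) →
  binSum m (λ t d → binSum t (λ a c → F a c d)) ≡ binSum m (λ a t → binSum t (F a))
binSum-assoc zero    F = refl
binSum-assoc (suc m) F = begin
  binSum m (λ t d → binSum t (λ a c → F (suc a) c d) + binSum t (λ a c → F a (suc c) d))
    + binSum m (λ t d → binSum t (λ a c → F a c (suc d)))
    ≡⟨ cong (_+ binSum m (λ t d → binSum t (λ a c → F a c (suc d))))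
         (binSum-+ m (λ t d → binSum t (λ a c → F (suc a) c d)) (λ t d → binSum t (λ a c → F a (suc c) d))) ⟩
  binSum m (λ t d → binSum t (λ a c → F (suc a) c d)) + binSum m (λ t d → binSum t (λ a c → F a (suc c) d))
    + binSum m (λ t d → binSum t (λ a c → F a c (suc d)))
    ≡⟨ cong₂ _+_ (cong₂ _+_ (binSum-assoc m (λ a → F (suc a))) (binSum-assoc m (λ a c → F a (suc c))))
                 (binSum-assoc m (λ a c d → F a c (suc d))) ⟩
  binSum m (λ a t → binSum t (F (suc a))) + binSum m (λ a t → binSum t (λ c → F a (suc c)))
    + binSum m (λ a t → binSum t (λ c d → F a c (suc d)))
    ≡⟨ +-assoc (binSum m (λ a t → binSum t (F (suc a)))) _ _ ⟩
  binSum m (λ a t → binSum t (F (suc a)))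
    + (binSum m (λ a t → binSum t (λ c → F a (suc c))) + binSum m (λ a t → binSum t (λ c d → F a c (suc d))))
    ≡⟨ cong (_+_ (binSum m (λ a t → binSum t (F (suc a)))))
         (binSum-+ m (λ a t → binSum t (λ c → F a (suc c))) (λ a t → binSum t (λ c d → F a c (suc d)))) ⟨
  binSum (suc m) (λ a t → binSum t (F a)) ∎
  where open ≡-Reasoning

binomial-theorem : ∀ m x y → binSum m (λ a b → y ^ a * x ^ b) ≡ (y + x) ^ m
binomial-theorem zero    x y = refl
binomial-theorem (suc m) x y = begin
  binSum m (λ a b → y * y ^ a * x ^ b) + binSum m (λ a b → y ^ a * (x * x ^ b))
    ≡⟨ cong₂ _+_ (binSum-cong m (λ a b _ → *-assoc y (y ^ a) (x ^ b)))
                 (binSum-cong m (λ a b _ → *-swap (y ^ a) x (x ^ b))) ⟩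
  binSum m (λ a b → y * (y ^ a * x ^ b)) + binSum m (λ a b → x * (y ^ a * x ^ b))
    ≡⟨ cong₂ _+_ (trans (binSum-*ˡ m y _) (cong (y *_) (binomial-theorem m x y)))
                 (trans (binSum-*ˡ m x _) (cong (x *_) (binomial-theorem m x y))) ⟩
  y * (y + x) ^ m + x * (y + x) ^ m
    ≡⟨ *-distribʳ-+ ((y + x) ^ m) y x ⟨
  (y + x) * (y + x) ^ m ∎
  where
  open ≡-Reasoning
  *-swap : ∀ a b c → a * (b * c) ≡ b * (a * c)
  *-swap = solve-∀ ℚ-ring

-- The y-derivative of the binomial theorem, multiplied by y (y + x).
binomial-theorem′ : ∀ m x y →
  (y + x) * binSum m (λ a b → ι a * (y ^ a * x ^ b)) ≡ ι m * (y * (y + x) ^ m)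
binomial-theorem′ zero    x y = vanish (y + x) y
  where
  vanish : ∀ z y → z * (0ℚ * (1ℚ * 1ℚ)) ≡ 0ℚ * (y * 1ℚ)
  vanish = solve-∀ ℚ-ring
binomial-theorem′ (suc m) x y = begin
  z * (binSum m (λ a b → ι (suc a) * (y * y ^ a * x ^ b)) + binSum m (λ a b → ι a * (y ^ a * (x * x ^ b))))
    ≡⟨ cong (z *_) (cong₂ _+_
         (trans (binSum-cong m (λ a b _ → trans (cong (_* (y * y ^ a * x ^ b)) (ι-suc a)) (expandʸ (ι a) y (y ^ a) (x ^ b))))
           (trans (binSum-+ m (λ a b → y * (y ^ a * x ^ b)) _)
             (cong₂ _+_ (trans (binSum-*ˡ m y _) (cong (y *_) (binomial-theorem m x y))) (binSum-*ˡ m y _))))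
         (trans (binSum-cong m (λ a b _ → expandˣ (ι a) (y ^ a) x (x ^ b))) (binSum-*ˡ m x _))) ⟩
  z * ((y * z ^ m + y * D) + x * D)
    ≡⟨ collect x y (z ^ m) D ⟩
  z * (z * D) + y * (z * z ^ m)
    ≡⟨ cong (λ d → z * d + y * (z * z ^ m)) (binomial-theorem′ m x y) ⟩
  z * (ι m * (y * z ^ m)) + y * (z * z ^ m)
    ≡⟨ regroup z (ι m) y (z ^ m) ⟩
  (1ℚ + ι m) * (y * (z * z ^ m))
    ≡⟨ cong (_* (y * (z * z ^ m))) (ι-suc m) ⟨
  ι (suc m) * (y * (z * z ^ m)) ∎
  where
  open ≡-Reasoning
  z D : ℚ
  z = y + x
  D = binSum m (λ a b → ι a * (y ^ a * x ^ b))
  expandʸ : ∀ i y p q → (1ℚ + i) * (y * p * q) ≡ y * (p * q) + y * (i * (p * q))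
  expandʸ = solve-∀ ℚ-ring
  expandˣ : ∀ i p x q → i * (p * (x * q)) ≡ x * (i * (p * q))
  expandˣ = solve-∀ ℚ-ring
  collect : ∀ x y p d → (y + x) * ((y * p + y * d) + x * d) ≡ (y + x) * ((y + x) * d) + y * ((y + x) * p)
  collect = solve-∀ ℚ-ring
  regroup : ∀ z i y p → z * (i * (y * p)) + y * (z * p) ≡ (1ℚ + i) * (y * (z * p))
  regroup = solve-∀ ℚ-ring

-- States of the street and one more car

free : ∀ {n} → Subset n → ℕ
free []              = 0
free (outside ∷ occ) = suc (free occ)
free (inside  ∷ occ) = free occ

-- The value of f after one more car has driven in from the left of the street,
-- and the sum of the values of f after one more car, over all preferences of
-- that car. A car that fails to park counts 0.
enter nextCar : ∀ {n} → (Subset n → ℚ) → Subset n → ℚ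
enter f []              = 0ℚ
enter f (outside ∷ occ) = f (inside ∷ occ)
enter f (inside  ∷ occ) = enter (λ o → f (inside ∷ o)) occ
nextCar f []        = 0ℚ
nextCar f (s ∷ occ) = enter f (s ∷ occ) + nextCar (λ o → f (s ∷ o)) occ

-- A car that parks uses up one free spot, so agreement on states with one free spot fewer is
-- enough. Inductions that tie the number of cars to `free` rely on this.
enter-cong : ∀ {n} {f g : Subset n → ℚ} occ →
  (∀ o → suc (free o) ≡ free occ → f o ≡ g o) → enter f occ ≡ enter g occ
enter-cong []              f≡g = refl
enter-cong (outside ∷ occ) f≡g = f≡g (inside ∷ occ) refl
enter-cong (inside  ∷ occ) f≡g = enter-cong occ (λ o → f≡g (inside ∷ o))

nextCar-cong : ∀ {n} {f g : Subset n → ℚ} occ →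
  (∀ o → suc (free o) ≡ free occ → f o ≡ g o) → nextCar f occ ≡ nextCar g occ
nextCar-cong []              f≡g = refl
nextCar-cong (outside ∷ occ) f≡g =
  cong₂ _+_ (f≡g (inside ∷ occ) refl) (nextCar-cong occ (λ o e → f≡g (outside ∷ o) (cong suc e)))
nextCar-cong (inside  ∷ occ) f≡g =
  cong₂ _+_ (enter-cong occ (λ o → f≡g (inside ∷ o))) (nextCar-cong occ (λ o → f≡g (inside ∷ o)))

enter-+ : ∀ {n} (f g : Subset n → ℚ) occ → enter (λ o → f o + g o) occ ≡ enter f occ + enter g occ
enter-+ f g []              = refl
enter-+ f g (outside ∷ occ) = refl
enter-+ f g (inside  ∷ occ) = enter-+ (λ o → f (inside ∷ o)) (λ o → g (inside ∷ o)) occ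

nextCar-+ : ∀ {n} (f g : Subset n → ℚ) occ → nextCar (λ o → f o + g o) occ ≡ nextCar f occ + nextCar g occ
nextCar-+ f g []        = refl
nextCar-+ f g (s ∷ occ) = trans
  (cong₂ _+_ (enter-+ f g (s ∷ occ)) (nextCar-+ (λ o → f (s ∷ o)) (λ o → g (s ∷ o)) occ))
  (+-interchange (enter f (s ∷ occ)) (enter g (s ∷ occ)) _ _)

enter-*ˡ : ∀ {n} c (f : Subset n → ℚ) occ → enter (λ o → c * f o) occ ≡ c * enter f occ
enter-*ˡ c f []              = sym (*-zeroʳ c)
enter-*ˡ c f (outside ∷ occ) = refl
enter-*ˡ c f (inside  ∷ occ) = enter-*ˡ c (λ o → f (inside ∷ o)) occ

nextCar-*ˡ : ∀ {n} c (f : Subset n → ℚ) occ → nextCar (λ o → c * f o) occ ≡ c * nextCar f occ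
nextCar-*ˡ c f []        = sym (*-zeroʳ c)
nextCar-*ˡ c f (s ∷ occ) = trans
  (cong₂ _+_ (enter-*ˡ c f (s ∷ occ)) (nextCar-*ˡ c (λ o → f (s ∷ o)) occ))
  (sym (*-distribˡ-+ c (enter f (s ∷ occ)) _))

nextCar-*ʳ : ∀ {n} c (f : Subset n → ℚ) occ → nextCar (λ o → f o * c) occ ≡ nextCar f occ * c
nextCar-*ʳ c f occ = trans (nextCar-cong occ (λ o _ → *-comm (f o) c)) (trans (nextCar-*ˡ c f occ) (*-comm c _))

nextCar-0 : ∀ {n} (occ : Subset n) → nextCar (λ _ → 0ℚ) occ ≡ 0ℚ
nextCar-0 occ = trans (nextCar-*ˡ 0ℚ (λ _ → 0ℚ) occ) (*-zeroˡ (nextCar (λ _ → 0ℚ) occ))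

enter-binSum : ∀ {n} m (F : Subset n → ℕ → ℕ → ℚ) occ →
  enter (λ o → binSum m (F o)) occ ≡ binSum m (λ a b → enter (λ o → F o a b) occ)
enter-binSum zero    F occ = refl
enter-binSum (suc m) F occ = trans (enter-+ _ _ occ)
  (cong₂ _+_ (enter-binSum m (λ o a → F o (suc a)) occ) (enter-binSum m (λ o a b → F o a (suc b)) occ))

nextCar-binSum : ∀ {n} m (F : Subset n → ℕ → ℕ → ℚ) occ →
  nextCar (λ o → binSum m (F o)) occ ≡ binSum m (λ a b → nextCar (λ o → F o a b) occ)
nextCar-binSum zero    F occ = refl
nextCar-binSum (suc m) F occ = trans (nextCar-+ _ _ occ)
  (cong₂ _+_ (nextCar-binSum m (λ o a → F o (suc a)) occ) (nextCar-binSum m (λ o a b → F o a (suc b)) occ))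

-- Counting preference sequences spot by spot

-- r cars reach a spot; g is evaluated at the number of cars that drive on.
absorb : Bool → (ℕ → ℚ) → ℕ → ℚ
absorb inside  g r       = g r
absorb outside g zero    = 0ℚ
absorb outside g (suc r) = g r

-- A spot stays free only if no car reaches it from the left and none prefers it. This supplies the
-- case c = 0 that `absorb` sends to 0.
skip : Bool → ℕ → ℚ → ℚ
skip outside zero p = p
skip _       _    p = 0ℚ

-- Peels the spots off from the left. The preferences of l cars are split
-- according to how many of them prefer the first spot; r is the number of
-- further cars that drive in from the left. Since the occupied spots and the
-- numbers of overflowing cars depend only on the content of a preference
-- sequence, this counts sequences, weighted by h at the right end of the street
-- if every spot gets filled, and by e after the first spot that stays free.
fill : (ℕ → ℕ → ℚ) → (∀ {n} → Subset n → ℕ → ℚ) → ∀ {n} → ℕ → Subset n → ℕ → ℚ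
fill h e r []        l = h r l
fill h e r (s ∷ occ) l =
  binSum l (λ c b → absorb s (λ r′ → fill h e r′ occ b) (c ℕ.+ r)) + skip s r (e occ l)

absorb-cong : ∀ s {f g : ℕ → ℚ} r → (∀ r → f r ≡ g r) → absorb s f r ≡ absorb s g r
absorb-cong inside  r       f≡g = f≡g r
absorb-cong outside zero    f≡g = refl
absorb-cong outside (suc r) f≡g = f≡g r

absorb-+ : ∀ s (f g : ℕ → ℚ) r → absorb s (λ r → f r + g r) r ≡ absorb s f r + absorb s g r
absorb-+ inside  f g r       = refl
absorb-+ outside f g zero    = refl
absorb-+ outside f g (suc r) = refl

absorb-0 : ∀ s r → absorb s (λ _ → 0ℚ) r ≡ 0ℚ
absorb-0 inside  r       = refl
absorb-0 outside zero    = refl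
absorb-0 outside (suc r) = refl

absorb-nextCar : ∀ s {n} (F : ℕ → Subset n → ℚ) occ r →
  absorb s (λ r → nextCar (F r) occ) r ≡ nextCar (λ o → absorb s (λ r → F r o) r) occ
absorb-nextCar inside  F occ r       = refl
absorb-nextCar outside F occ zero    = sym (nextCar-0 occ)
absorb-nextCar outside F occ (suc r) = refl

skip-+ : ∀ s r p q → skip s r (p + q) ≡ skip s r p + skip s r q
skip-+ inside  r       p q = refl
skip-+ outside zero    p q = refl
skip-+ outside (suc r) p q = refl

skip-0 : ∀ s r → skip s r 0ℚ ≡ 0ℚ
skip-0 inside  r       = refl
skip-0 outside zero    = refl
skip-0 outside (suc r) = refl

skip-nextCar : ∀ s r {n} (f : Subset n → ℚ) occ → skip s r (nextCar f occ) ≡ nextCar (λ o → skip s r (f o)) occ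
skip-nextCar inside  r       f occ = sym (nextCar-0 occ)
skip-nextCar outside zero    f occ = refl
skip-nextCar outside (suc r) f occ = sym (nextCar-0 occ)

noWeight : ∀ {n} → Subset n → ℕ → ℚ
noWeight _ _ = 0ℚ

fill-0 : ∀ {n} r (occ : Subset n) l → fill (λ _ _ → 0ℚ) noWeight r occ l ≡ 0ℚ
fill-0 r []        l = refl
fill-0 r (s ∷ occ) l = cong₂ _+_
  (trans (binSum-cong l (λ c b _ → trans (absorb-cong s (c ℕ.+ r) (λ r′ → fill-0 r′ occ b)) (absorb-0 s (c ℕ.+ r)))) (binSum-0 l))
  (skip-0 s r)

module _ (h : ℕ → ℕ → ℚ) (e : ∀ {n} → Subset n → ℕ → ℚ) (h-suc : ∀ r l → h (suc r) l ≡ 0ℚ) where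

  open ≡-Reasoning

  -- In `fill` only the number of cars reaching each spot matters, so one of the cars coming from
  -- the left may as well drive in before all others. The hypothesis `h-suc` mirrors that `enter`
  -- gives 0 to a car that leaves the street.
  fill-enter : ∀ {n} r (occ : Subset n) l → fill h e (suc r) occ l ≡ enter (λ o → fill h e r o l) occ
  fill-enter r []              l = h-suc r l
  fill-enter r (outside ∷ occ) l = cong (_+ 0ℚ) (binSum-cong l (λ c b _ →
    cong (absorb outside (λ r′ → fill h e r′ occ b)) (ℕ.+-suc c r)))
  fill-enter r (inside  ∷ occ) l = begin
    binSum l (λ c b → fill h e (c ℕ.+ suc r) occ b) + 0ℚ
      ≡⟨ +-identityʳ _ ⟩
    binSum l (λ c b → fill h e (c ℕ.+ suc r) occ b)
      ≡⟨ binSum-cong l (λ c b _ → trans (cong (λ r → fill h e r occ b) (ℕ.+-suc c r)) (fill-enter (c ℕ.+ r) occ b)) ⟩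
    binSum l (λ c b → enter (λ o → fill h e (c ℕ.+ r) o b) occ)
      ≡⟨ enter-binSum l (λ o c b → fill h e (c ℕ.+ r) o b) occ ⟨
    enter (λ o → binSum l (λ c b → fill h e (c ℕ.+ r) o b)) occ
      ≡⟨ enter-cong occ (λ o _ → sym (+-identityʳ _)) ⟩
    enter (λ o → binSum l (λ c b → fill h e (c ℕ.+ r) o b) + 0ℚ) occ ∎

  module _ (e′ : ∀ {n} → Subset n → ℕ → ℚ)
    (h-time : ∀ r l → h r (suc l) ≡ 0ℚ)
    (e-time : ∀ {n} (occ : Subset n) l → e occ (suc l) ≡ e′ occ l + nextCar (λ o → e o l) occ) where

    -- `binSum` at `suc l` distinguishes whether the first car prefers the peeled-off spot. If so,
    -- it enters `s ∷ occ` from the left; otherwise the induction hypothesis for `occ` applies. The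
    -- term with `e′` collects what `e` counts beyond the case that the first car parks on the
    -- street, such as a first car on the extra spot.
    fill-time : ∀ {n} r (occ : Subset n) l →
      fill h e r occ (suc l) ≡ fill (λ _ _ → 0ℚ) e′ r occ l + nextCar (λ o → fill h e r o l) occ
    fill-time r []        l = h-time r l
    fill-time r (s ∷ occ) l = begin
      (binSum l (λ c b → absorb s (λ r′ → fill h e r′ occ b) (suc (c ℕ.+ r)))
        + binSum l (λ c b → absorb s (λ r′ → fill h e r′ occ (suc b)) (c ℕ.+ r)))
        + skip s r (e occ (suc l))
        ≡⟨ cong₂ _+_ (cong₂ _+_ (first s) later) (trans (cong (skip s r) (e-time occ l))
             (trans (skip-+ s r (e′ occ l) _) (cong (_+_ (skip s r (e′ occ l))) (skip-nextCar s r (λ o → e o l) occ)))) ⟩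
      (enter (λ o → fill h e r o l) (s ∷ occ) + (A + C)) + (A′ + C′)
        ≡⟨ shuffle (enter (λ o → fill h e r o l) (s ∷ occ)) A C A′ C′ ⟩
      (A + A′) + (enter (λ o → fill h e r o l) (s ∷ occ) + (C + C′))
        ≡⟨ cong (λ z → (A + A′) + (enter (λ o → fill h e r o l) (s ∷ occ) + z))
             (nextCar-+ (λ o → binSum l (λ c b → absorb s (λ r′ → fill h e r′ o b) (c ℕ.+ r))) (λ o → skip s r (e o l)) occ) ⟨
      fill (λ _ _ → 0ℚ) e′ r (s ∷ occ) l + nextCar (λ o → fill h e r o l) (s ∷ occ) ∎
      where
      A A′ C C′ : ℚ
      A  = binSum l (λ c b → absorb s (λ r′ → fill (λ _ _ → 0ℚ) e′ r′ occ b) (c ℕ.+ r))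
      A′ = skip s r (e′ occ l)
      C  = nextCar (λ o → binSum l (λ c b → absorb s (λ r′ → fill h e r′ o b) (c ℕ.+ r))) occ
      C′ = nextCar (λ o → skip s r (e o l)) occ
      shuffle : ∀ x a c a′ c′ → (x + (a + c)) + (a′ + c′) ≡ (a + a′) + (x + (c + c′))
      shuffle = solve-∀ ℚ-ring
      first : ∀ s → binSum l (λ c b → absorb s (λ r′ → fill h e r′ occ b) (suc (c ℕ.+ r)))
                  ≡ enter (λ o → fill h e r o l) (s ∷ occ)
      first outside = sym (+-identityʳ _)
      first inside  = begin
        binSum l (λ c b → fill h e (suc (c ℕ.+ r)) occ b)
          ≡⟨ binSum-cong l (λ c b _ → fill-enter (c ℕ.+ r) occ b) ⟩
        binSum l (λ c b → enter (λ o → fill h e (c ℕ.+ r) o b) occ)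
          ≡⟨ enter-binSum l (λ o c b → fill h e (c ℕ.+ r) o b) occ ⟨
        enter (λ o → binSum l (λ c b → fill h e (c ℕ.+ r) o b)) occ
          ≡⟨ enter-cong occ (λ o _ → sym (+-identityʳ _)) ⟩
        enter (λ o → fill h e r (inside ∷ o) l) occ ∎
      later : binSum l (λ c b → absorb s (λ r′ → fill h e r′ occ (suc b)) (c ℕ.+ r)) ≡ A + C
      later = begin
        binSum l (λ c b → absorb s (λ r′ → fill h e r′ occ (suc b)) (c ℕ.+ r))
          ≡⟨ binSum-cong l (λ c b _ → trans (absorb-cong s (c ℕ.+ r) (λ r′ → fill-time r′ occ b))
               (trans (absorb-+ s (λ r′ → fill (λ _ _ → 0ℚ) e′ r′ occ b) _ (c ℕ.+ r))
                 (cong (_+_ (absorb s (λ r′ → fill (λ _ _ → 0ℚ) e′ r′ occ b) (c ℕ.+ r)))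
                   (absorb-nextCar s (λ r′ o → fill h e r′ o b) occ (c ℕ.+ r))))) ⟩
        binSum l (λ c b → absorb s (λ r′ → fill (λ _ _ → 0ℚ) e′ r′ occ b) (c ℕ.+ r)
                        + nextCar (λ o → absorb s (λ r′ → fill h e r′ o b) (c ℕ.+ r)) occ)
          ≡⟨ binSum-+ l _ _ ⟩
        A + binSum l (λ c b → nextCar (λ o → absorb s (λ r′ → fill h e r′ o b) (c ℕ.+ r)) occ)
          ≡⟨ cong (_+_ A) (nextCar-binSum l (λ o c b → absorb s (λ r′ → fill h e r′ o b) (c ℕ.+ r)) occ) ⟨
        A + C ∎

-- One extra letter stands for the spot to the right of the street.
pow : ∀ {n} → Subset n → ℕ → ℚ
pow {n} _ l = ι (suc n) ^ l

-- Every word over the n spots and the extra one either fills the street or leaves a first spot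
-- free, whatever the number r of cars from the left.
fill-total : ∀ {n} r (occ : Subset n) l →
  fill (λ _ _ → 1ℚ) noWeight r occ l + fill (λ _ _ → 0ℚ) pow r occ l ≡ pow occ l
fill-total r []        l = sym (1^ l)
fill-total {suc n} r (s ∷ occ) l = begin
  (A + skip s r 0ℚ) + (C + skip s r (pow occ l))
    ≡⟨ cong (λ z → (A + z) + (C + skip s r (pow occ l))) (skip-0 s r) ⟩
  (A + 0ℚ) + (C + skip s r (pow occ l))
    ≡⟨ shuffle A C _ ⟩
  (A + C) + skip s r (pow occ l)
    ≡⟨ cong (_+ skip s r (pow occ l)) (trans (sym (binSum-+ l _ _)) (binSum-cong l (λ c b _ →
         trans (sym (absorb-+ s _ _ (c ℕ.+ r))) (absorb-cong s (c ℕ.+ r) (λ r′ → fill-total r′ occ b))))) ⟩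
  binSum l (λ c b → absorb s (λ _ → pow occ b) (c ℕ.+ r)) + skip s r (pow occ l)
    ≡⟨ split s r ⟩
  binSum l (λ c b → 1ℚ ^ c * ι (suc n) ^ b)
    ≡⟨ binomial-theorem l (ι (suc n)) 1ℚ ⟩
  (1ℚ + ι (suc n)) ^ l
    ≡⟨ cong (_^ l) (ι-suc (suc n)) ⟨
  pow (s ∷ occ) l ∎
  where
  open ≡-Reasoning
  A C : ℚ
  A = binSum l (λ c b → absorb s (λ r′ → fill (λ _ _ → 1ℚ) noWeight r′ occ b) (c ℕ.+ r))
  C = binSum l (λ c b → absorb s (λ r′ → fill (λ _ _ → 0ℚ) pow r′ occ b) (c ℕ.+ r))
  shuffle : ∀ a c p → (a + 0ℚ) + (c + p) ≡ (a + c) + p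
  shuffle = solve-∀ ℚ-ring
  unit : ∀ c b → pow occ b ≡ 1ℚ ^ c * ι (suc n) ^ b
  unit c b = trans (sym (*-identityˡ (pow occ b))) (cong (_* pow occ b) (sym (1^ c)))
  -- At a free spot that no car reaches from the left, the summand c = 0 is lost; the gap term `f l`
  -- restores it.
  absorb0 : ∀ l (f : ℕ → ℚ) → binSum l (λ c b → absorb outside (λ _ → f b) (c ℕ.+ 0)) + f l ≡ binSum l (λ _ b → f b)
  absorb0 zero    f = +-identityˡ (f 0)
  absorb0 (suc l) f = trans (+-assoc (binSum l (λ _ → f)) (binSum l (λ c b → absorb outside (λ _ → f (suc b)) (c ℕ.+ 0))) _)
    (cong (_+_ (binSum l (λ _ b → f b))) (absorb0 l (λ b → f (suc b))))
  split : ∀ s r → binSum l (λ c b → absorb s (λ _ → pow occ b) (c ℕ.+ r)) + skip s r (pow occ l)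
                ≡ binSum l (λ c b → 1ℚ ^ c * ι (suc n) ^ b)
  split inside  r       = trans (+-identityʳ _) (binSum-cong l (λ c b _ → unit c b))
  split outside zero    = trans (absorb0 l (pow occ)) (binSum-cong l (λ c b _ → unit c b))
  split outside (suc r) = trans (+-identityʳ _) (binSum-cong l (λ c b _ →
    trans (cong (absorb outside (λ _ → pow occ b)) (ℕ.+-suc c r)) (unit c b)))

-- Filling the street exactly or with overflow

exact : ℕ → ℕ → ℚ
exact zero zero = 1ℚ
exact _    _    = 0ℚ

-- In `exactFill` all preferences lie on the street and no car overflows. In `overfill` the extra
-- spot of `pow` may also be preferred, and any overflow is allowed.
exactFill overfill : ∀ {n} → ℕ → Subset n → ℕ → ℚ
exactFill = fill exact noWeight
overfill  = fill (λ _ _ → 1ℚ) noWeight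

exactFill-time : ∀ {n} r (occ : Subset n) l → exactFill r occ (suc l) ≡ nextCar (λ o → exactFill r o l) occ
exactFill-time r occ l = trans
  (fill-time exact noWeight (λ _ _ → refl) noWeight (λ { zero _ → refl ; (suc _) _ → refl })
    (λ o _ → sym (cong₂ _+_ {x = 0ℚ} refl (nextCar-0 o))) r occ l)
  (trans (cong (_+ nextCar (λ o → exactFill r o l) occ) (fill-0 r occ l)) (+-identityˡ _))

exactFill-done : ∀ {n} (occ : Subset n) → exactFill (free occ) occ 0 ≡ 1ℚ
exactFill-done []              = refl
exactFill-done (outside ∷ occ) = cong (_+ 0ℚ) (exactFill-done occ)
exactFill-done (inside  ∷ occ) = cong (_+ 0ℚ) (exactFill-done occ)

parkings : ∀ {n} → Subset n → ℕ → ℚ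
parkings occ zero    = 1ℚ
parkings occ (suc m) = nextCar (λ o → parkings o m) occ

-- If m cars park and leave r spots free, then r further cars from the left fill these in exactly
-- one way.
parkings≡exactFill : ∀ {n} r (occ : Subset n) m → r ℕ.+ m ≡ free occ → parkings occ m ≡ exactFill r occ m
parkings≡exactFill r occ zero    e = sym (trans
  (cong (λ r → exactFill r occ 0) (trans (sym (ℕ.+-identityʳ r)) e)) (exactFill-done occ))
parkings≡exactFill r occ (suc m) e = trans
  (nextCar-cong occ (λ o e′ → parkings≡exactFill r o m
    (ℕ.suc-injective (trans (sym (ℕ.+-suc r m)) (trans e (sym e′))))))
  (sym (exactFill-time r occ m))

parkings-overfull : ∀ {n} (occ : Subset n) m → free occ ℕ.< m → parkings occ m ≡ 0ℚ
parkings-overfull occ (suc m) (s≤s free≤m) = trans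
  (nextCar-cong occ (λ o e → parkings-overfull o m (subst (ℕ._≤ m) (sym e) free≤m)))
  (nextCar-0 occ)

overfill-small : ∀ {n} r (occ : Subset n) l → l ℕ.+ r ℕ.< free occ → overfill r occ l ≡ 0ℚ
overfill-small r (s ∷ occ) l h = cong₂ _+_
  (trans (binSum-cong l (λ c b e → small s c b e h)) (binSum-0 l)) (skip-0 s r)
  where
  reorder : ∀ c b → c ℕ.+ b ≡ l → b ℕ.+ (c ℕ.+ r) ≡ l ℕ.+ r
  reorder c b e = trans (sym (ℕ.+-assoc b c r)) (cong (ℕ._+ r) (trans (ℕ.+-comm b c) e))
  small : ∀ s c b → c ℕ.+ b ≡ l → l ℕ.+ r ℕ.< free (s ∷ occ) →
    absorb s (λ r′ → overfill r′ occ b) (c ℕ.+ r) ≡ 0ℚ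
  small inside  c b e h = overfill-small (c ℕ.+ r) occ b (subst (ℕ._< free occ) (sym (reorder c b e)) h)
  small outside c b e (s≤s h) with c ℕ.+ r | reorder c b e
  ... | zero   | _  = refl
  ... | suc r′ | e′ = overfill-small r′ occ b (subst (ℕ._≤ free occ) (sym (trans (sym (ℕ.+-suc b r′)) e′)) h)

-- Sequences that make the extra spot lucky

-- Preference sequences on a street with one more spot to the right of occ, in
-- which some car prefers that spot and the first car to reach it does so:
-- all of them, and those that fill the street.
lucky luckyFill : ∀ {n} → Subset n → ℕ → ℚ
lucky occ zero    = 0ℚ
lucky occ (suc l) = pow occ l + nextCar (λ o → lucky o l) occ
luckyFill occ zero    = 0ℚ
luckyFill occ (suc l) = overfill 0 occ l + nextCar (λ o → luckyFill o l) occ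

-- No car drives past a spot that stays free, so whether the extra spot is lucky is decided by the
-- cars with preferences beyond the first such spot.
luckyGap : ∀ {n} → ℕ → Subset n → ℕ → ℚ
luckyGap = fill (λ _ _ → 0ℚ) lucky

luckyGap-start : ∀ {n} r (occ : Subset n) → luckyGap r occ 0 ≡ 0ℚ
luckyGap-start r []        = refl
luckyGap-start r (s ∷ occ) = cong₂ _+_
  (trans (absorb-cong s r (λ r′ → luckyGap-start r′ occ)) (absorb-0 s r)) (skip-0 s r)

-- Induction on the cars: if the first one takes the extra spot, `fill-total` splits the words of
-- the others into those that fill the street and those that leave a gap; if it parks on the street,
-- the induction hypothesis applies.
lucky≡luckyFill+luckyGap : ∀ {n} (occ : Subset n) l → lucky occ l ≡ luckyFill occ l + luckyGap 0 occ l
lucky≡luckyFill+luckyGap occ zero    = sym (trans (+-identityˡ _) (luckyGap-start 0 occ))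
lucky≡luckyFill+luckyGap occ (suc l) = begin
  pow occ l + nextCar (λ o → lucky o l) occ
    ≡⟨ cong₂ _+_ (sym (fill-total 0 occ l))
         (trans (nextCar-cong occ (λ o _ → lucky≡luckyFill+luckyGap o l)) (nextCar-+ _ _ occ)) ⟩
  (overfill 0 occ l + gap) + (nextCar (λ o → luckyFill o l) occ + nextCar (λ o → luckyGap 0 o l) occ)
    ≡⟨ +-interchange (overfill 0 occ l) gap _ _ ⟩
  luckyFill occ (suc l) + (gap + nextCar (λ o → luckyGap 0 o l) occ)
    ≡⟨ cong (_+_ (luckyFill occ (suc l)))
         (fill-time (λ _ _ → 0ℚ) lucky (λ _ _ → refl) pow (λ _ _ → refl) (λ _ _ → refl) 0 occ l) ⟨
  luckyFill occ (suc l) + luckyGap 0 occ (suc l) ∎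
  where
  open ≡-Reasoning
  gap : ℚ
  gap = fill (λ _ _ → 0ℚ) pow 0 occ l

luckyFill-small : ∀ {n} (occ : Subset n) l → l ℕ.≤ free occ → luckyFill occ l ≡ 0ℚ
luckyFill-small occ zero    h = refl
luckyFill-small occ (suc l) h = cong₂ _+_
  (overfill-small 0 occ l (subst (ℕ._< free occ) (sym (ℕ.+-identityʳ l)) h))
  (trans (nextCar-cong occ (λ o e → luckyFill-small o l (ℕ.s≤s⁻¹ (subst (suc l ℕ.≤_) (sym e) h)))) (nextCar-0 occ))

-- Cutting the street at the lucky spot

free-++ : ∀ {m n} (X : Subset m) (Y : Subset n) → free (X ++ Y) ≡ free X ℕ.+ free Y
free-++ []            Y = refl
free-++ (outside ∷ X) Y = cong suc (free-++ X Y)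
free-++ (inside  ∷ X) Y = free-++ X Y

absorb-binSum : ∀ s m (F : ℕ → ℕ → ℕ → ℚ) r →
  absorb s (λ r → binSum m (F r)) r ≡ binSum m (λ a b → absorb s (λ r → F r a b) r)
absorb-binSum inside  m F r       = refl
absorb-binSum outside m F zero    = sym (binSum-0 m)
absorb-binSum outside m F (suc r) = refl

-- The occupied spot between `X` and `Y` plays the role of the extra spot for `X`. Of the s + r cars
-- arriving up to there, `free X` stay and the others drive into `Y`. The truncated difference does
-- no harm, as `overfill` is 0 when there are too few cars to fill `X`.
exactFill-++ : ∀ {m n} r (X : Subset m) (Y : Subset n) l →
  exactFill r (X ++ inside ∷ Y) l
    ≡ binSum l (λ s b → overfill r X s * exactFill ((s ℕ.+ r) ℕ.∸ free X) Y b)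
exactFill-++ r []      Y l = trans (+-identityʳ _) (binSum-cong l (λ s b _ → sym (*-identityˡ _)))
exactFill-++ r (s ∷ X) Y l = begin
  binSum l (λ c t → absorb s (λ r′ → exactFill r′ (X ++ inside ∷ Y) t) (c ℕ.+ r)) + skip s r 0ℚ
    ≡⟨ trans (cong (_+_ (binSum l (λ c t → absorb s (λ r′ → exactFill r′ (X ++ inside ∷ Y) t) (c ℕ.+ r)))) (skip-0 s r))
         (+-identityʳ _) ⟩
  binSum l (λ c t → absorb s (λ r′ → exactFill r′ (X ++ inside ∷ Y) t) (c ℕ.+ r))
    ≡⟨ binSum-cong l (λ c t _ → begin
         absorb s (λ r′ → exactFill r′ (X ++ inside ∷ Y) t) (c ℕ.+ r)
           ≡⟨ absorb-cong s (c ℕ.+ r) (λ r′ → exactFill-++ r′ X Y t) ⟩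
         absorb s (λ r′ → binSum t (λ d b → overfill r′ X d * exactFill ((d ℕ.+ r′) ℕ.∸ free X) Y b)) (c ℕ.+ r)
           ≡⟨ absorb-binSum s t (λ r′ d b → overfill r′ X d * exactFill ((d ℕ.+ r′) ℕ.∸ free X) Y b) (c ℕ.+ r) ⟩
         binSum t (λ d b → absorb s (λ r′ → overfill r′ X d * exactFill ((d ℕ.+ r′) ℕ.∸ free X) Y b) (c ℕ.+ r))
           ≡⟨ binSum-cong t (λ d b _ → pull s d (c ℕ.+ r) (λ r′ → overfill r′ X d) (λ r′ → exactFill r′ Y b)) ⟩
         binSum t (λ d b → absorb s (λ r′ → overfill r′ X d) (c ℕ.+ r)
                           * exactFill ((d ℕ.+ (c ℕ.+ r)) ℕ.∸ free (s ∷ X)) Y b) ∎) ⟩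
  binSum l (λ c t → binSum t (λ d b → absorb s (λ r′ → overfill r′ X d) (c ℕ.+ r)
                                      * exactFill ((d ℕ.+ (c ℕ.+ r)) ℕ.∸ free (s ∷ X)) Y b))
    ≡⟨ binSum-assoc l (λ c d b → absorb s (λ r′ → overfill r′ X d) (c ℕ.+ r)
                                 * exactFill ((d ℕ.+ (c ℕ.+ r)) ℕ.∸ free (s ∷ X)) Y b) ⟨
  binSum l (λ t b → binSum t (λ c d → absorb s (λ r′ → overfill r′ X d) (c ℕ.+ r)
                                      * exactFill ((d ℕ.+ (c ℕ.+ r)) ℕ.∸ free (s ∷ X)) Y b))
    ≡⟨ binSum-cong l (λ t b _ → trans
         (binSum-cong t (λ c d e → cong (λ z → absorb s (λ r′ → overfill r′ X d) (c ℕ.+ r) * exactFill (z ℕ.∸ free (s ∷ X)) Y b)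
           (trans (sym (ℕ.+-assoc d c r)) (cong (ℕ._+ r) (trans (ℕ.+-comm d c) e)))))
         (trans (binSum-*ʳ t (exactFill ((t ℕ.+ r) ℕ.∸ free (s ∷ X)) Y b) (λ c d → absorb s (λ r′ → overfill r′ X d) (c ℕ.+ r))) (cong (_* exactFill ((t ℕ.+ r) ℕ.∸ free (s ∷ X)) Y b)
           (sym (trans (cong (_+_ (binSum t (λ c d → absorb s (λ r′ → overfill r′ X d) (c ℕ.+ r)))) (skip-0 s r)) (+-identityʳ (binSum t (λ c d → absorb s (λ r′ → overfill r′ X d) (c ℕ.+ r))))))))) ⟩
  binSum l (λ t b → overfill r (s ∷ X) t * exactFill ((t ℕ.+ r) ℕ.∸ free (s ∷ X)) Y b) ∎
  where
  open ≡-Reasoning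
  pull : ∀ s d ρ (f g : ℕ → ℚ) → absorb s (λ r′ → f r′ * g ((d ℕ.+ r′) ℕ.∸ free X)) ρ
                               ≡ absorb s f ρ * g ((d ℕ.+ ρ) ℕ.∸ free (s ∷ X))
  pull inside  d ρ        f g = refl
  pull outside d zero     f g = sym (*-zeroˡ (g ((d ℕ.+ 0) ℕ.∸ suc (free X))))
  pull outside d (suc r′) f g = cong (λ z → f r′ * g (z ℕ.∸ suc (free X))) (sym (ℕ.+-suc d r′))

claim : ∀ {n} → Fin n → (Subset n → ℚ) → Subset n → ℚ
claim zero    f (outside ∷ occ) = f (inside ∷ occ)
claim zero    f (inside  ∷ occ) = 0ℚ
claim (suc j) f (s ∷ occ)       = claim j (λ o → f (s ∷ o)) occ

-- The summand with `nextCar` also admits a first car that parks in j. It then contributes 0, since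
-- a taken spot cannot be claimed later; the lucky case is put back by `claim`.
luckyParkings : ∀ {n} → Fin n → Subset n → ℕ → ℚ
luckyParkings j occ zero    = 0ℚ
luckyParkings j occ (suc m) = nextCar (λ o → luckyParkings j o m) occ + claim j (λ o → parkings o m) occ

claim-free : ∀ {k n} (f : Subset (k ℕ.+ suc n) → ℚ) (X : Subset k) (Y : Subset n) →
  claim (k ↑ʳ zero) f (X ++ outside ∷ Y) ≡ f (X ++ inside ∷ Y)
claim-free f []      Y = refl
claim-free f (s ∷ X) Y = claim-free (λ o → f (s ∷ o)) X Y

claim-taken : ∀ {k n} (f : Subset (k ℕ.+ suc n) → ℚ) (X : Subset k) (Y : Subset n) →
  claim (k ↑ʳ zero) f (X ++ inside ∷ Y) ≡ 0ℚ
claim-taken f []      Y = refl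
claim-taken f (s ∷ X) Y = claim-taken (λ o → f (s ∷ o)) X Y

module _ {n : ℕ} where

  enter-taken : ∀ {k} (f : Subset (k ℕ.+ suc n) → ℚ) → (∀ X Y → f (X ++ inside ∷ Y) ≡ 0ℚ) →
    ∀ (X : Subset k) Y → enter f (X ++ inside ∷ Y) ≡ 0ℚ
  enter-taken f f≡0 []            Y = trans (enter-cong Y (λ o _ → f≡0 [] o)) (trans (enter-*ˡ 0ℚ (λ _ → 0ℚ) Y) (*-zeroˡ (enter (λ _ → 0ℚ) Y)))
  enter-taken f f≡0 (outside ∷ X) Y = f≡0 (inside ∷ X) Y
  enter-taken f f≡0 (inside  ∷ X) Y = enter-taken (λ o → f (inside ∷ o)) (λ X → f≡0 (inside ∷ X)) X Y

  nextCar-taken : ∀ {k} (f : Subset (k ℕ.+ suc n) → ℚ) → (∀ X Y → f (X ++ inside ∷ Y) ≡ 0ℚ) →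
    ∀ (X : Subset k) Y → nextCar f (X ++ inside ∷ Y) ≡ 0ℚ
  nextCar-taken f f≡0 []      Y = cong₂ _+_ (enter-taken f f≡0 [] Y)
    (trans (nextCar-cong Y (λ o _ → f≡0 [] o)) (nextCar-0 Y))
  nextCar-taken f f≡0 (s ∷ X) Y = cong₂ _+_ (enter-taken f f≡0 (s ∷ X) Y) (nextCar-taken (λ o → f (s ∷ o)) (λ X → f≡0 (s ∷ X)) X Y)

  enter-untaken : ∀ {k} (f : Subset (k ℕ.+ suc n) → ℚ) → (∀ X Y → f (X ++ inside ∷ Y) ≡ 0ℚ) →
    ∀ (X : Subset k) Y → enter f (X ++ outside ∷ Y) ≡ enter (λ X → f (X ++ outside ∷ Y)) X
  enter-untaken f f≡0 []            Y = f≡0 [] Y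
  enter-untaken f f≡0 (outside ∷ X) Y = refl
  enter-untaken f f≡0 (inside  ∷ X) Y = enter-untaken (λ o → f (inside ∷ o)) (λ X → f≡0 (inside ∷ X)) X Y

  -- A car overflowing from `X` parks in the free middle spot, where `f` vanishes. So no car passes
  -- from `X` to `Y`, and the two sides do not interact.
  nextCar-untaken : ∀ {k} (f : Subset (k ℕ.+ suc n) → ℚ) → (∀ X Y → f (X ++ inside ∷ Y) ≡ 0ℚ) →
    ∀ (X : Subset k) Y → nextCar f (X ++ outside ∷ Y)
      ≡ nextCar (λ X → f (X ++ outside ∷ Y)) X + nextCar (λ Y → f (X ++ outside ∷ Y)) Y
  nextCar-untaken f f≡0 []      Y = cong (_+ nextCar (λ Y → f (outside ∷ Y)) Y) (f≡0 [] Y)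
  nextCar-untaken f f≡0 (s ∷ X) Y = trans
    (cong₂ _+_ (enter-untaken f f≡0 (s ∷ X) Y) (nextCar-untaken (λ o → f (s ∷ o)) (λ X → f≡0 (s ∷ X)) X Y))
    (sym (+-assoc (enter (λ X → f (X ++ outside ∷ Y)) (s ∷ X)) _ _))

  luckyParkings-taken : ∀ {k} m (X : Subset k) (Y : Subset n) → luckyParkings (k ↑ʳ zero) (X ++ inside ∷ Y) m ≡ 0ℚ
  luckyParkings-taken zero    X Y = refl
  luckyParkings-taken (suc m) X Y = cong₂ _+_ (nextCar-taken (λ o → luckyParkings (_ ↑ʳ zero) o m) (luckyParkings-taken m) X Y) (claim-taken _ X Y)

  -- As there are as many cars as free spots, the street has to be filled. The first car parks in
  -- `X` (the term L), parks in `Y` (R) or claims the middle spot (M); from then on that spot is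
  -- occupied, and `exactFill-++` applies.
  luckyParkings-untaken : ∀ {k} m (X : Subset k) (Y : Subset n) → m ≡ free X ℕ.+ suc (free Y) →
    luckyParkings (k ↑ʳ zero) (X ++ outside ∷ Y) m
      ≡ binSum m (λ s b → luckyFill X s * exactFill (s ℕ.∸ suc (free X)) Y b)
  luckyParkings-untaken zero    X Y e with () ← trans e (ℕ.+-suc (free X) (free Y))
  luckyParkings-untaken {k} (suc m) X Y e = begin
    nextCar (λ o → luckyParkings j o m) (X ++ outside ∷ Y) + claim j (λ o → parkings o m) (X ++ outside ∷ Y)
      ≡⟨ cong₂ _+_ (nextCar-untaken (λ o → luckyParkings (_ ↑ʳ zero) o m) (luckyParkings-taken m) X Y)
           (trans (claim-free (λ o → parkings o m) X Y) (parkings≡exactFill 0 (X ++ inside ∷ Y) m (trans m≡ (sym (free-++ X (inside ∷ Y)))))) ⟩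
    (nextCar (λ X → luckyParkings j (X ++ outside ∷ Y) m) X + nextCar (λ Y → luckyParkings j (X ++ outside ∷ Y) m) Y)
      + exactFill 0 (X ++ inside ∷ Y) m
      ≡⟨ cong₂ _+_ (cong₂ _+_ left right) middle ⟩
    (L + R) + M
      ≡⟨ shuffle L R M ⟩
    (M + L) + R
      -- M and L are the two summands in the recursion of `luckyFill X (suc s)`. R is the half of
      -- `binSum (suc m)` in which the first car prefers a spot of `Y`.
      ≡⟨ cong (_+ R) (trans (sym (binSum-+ m _ _)) (binSum-cong m (λ s b _ → sym (*-distribʳ-+ (exactFill (s ℕ.∸ free X) Y b) (overfill 0 X s) _)))) ⟩
    binSum (suc m) (λ s b → luckyFill X s * exactFill (s ℕ.∸ suc (free X)) Y b) ∎
    where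
    open ≡-Reasoning
    j : Fin (k ℕ.+ suc n)
    j = k ↑ʳ zero
    m≡ : m ≡ free X ℕ.+ free Y
    m≡ = ℕ.suc-injective (trans e (ℕ.+-suc (free X) (free Y)))
    L R M : ℚ
    L = binSum m (λ s b → nextCar (λ X → luckyFill X s) X * exactFill (s ℕ.∸ free X) Y b)
    R = binSum m (λ s b → luckyFill X s * exactFill (s ℕ.∸ suc (free X)) Y (suc b))
    M = binSum m (λ s b → overfill 0 X s * exactFill (s ℕ.∸ free X) Y b)
    shuffle : ∀ l r m → (l + r) + m ≡ (m + l) + r
    shuffle = solve-∀ ℚ-ring
    left : nextCar (λ X → luckyParkings j (X ++ outside ∷ Y) m) X ≡ L
    left = begin
      nextCar (λ X → luckyParkings j (X ++ outside ∷ Y) m) X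
        ≡⟨ nextCar-cong X (λ X′ e′ → trans
             (luckyParkings-untaken m X′ Y (ℕ.suc-injective (trans e (cong (ℕ._+ suc (free Y)) (sym e′)))))
             (binSum-cong m (λ s b _ → cong (λ z → luckyFill X′ s * exactFill (s ℕ.∸ z) Y b) e′))) ⟩
      nextCar (λ X′ → binSum m (λ s b → luckyFill X′ s * exactFill (s ℕ.∸ free X) Y b)) X
        ≡⟨ nextCar-binSum m _ X ⟩
      binSum m (λ s b → nextCar (λ X′ → luckyFill X′ s * exactFill (s ℕ.∸ free X) Y b) X)
        ≡⟨ binSum-cong m (λ s b _ → nextCar-*ʳ _ _ X) ⟩
      L ∎
    right : nextCar (λ Y → luckyParkings j (X ++ outside ∷ Y) m) Y ≡ R
    right = begin
      nextCar (λ Y → luckyParkings j (X ++ outside ∷ Y) m) Y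
        ≡⟨ nextCar-cong Y (λ Y′ e′ → luckyParkings-untaken m X Y′ (trans m≡ (cong (free X ℕ.+_) (sym e′)))) ⟩
      nextCar (λ Y′ → binSum m (λ s b → luckyFill X s * exactFill (s ℕ.∸ suc (free X)) Y′ b)) Y
        ≡⟨ nextCar-binSum m _ Y ⟩
      binSum m (λ s b → nextCar (λ Y′ → luckyFill X s * exactFill (s ℕ.∸ suc (free X)) Y′ b) Y)
        ≡⟨ binSum-cong m (λ s b _ → trans (nextCar-*ˡ (luckyFill X s) (λ Y′ → exactFill (s ℕ.∸ suc (free X)) Y′ b) Y)
             (cong (luckyFill X s *_) (sym (exactFill-time (s ℕ.∸ suc (free X)) Y b)))) ⟩
      R ∎
    middle : exactFill 0 (X ++ inside ∷ Y) m ≡ M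
    middle = trans (exactFill-++ 0 X Y m) (binSum-cong m (λ s b _ →
      cong (λ z → overfill 0 X s * exactFill (z ℕ.∸ free X) Y b) (ℕ.+-identityʳ s)))

-- From lists of preference sequences to the recursions

indicator : Bool → ℚ
indicator b = if b then 1ℚ else 0ℚ

total : {A : Set} → (A → ℚ) → List A → ℚ
total f []       = 0ℚ
total f (x ∷ xs) = f x + total f xs

sum : ∀ {n} → (Fin n → ℚ) → ℚ
sum {zero}  f = 0ℚ
sum {suc n} f = f zero + sum (λ i → f (suc i))

sum-cong : ∀ {n} {f g : Fin n → ℚ} → (∀ i → f i ≡ g i) → sum f ≡ sum g
sum-cong {zero}  f≡g = refl
sum-cong {suc n} f≡g = cong₂ _+_ (f≡g zero) (sum-cong (λ i → f≡g (suc i)))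

sum-0 : ∀ n → sum {n} (λ _ → 0ℚ) ≡ 0ℚ
sum-0 zero    = refl
sum-0 (suc n) = cong (_+_ 0ℚ) (sum-0 n)

module _ {A : Set} where

  total-cong : ∀ {f g : A → ℚ} xs → (∀ x → f x ≡ g x) → total f xs ≡ total g xs
  total-cong []       f≡g = refl
  total-cong (x ∷ xs) f≡g = cong₂ _+_ (f≡g x) (total-cong xs f≡g)

  total-0 : ∀ (xs : List A) → total (λ _ → 0ℚ) xs ≡ 0ℚ
  total-0 []       = refl
  total-0 (x ∷ xs) = cong (_+_ 0ℚ) (total-0 xs)

  total-++ : ∀ (f : A → ℚ) xs ys → total f (xs List.++ ys) ≡ total f xs + total f ys
  total-++ f []       ys = sym (+-identityˡ (total f ys))
  total-++ f (x ∷ xs) ys = trans (cong (_+_ (f x)) (total-++ f xs ys)) (sym (+-assoc (f x) _ _))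

  total-map : ∀ {B : Set} (f : A → ℚ) (g : B → A) xs → total f (List.map g xs) ≡ total (λ x → f (g x)) xs
  total-map f g []       = refl
  total-map f g (x ∷ xs) = cong (_+_ (f (g x))) (total-map f g xs)

  total-cartesianProductWith : ∀ {B C : Set} (f : A → ℚ) (g : B → C → A) xs ys →
    total f (cartesianProductWith g xs ys) ≡ total (λ x → total (λ y → f (g x y)) ys) xs
  total-cartesianProductWith f g []       ys = refl
  total-cartesianProductWith f g (x ∷ xs) ys = trans (total-++ f (List.map (g x) ys) _)
    (cong₂ _+_ (total-map f (g x) ys) (total-cartesianProductWith f g xs ys))

  total-tabulate : ∀ {n} (f : A → ℚ) (g : Fin n → A) → total f (tabulate g) ≡ sum (λ i → f (g i))
  total-tabulate {n = zero}  f g = refl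
  total-tabulate {n = suc n} f g = cong (_+_ (f (g zero))) (total-tabulate f (λ i → g (suc i)))

  ι-length-filter : ∀ {P : A → Set} (P? : Decidable P) xs →
    ι (length (filter P? xs)) ≡ total (λ x → indicator (does (P? x))) xs
  ι-length-filter P? []       = refl
  ι-length-filter P? (x ∷ xs) with does (P? x)
  ... | true  = trans (ι-suc (length (filter P? xs))) (cong (_+_ 1ℚ) (ι-length-filter P? xs))
  ... | false = trans (ι-length-filter P? xs) (sym (+-identityˡ _))

  ι-sum-map : ∀ (f : A → ℕ) xs → ι (ℕ.sum (List.map f xs)) ≡ total (λ x → ι (f x)) xs
  ι-sum-map f []       = refl
  ι-sum-map f (x ∷ xs) = trans (ι-+ (f x) _) (cong (_+_ (ι (f x))) (ι-sum-map f xs))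

sum-single : ∀ {n} (j : Fin n) {f : Fin n → ℚ} → (∀ p → p ≢ j → f p ≡ 0ℚ) → sum f ≡ f j
sum-single {suc n} zero    {f} f≡0 = trans
  (cong (_+_ (f zero)) (trans (sum-cong {n} (λ p → f≡0 (suc p) (λ ()))) (sum-0 n))) (+-identityʳ (f zero))
sum-single         (suc j) {f} f≡0 = trans
  (cong₂ _+_ (f≡0 zero (λ ())) (sum-single j (λ p p≢j → f≡0 (suc p) (λ e → p≢j (Fin.suc-injective e)))))
  (+-identityˡ (f (suc j)))

afterParking : ∀ {n} → (Subset n → ℚ) → Subset n → Maybe (Fin n) → ℚ
afterParking f occ (just q) = f (occ [ q ]≔ inside)
afterParking f occ nothing  = 0ℚ

afterParking-suc : ∀ {n} (f : Subset (suc n) → ℚ) s occ q →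
  afterParking f (s ∷ occ) (Maybe.map suc q) ≡ afterParking (λ o → f (s ∷ o)) occ q
afterParking-suc f s occ (just q) = refl
afterParking-suc f s occ nothing  = refl

firstAvailable-suc : ∀ {n} s (occ : Subset n) p → firstAvailable (s ∷ occ) (suc p) ≡ Maybe.map suc (firstAvailable occ p)
firstAvailable-suc outside occ         p = refl
firstAvailable-suc inside  (_ ∷ _)     p = refl

afterParking-zero : ∀ {n} (f : Subset (suc n) → ℚ) occ → afterParking f occ (firstAvailable occ zero) ≡ enter f occ
afterParking-zero         f (outside ∷ occ)   = refl
afterParking-zero         f (inside  ∷ [])    = refl
afterParking-zero {suc n} f (inside  ∷ occ) = trans
  (afterParking-suc f inside occ (firstAvailable occ zero)) (afterParking-zero (λ o → f (inside ∷ o)) occ)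

sum-afterParking : ∀ {n} (f : Subset n → ℚ) occ →
  sum (λ p → afterParking f occ (firstAvailable occ p)) ≡ nextCar f occ
sum-afterParking f []        = refl
sum-afterParking f (s ∷ occ) = cong₂ _+_ (afterParking-zero f (s ∷ occ))
  (trans (sum-cong (λ p → trans (cong (afterParking f (s ∷ occ)) (firstAvailable-suc s occ p))
                                  (afterParking-suc f s occ (firstAvailable occ p))))
         (sum-afterParking (λ o → f (s ∷ o)) occ))

-- The Boolean of `isParkingFunction?`, for any number of cars, so that it can be followed from car
-- to car.
allParked : ∀ {n m} → Vec (Maybe (Fin n)) m → Bool
allParked spots = does (all? (MaybeAny.dec {P = λ _ → ⊤} (λ _ → yes _)) spots)

total-allParked : ∀ {n} (occ : Subset n) m →
  total (λ a → indicator (allParked (parkFrom occ a))) (preferences n m) ≡ parkings occ m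
total-allParked     occ zero    = +-identityʳ 1ℚ
total-allParked {n} occ (suc m) = begin
  total (λ a → indicator (allParked (parkFrom occ a))) (preferences n (suc m))
    ≡⟨ total-cartesianProductWith _ _∷_ (allFin n) (preferences n m) ⟩
  total (λ p → total (λ a → indicator (allParked (parkFrom occ (p ∷ a)))) (preferences n m)) (allFin n)
    ≡⟨ total-tabulate {n = n} _ (λ p → p) ⟩
  sum (λ p → total (λ a → indicator (allParked (parkFrom occ (p ∷ a)))) (preferences n m))
    ≡⟨ sum-cong {n} (λ p → step (firstAvailable occ p)) ⟩
  sum (λ p → afterParking (λ o → parkings o m) occ (firstAvailable occ p))
    ≡⟨ sum-afterParking (λ o → parkings o m) occ ⟩
  parkings occ (suc m) ∎
  where
  open ≡-Reasoning
  step : ∀ q → total (λ a → indicator (allParked (q ∷ parkFrom (occupy occ q) a))) (preferences n m)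
             ≡ afterParking (λ o → parkings o m) occ q
  step (just q) = total-allParked (occ [ q ]≔ inside) m
  step nothing  = total-0 (preferences n m)

parksAt : ∀ {n} → Maybe (Fin n) → Fin n → Bool
parksAt q p = does (Maybe.≡-dec Fin._≟_ q (just p))

parksAt-claim : ∀ {n} (j : Fin n) (f : Subset n → ℚ) occ →
  afterParking (λ o → if parksAt (firstAvailable occ j) j then f o else 0ℚ) occ (firstAvailable occ j) ≡ claim j f occ
parksAt-claim zero f (outside ∷ occ) = refl
parksAt-claim {suc zero}    zero f (inside ∷ occ) = refl
parksAt-claim {suc (suc n)} zero f (inside ∷ occ) with firstAvailable occ zero
... | just q  = refl
... | nothing = refl
parksAt-claim (suc j) f (s ∷ occ) rewrite firstAvailable-suc s occ j = trans
  (cancel (firstAvailable occ j)) (parksAt-claim j (λ o → f (s ∷ o)) occ)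
  where
  cancel : ∀ q → afterParking (λ o → if parksAt (Maybe.map suc q) (suc j) then f o else 0ℚ) (s ∷ occ) (Maybe.map suc q)
               ≡ afterParking (λ o → if parksAt q j then f (s ∷ o) else 0ℚ) occ q
  cancel (just q) = refl
  cancel nothing  = refl

-- Written in the shape to which the decision procedure in `q` reduces when the street starts empty,
-- so that `sum-q` needs no conversion.
luckyAt : ∀ {n m} → Fin n → Subset n → Vec (Fin n) m → Fin m → Bool
luckyAt j occ a i = allParked (parkFrom occ a)
  ∧ does (label (lookup a i) ℕ.≟ label j) ∧ parksAt (lookup (parkFrom occ a) i) (lookup a i)

luckyCar : ∀ {n m} → Fin n → Subset n → Fin m → ℚ
luckyCar {n} {m} j occ i = total (λ a → indicator (luckyAt j occ a i)) (preferences n m)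

luckyCar-zero : ∀ {n m} (j : Fin n) occ → luckyCar {m = suc m} j occ zero ≡ claim j (λ o → parkings o m) occ
luckyCar-zero {n} {m} j occ = begin
  luckyCar j occ zero
    ≡⟨ trans (total-cartesianProductWith _ _∷_ (allFin n) (preferences n m)) (total-tabulate {n = n} _ (λ p → p)) ⟩
  sum (λ p → total (λ a → indicator (luckyAt j occ (p ∷ a) zero)) (preferences n m))
    ≡⟨ sum-cong {n} (λ p → step (does (label p ℕ.≟ label j)) (λ q → parksAt q p) (firstAvailable occ p)) ⟩
  sum (λ p → afterParking (λ o → if does (label p ℕ.≟ label j) ∧ parksAt (firstAvailable occ p) p then parkings o m else 0ℚ)
                          occ (firstAvailable occ p))
    ≡⟨ sum-single j (λ p p≢j → trans
         (cong (λ b → afterParking (λ o → if b ∧ parksAt (firstAvailable occ p) p then parkings o m else 0ℚ) occ (firstAvailable occ p))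
           (dec-false (label p ℕ.≟ label j) (λ e → p≢j (Fin.toℕ-injective (ℕ.suc-injective e)))))
         (afterParking-0 (firstAvailable occ p))) ⟩
  afterParking (λ o → if does (label j ℕ.≟ label j) ∧ parksAt (firstAvailable occ j) j then parkings o m else 0ℚ)
               occ (firstAvailable occ j)
    ≡⟨ cong (λ b → afterParking (λ o → if b ∧ parksAt (firstAvailable occ j) j then parkings o m else 0ℚ) occ (firstAvailable occ j))
         (dec-true (label j ℕ.≟ label j) refl) ⟩
  afterParking (λ o → if parksAt (firstAvailable occ j) j then parkings o m else 0ℚ) occ (firstAvailable occ j)
    ≡⟨ parksAt-claim j (λ o → parkings o m) occ ⟩
  claim j (λ o → parkings o m) occ ∎
  where
  open ≡-Reasoning
  afterParking-0 : ∀ q → afterParking (λ _ → 0ℚ) occ q ≡ 0ℚ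
  afterParking-0 (just q) = refl
  afterParking-0 nothing  = refl
  pull : ∀ b (f : Vec (Fin n) m → Bool) xs →
    total (λ a → indicator (f a ∧ b)) xs ≡ (if b then total (λ a → indicator (f a)) xs else 0ℚ)
  pull true  f xs = total-cong xs (λ a → cong indicator (∧-true (f a)))
    where
    ∧-true : ∀ b → b ∧ true ≡ b
    ∧-true true  = refl
    ∧-true false = refl
  pull false f xs = trans (total-cong xs (λ a → cong indicator (∧-false (f a)))) (total-0 xs)
    where
    ∧-false : ∀ b → b ∧ false ≡ false
    ∧-false true  = refl
    ∧-false false = refl
  step : ∀ b (c : Maybe (Fin n) → Bool) q →
    total (λ a → indicator (allParked (q ∷ parkFrom (occupy occ q) a) ∧ b ∧ c q)) (preferences n m)
      ≡ afterParking (λ o → if b ∧ c q then parkings o m else 0ℚ) occ q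
  step b c (just q) = trans (pull (b ∧ c (just q)) (λ a → allParked (parkFrom (occ [ q ]≔ inside) a)) (preferences n m))
    (cong (λ z → if b ∧ c (just q) then z else 0ℚ) (total-allParked (occ [ q ]≔ inside) m))
  step b c nothing  = total-0 (preferences n m)

luckyCar-suc : ∀ {n m} (j : Fin n) occ (i : Fin m) → luckyCar j occ (suc i) ≡ nextCar (λ o → luckyCar j o i) occ
luckyCar-suc {n} {m} j occ i = begin
  luckyCar j occ (suc i)
    ≡⟨ trans (total-cartesianProductWith _ _∷_ (allFin n) (preferences n m)) (total-tabulate {n = n} _ (λ p → p)) ⟩
  sum (λ p → total (λ a → indicator (luckyAt j occ (p ∷ a) (suc i))) (preferences n m))
    ≡⟨ sum-cong {n} (λ p → step (firstAvailable occ p)) ⟩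
  sum (λ p → afterParking (λ o → luckyCar j o i) occ (firstAvailable occ p))
    ≡⟨ sum-afterParking (λ o → luckyCar j o i) occ ⟩
  nextCar (λ o → luckyCar j o i) occ ∎
  where
  open ≡-Reasoning
  step : ∀ q →
    total (λ a → indicator (allParked (q ∷ parkFrom (occupy occ q) a)
      ∧ does (label (lookup a i) ℕ.≟ label j) ∧ parksAt (lookup (parkFrom (occupy occ q) a) i) (lookup a i))) (preferences n m)
      ≡ afterParking (λ o → luckyCar j o i) occ q
  step (just q) = refl
  step nothing  = total-0 (preferences n m)

nextCar-sum : ∀ {n m} (F : Fin m → Subset n → ℚ) occ →
  sum (λ i → nextCar (F i) occ) ≡ nextCar (λ o → sum (λ i → F i o)) occ
nextCar-sum {m = zero}  F occ = sym (nextCar-0 occ)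
nextCar-sum {m = suc m} F occ = trans
  (cong (_+_ (nextCar (F zero) occ)) (nextCar-sum (λ i → F (suc i)) occ))
  (sym (nextCar-+ (F zero) (λ o → sum (λ i → F (suc i) o)) occ))

sum-luckyCar : ∀ {n} (j : Fin n) occ m → sum (λ (i : Fin m) → luckyCar j occ i) ≡ luckyParkings j occ m
sum-luckyCar j occ zero    = refl
sum-luckyCar j occ (suc m) = begin
  luckyCar j occ zero + sum (λ (i : Fin m) → luckyCar j occ (suc i))
    ≡⟨ cong₂ _+_ (luckyCar-zero j occ) (trans (sum-cong {m} (λ i → luckyCar-suc j occ i)) (nextCar-sum {m = m} (λ i o → luckyCar j o i) occ)) ⟩
  claim j (λ o → parkings o m) occ + nextCar (λ o → sum (λ (i : Fin m) → luckyCar j o i)) occ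
    ≡⟨ +-comm (claim j (λ o → parkings o m) occ) _ ⟩
  nextCar (λ o → sum (λ (i : Fin m) → luckyCar j o i)) occ + claim j (λ o → parkings o m) occ
    ≡⟨ cong (_+ claim j (λ o → parkings o m) occ) (nextCar-cong occ (λ o _ → sum-luckyCar j o m)) ⟩
  luckyParkings j occ (suc m) ∎
  where open ≡-Reasoning

empty : ∀ n → Subset n
empty n = replicate n outside

sum-q : ∀ {n} (j : Fin n) → ι (ℕ.sum (List.map (λ i → q n i (label j)) (allFin n))) ≡ luckyParkings j (empty n) n
sum-q {n} j = begin
  ι (ℕ.sum (List.map (λ i → q n i (label j)) (allFin n)))
    ≡⟨ trans (ι-sum-map (λ i → q n i (label j)) (allFin n)) (total-tabulate {n = n} _ (λ i → i)) ⟩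
  sum (λ i → ι (q n i (label j)))
    ≡⟨ sum-cong {n} (λ i → ι-length-filter _ (preferences n n)) ⟩
  sum (λ i → luckyCar {m = n} j (empty n) i)
    ≡⟨ sum-luckyCar j (empty n) n ⟩
  luckyParkings j (empty n) n ∎
  where open ≡-Reasoning

-- Closed forms on an empty street

free-empty : ∀ n → free (empty n) ≡ n
free-empty zero    = refl
free-empty (suc n) = cong suc (free-empty n)

empty-++ : ∀ k n → empty k ++ outside ∷ empty n ≡ empty (k ℕ.+ suc n)
empty-++ zero    n = refl
empty-++ (suc k) n = cong (outside ∷_) (empty-++ k n)

-- This is the count (r + 1) (n + 1)^(l - 1), multiplied by n + 1 to avoid a negative exponent at l
-- = 0; r = 0 gives the number of parking functions. Peeling off the first spot leaves a binomial
-- sum with weights c + r, which the binomial theorem and its derivative evaluate.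
exactFill-empty : ∀ n r l → r ℕ.+ l ≡ n → ι (suc n) * exactFill r (empty n) l ≡ ι (suc r) * ι (suc n) ^ l
exactFill-empty zero    zero zero refl = refl
exactFill-empty (suc n) r    l    e    = *-cancelˡ-pos x {{ι-pos n}} (begin
  x * (ι (suc (suc n)) * exactFill r (empty (suc n)) l)
    ≡⟨ cong₂ (λ u v → x * (u * (S + v))) (ι-suc (suc n)) (skip-0 outside r) ⟩
  x * ((1ℚ + x) * (S + 0ℚ))           ≡⟨ swap x S ⟩
  (1ℚ + x) * (x * S)                  ≡⟨ cong (_*_ (1ℚ + x)) xS ⟩
  (1ℚ + x) * (D + ι r * (1ℚ + x) ^ l) ≡⟨ *-distribˡ-+ (1ℚ + x) D _ ⟩
  (1ℚ + x) * D + (1ℚ + x) * (ι r * (1ℚ + x) ^ l)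
    ≡⟨ cong (_+ (1ℚ + x) * (ι r * (1ℚ + x) ^ l)) (binomial-theorem′ l x 1ℚ) ⟩
  ι l * (1ℚ * (1ℚ + x) ^ l) + (1ℚ + x) * (ι r * (1ℚ + x) ^ l)
    ≡⟨ collect (ι l) (ι r) x ((1ℚ + x) ^ l) ⟩
  (ι r + ι l) * (1ℚ + x) ^ l + x * (ι r * (1ℚ + x) ^ l)
    ≡⟨ cong (λ u → u * (1ℚ + x) ^ l + x * (ι r * (1ℚ + x) ^ l)) (trans (sym (ι-+ r l)) (cong ι e)) ⟩
  x * (1ℚ + x) ^ l + x * (ι r * (1ℚ + x) ^ l)
    ≡⟨ factor (ι r) x ((1ℚ + x) ^ l) ⟩
  x * ((1ℚ + ι r) * (1ℚ + x) ^ l)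
    ≡⟨ cong₂ (λ u v → x * (u * v ^ l)) (ι-suc r) (ι-suc (suc n)) ⟨
  x * (ι (suc r) * ι (suc (suc n)) ^ l) ∎)
  where
  open ≡-Reasoning
  x S D : ℚ
  x = ι (suc n)
  S = binSum l (λ c b → absorb outside (λ r′ → exactFill r′ (empty n) b) (c ℕ.+ r))
  D = binSum l (λ c b → ι c * (1ℚ ^ c * x ^ b))
  swap : ∀ x s → x * ((1ℚ + x) * (s + 0ℚ)) ≡ (1ℚ + x) * (x * s)
  swap = solve-∀ ℚ-ring
  collect : ∀ l r x p → l * (1ℚ * p) + (1ℚ + x) * (r * p) ≡ (r + l) * p + x * (r * p)
  collect = solve-∀ ℚ-ring
  factor : ∀ r x p → x * p + x * (r * p) ≡ x * ((1ℚ + r) * p)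
  factor = solve-∀ ℚ-ring
  -- At ρ = 0 the first spot would stay free, and the factor `ι ρ` gives the required 0.
  absorbed : ∀ ρ b → b ℕ.+ ρ ≡ suc n → x * absorb outside (λ r′ → exactFill r′ (empty n) b) ρ ≡ ι ρ * x ^ b
  absorbed zero    b e = trans (*-zeroʳ x) (sym (*-zeroˡ (x ^ b)))
  absorbed (suc ρ) b e = exactFill-empty n ρ b (ℕ.suc-injective (trans (cong suc (ℕ.+-comm ρ b)) (trans (sym (ℕ.+-suc b ρ)) e)))
  count : ∀ c b → c ℕ.+ b ≡ l → b ℕ.+ (c ℕ.+ r) ≡ suc n
  count c b e′ = trans (sym (ℕ.+-assoc b c r)) (trans (cong (ℕ._+ r) (trans (ℕ.+-comm b c) e′)) (trans (ℕ.+-comm l r) e))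
  split : ∀ c r p → (c + r) * p ≡ c * (1ℚ * p) + r * (1ℚ * p)
  split = solve-∀ ℚ-ring
  xS : x * S ≡ D + ι r * (1ℚ + x) ^ l
  xS = begin
    x * S
      ≡⟨ binSum-*ˡ l x _ ⟨
    binSum l (λ c b → x * absorb outside (λ r′ → exactFill r′ (empty n) b) (c ℕ.+ r))
      ≡⟨ binSum-cong l (λ c b e′ → trans (absorbed (c ℕ.+ r) b (count c b e′)) (trans (cong (_* x ^ b) (ι-+ c r))
           (trans (split (ι c) (ι r) (x ^ b)) (cong (λ u → ι c * (u * x ^ b) + ι r * (u * x ^ b)) (sym (1^ c)))))) ⟩
    binSum l (λ c b → ι c * (1ℚ ^ c * x ^ b) + ι r * (1ℚ ^ c * x ^ b))
      ≡⟨ binSum-+ l (λ c b → ι c * (1ℚ ^ c * x ^ b)) (λ c b → ι r * (1ℚ ^ c * x ^ b)) ⟩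
    D + binSum l (λ c b → ι r * (1ℚ ^ c * x ^ b))
      ≡⟨ cong (_+_ D) (trans (binSum-*ˡ l (ι r) (λ c b → 1ℚ ^ c * x ^ b)) (cong (ι r *_) (binomial-theorem l x 1ℚ))) ⟩
    D + ι r * (1ℚ + x) ^ l ∎

-- The truncated difference makes the formula hold for all t: beyond n cars both sides are 0.
parkings-empty : ∀ n t → ι (suc n) * parkings (empty n) t ≡ ι (suc n ℕ.∸ t) * ι (suc n) ^ t
parkings-empty n t with t ℕ.≤? n
... | yes t≤n = begin
  ι (suc n) * parkings (empty n) t
    ≡⟨ cong (ι (suc n) *_) (parkings≡exactFill (n ℕ.∸ t) (empty n) t (trans (ℕ.m∸n+n≡m t≤n) (sym (free-empty n)))) ⟩
  ι (suc n) * exactFill (n ℕ.∸ t) (empty n) t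
    ≡⟨ exactFill-empty n (n ℕ.∸ t) t (ℕ.m∸n+n≡m t≤n) ⟩
  ι (suc (n ℕ.∸ t)) * ι (suc n) ^ t
    ≡⟨ cong (λ u → ι u * ι (suc n) ^ t) (ℕ.+-∸-assoc 1 t≤n) ⟨
  ι (suc n ℕ.∸ t) * ι (suc n) ^ t ∎
  where open ≡-Reasoning
... | no t≰n = begin
  ι (suc n) * parkings (empty n) t
    ≡⟨ cong (ι (suc n) *_) (parkings-overfull (empty n) t (subst (ℕ._< t) (sym (free-empty n)) (ℕ.≰⇒> t≰n))) ⟩
  ι (suc n) * 0ℚ                     ≡⟨ *-zeroʳ (ι (suc n)) ⟩
  0ℚ                                 ≡⟨ *-zeroˡ (ι (suc n) ^ t) ⟨
  0ℚ * ι (suc n) ^ t                 ≡⟨ cong (λ u → ι u * ι (suc n) ^ t) (ℕ.m≤n⇒m∸n≡0 (ℕ.≰⇒> t≰n)) ⟨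
  ι (suc n ℕ.∸ t) * ι (suc n) ^ t    ∎
  where open ≡-Reasoning

-- Σ_{t < l} f t · y^(l - 1 - t)
convolve : ℚ → (ℕ → ℚ) → ℕ → ℚ
convolve y f zero    = 0ℚ
convolve y f (suc l) = f 0 * y ^ l + convolve y (λ t → f (suc t)) l

nextCar-convolve : ∀ {n} y (F : Subset n → ℕ → ℚ) occ l →
  nextCar (λ o → convolve y (F o) l) occ ≡ convolve y (λ t → nextCar (λ o → F o t) occ) l
nextCar-convolve y F occ zero    = nextCar-0 occ
nextCar-convolve y F occ (suc l) = trans
  (nextCar-+ (λ o → F o 0 * y ^ l) (λ o → convolve y (λ t → F o (suc t)) l) occ)
  (cong₂ _+_ (nextCar-*ʳ (y ^ l) (λ o → F o 0) occ) (nextCar-convolve y (λ o t → F o (suc t)) occ l))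

-- Here t is the number of cars before the first one that prefers the extra spot. They all have to
-- park on the street, while the cars after it are unrestricted.
lucky≡convolve : ∀ {n} (occ : Subset n) l → lucky occ l ≡ convolve (ι (suc n)) (parkings occ) l
lucky≡convolve         occ zero    = refl
lucky≡convolve {n = n} occ (suc l) = cong₂ _+_ (sym (*-identityˡ (pow occ l)))
  (trans (nextCar-cong occ (λ o _ → lucky≡convolve o l)) (nextCar-convolve (ι (suc n)) parkings occ l))

triangle : ℕ → ℚ
triangle zero    = 0ℚ
triangle (suc m) = ι (suc m) + triangle m

-- By `h`, the summand at t times y^2 is c (m - t) y^l for t < m and 0 afterwards, so the sum is
-- complete as soon as l reaches m. The parameter c takes up a factor y whenever `f` is shifted.
convolve-triangle : ∀ y c (f : ℕ → ℚ) m → (∀ t → y * f t ≡ c * (ι (m ℕ.∸ t) * y ^ t)) →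
  ∀ l → m ℕ.≤ l → y * (y * convolve y f l) ≡ c * (triangle m * y ^ l)
convolve-triangle y c f zero    h zero    m≤l = vanish y c
  where
  vanish : ∀ y c → y * (y * 0ℚ) ≡ c * (0ℚ * 1ℚ)
  vanish = solve-∀ ℚ-ring
convolve-triangle y c f zero    h (suc l) m≤l = begin
  y * (y * (f 0 * y ^ l + convolve y (λ t → f (suc t)) l))
    ≡⟨ expand y (f 0) (y ^ l) _ ⟩
  (y * f 0) * (y * y ^ l) + y * (y * convolve y (λ t → f (suc t)) l)
    ≡⟨ cong₂ (λ u v → u * (y * y ^ l) + v) (h 0)
         (convolve-triangle y (c * y) (λ t → f (suc t)) 0 (λ t → trans (h (suc t))
           (trans (shift c y (y ^ t)) (cong (λ u → (c * y) * (ι u * y ^ t)) (sym (ℕ.0∸n≡0 t))))) l z≤n) ⟩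
  c * (0ℚ * 1ℚ) * (y * y ^ l) + (c * y) * (0ℚ * y ^ l)
    ≡⟨ vanish y c (y ^ l) ⟩
  c * (0ℚ * (y * y ^ l)) ∎
  where
  open ≡-Reasoning
  expand : ∀ y f p u → y * (y * (f * p + u)) ≡ (y * f) * (y * p) + y * (y * u)
  expand = solve-∀ ℚ-ring
  shift : ∀ c y p → c * (0ℚ * (y * p)) ≡ (c * y) * (0ℚ * p)
  shift = solve-∀ ℚ-ring
  vanish : ∀ y c p → c * (0ℚ * 1ℚ) * (y * p) + (c * y) * (0ℚ * p) ≡ c * (0ℚ * (y * p))
  vanish = solve-∀ ℚ-ring
convolve-triangle y c f (suc m) h (suc l) (s≤s m≤l) = begin
  y * (y * (f 0 * y ^ l + convolve y (λ t → f (suc t)) l))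
    ≡⟨ expand y (f 0) (y ^ l) _ ⟩
  (y * f 0) * (y * y ^ l) + y * (y * convolve y (λ t → f (suc t)) l)
    ≡⟨ cong₂ (λ u v → u * (y * y ^ l) + v) (h 0)
         (convolve-triangle y (c * y) (λ t → f (suc t)) m (λ t → trans (h (suc t)) (shift c y (ι (m ℕ.∸ t)) (y ^ t))) l m≤l) ⟩
  c * (ι (suc m) * 1ℚ) * (y * y ^ l) + (c * y) * (triangle m * y ^ l)
    ≡⟨ collect c y (ι (suc m)) (triangle m) (y ^ l) ⟩
  c * ((ι (suc m) + triangle m) * (y * y ^ l)) ∎
  where
  open ≡-Reasoning
  expand : ∀ y f p u → y * (y * (f * p + u)) ≡ (y * f) * (y * p) + y * (y * u)
  expand = solve-∀ ℚ-ring
  shift : ∀ c y m p → c * (m * (y * p)) ≡ (c * y) * (m * p)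
  shift = solve-∀ ℚ-ring
  collect : ∀ c y m t p → c * (m * 1ℚ) * (y * p) + (c * y) * (t * p) ≡ c * ((m + t) * (y * p))
  collect = solve-∀ ℚ-ring

recip : ℕ → ℚ
recip n = + 1 / suc n

recip-* : ∀ n → recip n * ι (suc n) ≡ 1ℚ
recip-* n = /-*-cancel 1 (suc n)

-- The limiting proportion of lucky sequences on suc n spots: (n + 2) / 2 (n + 1).
luckyRate : ℕ → ℚ
luckyRate n = triangle (suc n) * (recip n * recip n)

lucky∞ : ∀ {n} → Subset n → ℕ → ℚ
lucky∞ {n} occ l = luckyRate n * ι (suc n) ^ l

lucky-empty : ∀ n l → suc n ℕ.≤ l → lucky (empty n) l ≡ lucky∞ (empty n) l
lucky-empty n l n<l = begin
  lucky (empty n) l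
    ≡⟨ unit (recip n * y) (lucky (empty n) l) (recip-* n) ⟨
  (recip n * y) * ((recip n * y) * lucky (empty n) l)
    ≡⟨ regroup (recip n) y (lucky (empty n) l) ⟩
  (recip n * recip n) * (y * (y * lucky (empty n) l))
    ≡⟨ cong (λ u → (recip n * recip n) * (y * (y * u))) (lucky≡convolve (empty n) l) ⟩
  (recip n * recip n) * (y * (y * convolve y (parkings (empty n)) l))
    ≡⟨ cong (_*_ (recip n * recip n)) (convolve-triangle y 1ℚ (parkings (empty n)) (suc n)
         (λ t → trans (parkings-empty n t) (sym (*-identityˡ _))) l n<l) ⟩
  (recip n * recip n) * (1ℚ * (triangle (suc n) * y ^ l))
    ≡⟨ rotate (recip n * recip n) (triangle (suc n)) (y ^ l) ⟩
  lucky∞ (empty n) l ∎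
  where
  open ≡-Reasoning
  y : ℚ
  y = ι (suc n)
  unit : ∀ u v → u ≡ 1ℚ → u * (u * v) ≡ v
  unit u v refl = trans (*-identityˡ (1ℚ * v)) (*-identityˡ v)
  regroup : ∀ r y v → (r * y) * ((r * y) * v) ≡ (r * r) * (y * (y * v))
  regroup = solve-∀ ℚ-ring
  rotate : ∀ r t p → r * (1ℚ * (t * p)) ≡ (t * r) * p
  rotate = solve-∀ ℚ-ring

luckyGap∞ : ∀ {n} → ℕ → Subset n → ℕ → ℚ
luckyGap∞ = fill (λ _ _ → 0ℚ) lucky∞

-- Filling the i spots before the first gap uses up i cars, so at least n - i cars remain for the n
-- - i - 1 spots beyond it. This is just what `lucky-empty` requires.
luckyGap-empty : ∀ n r l → n ℕ.≤ l ℕ.+ r → luckyGap r (empty n) l ≡ luckyGap∞ r (empty n) l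
luckyGap-empty zero    r l h = refl
luckyGap-empty (suc n) r l h = cong₂ _+_ (binSum-cong l step) (last r h)
  where
  step : ∀ c b → c ℕ.+ b ≡ l →
    absorb outside (λ r′ → luckyGap r′ (empty n) b) (c ℕ.+ r) ≡ absorb outside (λ r′ → luckyGap∞ r′ (empty n) b) (c ℕ.+ r)
  step c b e with c ℕ.+ r in e′
  ... | zero   = refl
  ... | suc r′ = luckyGap-empty n r′ b (ℕ.s≤s⁻¹ (subst (suc n ℕ.≤_) count h))
    where
    count : l ℕ.+ r ≡ suc (b ℕ.+ r′)
    count = trans (cong (ℕ._+ r) (trans (sym e) (ℕ.+-comm c b))) (trans (ℕ.+-assoc b c r) (trans (cong (b ℕ.+_) e′) (ℕ.+-suc b r′)))
  last : ∀ r → suc n ℕ.≤ l ℕ.+ r → skip outside r (lucky (empty n) l) ≡ skip outside r (lucky∞ (empty n) l)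
  last zero    h = lucky-empty n l (subst (suc n ℕ.≤_) (ℕ.+-identityʳ l) h)
  last (suc r) h = refl

-- Cancellation of the sequences with a free spot

-- Up to normalisation this is the expectation of s - κ for a binomial variable s with mean m y / (y
-- + x). It vanishes when κ is the mean, which disposes of the gap terms; with κ = k it yields the
-- main term.
binSum-tilted : ∀ m g x y κ →
  (y + x) * binSum m (λ s b → (g * y ^ s) * ((ι s - κ) * x ^ b)) ≡ g * ((ι m * y - (y + x) * κ) * (y + x) ^ m)
binSum-tilted m g x y κ = begin
  (y + x) * binSum m (λ s b → (g * y ^ s) * ((ι s - κ) * x ^ b))
    ≡⟨ cong (_*_ (y + x)) (trans (binSum-cong m (λ s b _ → expand g (y ^ s) (ι s) κ (x ^ b)))
         (trans (binSum-+ m (λ s b → g * (ι s * (y ^ s * x ^ b))) (λ s b → - (g * κ) * (y ^ s * x ^ b)))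
           (cong₂ _+_ (binSum-*ˡ m g _) (trans (binSum-*ˡ m (- (g * κ)) _) (cong (- (g * κ) *_) (binomial-theorem m x y)))))) ⟩
  (y + x) * (g * D + - (g * κ) * (y + x) ^ m)
    ≡⟨ regroup (y + x) g D κ ((y + x) ^ m) ⟩
  g * ((y + x) * D) - g * ((y + x) * κ * (y + x) ^ m)
    ≡⟨ cong (λ u → g * u - g * ((y + x) * κ * (y + x) ^ m)) (binomial-theorem′ m x y) ⟩
  g * (ι m * (y * (y + x) ^ m)) - g * ((y + x) * κ * (y + x) ^ m)
    ≡⟨ factor g (ι m) y ((y + x) * κ) ((y + x) ^ m) ⟩
  g * ((ι m * y - (y + x) * κ) * (y + x) ^ m) ∎
  where
  open ≡-Reasoning
  D : ℚ
  D = binSum m (λ s b → ι s * (y ^ s * x ^ b))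
  expand : ∀ g p s κ q → (g * p) * ((s - κ) * q) ≡ g * (s * (p * q)) + - (g * κ) * (p * q)
  expand = solve-∀ ℚ-ring
  regroup : ∀ z g d κ p → z * (g * d + - (g * κ) * p) ≡ g * (z * d) - g * (z * κ * p)
  regroup = solve-∀ ℚ-ring
  factor : ∀ g m y w p → g * (m * (y * p)) - g * (w * p) ≡ g * ((m * y - w) * p)
  factor = solve-∀ ℚ-ring

-- Peeling off a spot that gets filled lowers k and the number of cars available by
-- one each; at the first gap, what is left is the binomial theorem for the spots
-- after it.
luckyGap∞-cancels : ∀ k r m N → m ℕ.+ r ≡ suc N ℕ.+ k →
  binSum m (λ s b → luckyGap∞ r (empty k) s * ((ι (s ℕ.+ r) - ι k) * ι (suc N) ^ b)) ≡ 0ℚ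
luckyGap∞-cancels zero    r m N e = trans (binSum-cong m (λ s b _ → *-zeroˡ ((ι (s ℕ.+ r) - ι 0) * ι (suc N) ^ b))) (binSum-0 m)
luckyGap∞-cancels (suc k) r m N e = begin
  binSum m (λ s b → (binSum s (A r) + skip outside r (lucky∞ (empty k) s)) * W r s b)
    ≡⟨ trans (binSum-cong m (λ s b _ → *-distribʳ-+ (W r s b) (binSum s (A r)) _))
         (binSum-+ m (λ s b → binSum s (A r) * W r s b) (λ s b → skip outside r (lucky∞ (empty k) s) * W r s b)) ⟩
  binSum m (λ s b → binSum s (A r) * W r s b) + binSum m (λ s b → skip outside r (lucky∞ (empty k) s) * W r s b)
    ≡⟨ cong₂ _+_ later (first r e) ⟩
  0ℚ ∎
  where
  open ≡-Reasoning
  x y : ℚ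
  x = ι (suc N)
  y = ι (suc k)
  W : ℕ → ℕ → ℕ → ℚ
  W r s b = (ι (s ℕ.+ r) - y) * x ^ b
  A : ℕ → ℕ → ℕ → ℚ
  A r c d = absorb outside (λ r′ → luckyGap∞ r′ (empty k) d) (c ℕ.+ r)
  sub-suc : ∀ a b → (1ℚ + a) - (1ℚ + b) ≡ a - b
  sub-suc = solve-∀ ℚ-ring
  inner : ∀ c t → c ℕ.+ t ≡ m → binSum t (λ d b → A r c d * W r (c ℕ.+ d) b) ≡ 0ℚ
  inner c t e′ with c ℕ.+ r in e″
  ... | zero   = trans (binSum-cong t (λ d b _ → *-zeroˡ (W r (c ℕ.+ d) b))) (binSum-0 t)
  ... | suc r′ = trans (binSum-cong t (λ d b _ → cong (λ u → luckyGap∞ r′ (empty k) d * (u * x ^ b)) (weight d)))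
                       (luckyGap∞-cancels k r′ t N (ℕ.suc-injective (begin
    suc (t ℕ.+ r′)     ≡⟨ ℕ.+-suc t r′ ⟨
    t ℕ.+ suc r′       ≡⟨ cong (t ℕ.+_) e″ ⟨
    t ℕ.+ (c ℕ.+ r)    ≡⟨ ℕ.+-assoc t c r ⟨
    (t ℕ.+ c) ℕ.+ r    ≡⟨ cong (ℕ._+ r) (trans (ℕ.+-comm t c) e′) ⟩
    m ℕ.+ r            ≡⟨ e ⟩
    suc N ℕ.+ suc k    ≡⟨ ℕ.+-suc (suc N) k ⟩
    suc (suc N ℕ.+ k)  ∎)))
    where
    weight : ∀ d → ι ((c ℕ.+ d) ℕ.+ r) - y ≡ ι (d ℕ.+ r′) - ι k
    weight d = begin
      ι ((c ℕ.+ d) ℕ.+ r) - y             ≡⟨ cong (λ u → ι u - y) (begin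
        (c ℕ.+ d) ℕ.+ r                     ≡⟨ cong (ℕ._+ r) (ℕ.+-comm c d) ⟩
        (d ℕ.+ c) ℕ.+ r                     ≡⟨ ℕ.+-assoc d c r ⟩
        d ℕ.+ (c ℕ.+ r)                     ≡⟨ cong (d ℕ.+_) e″ ⟩
        d ℕ.+ suc r′                        ≡⟨ ℕ.+-suc d r′ ⟩
        suc (d ℕ.+ r′)                      ∎) ⟩
      ι (suc (d ℕ.+ r′)) - y              ≡⟨ cong₂ _-_ (ι-suc (d ℕ.+ r′)) (ι-suc k) ⟩
      (1ℚ + ι (d ℕ.+ r′)) - (1ℚ + ι k)    ≡⟨ sub-suc (ι (d ℕ.+ r′)) (ι k) ⟩
      ι (d ℕ.+ r′) - ι k                  ∎
  later : binSum m (λ s b → binSum s (A r) * W r s b) ≡ 0ℚ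
  later = begin
    binSum m (λ s b → binSum s (A r) * W r s b)
      ≡⟨ binSum-cong m (λ s b _ → trans (sym (binSum-*ʳ s (W r s b) (A r)))
           (binSum-cong s (λ c d e′ → cong (λ u → A r c d * W r u b) (sym e′)))) ⟩
    binSum m (λ s b → binSum s (λ c d → A r c d * W r (c ℕ.+ d) b))
      ≡⟨ binSum-assoc m (λ c d b → A r c d * W r (c ℕ.+ d) b) ⟩
    binSum m (λ c t → binSum t (λ d b → A r c d * W r (c ℕ.+ d) b))
      ≡⟨ trans (binSum-cong m inner) (binSum-0 m) ⟩
    0ℚ ∎
  first : ∀ r → m ℕ.+ r ≡ suc N ℕ.+ suc k → binSum m (λ s b → skip outside r (lucky∞ (empty k) s) * W r s b) ≡ 0ℚ
  first (suc r) e = trans (binSum-cong m (λ s b _ → *-zeroˡ (W (suc r) s b))) (binSum-0 m)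
  -- No car from the left means m = y + x, so the mean of s is exactly the subtracted y. Multiplying
  -- by y + x > 0 makes `binSum-tilted` applicable.
  first zero    e = *-cancelˡ-pos (y + x) {{pos+pos⇒pos y {{ι-pos k}} x {{ι-pos N}}}} (begin
    (y + x) * binSum m (λ s b → (luckyRate k * y ^ s) * W 0 s b)
      ≡⟨ cong (_*_ (y + x)) (binSum-cong m (λ s b _ → cong (λ u → (luckyRate k * y ^ s) * ((ι u - y) * x ^ b)) (ℕ.+-identityʳ s))) ⟩
    (y + x) * binSum m (λ s b → (luckyRate k * y ^ s) * ((ι s - y) * x ^ b))
      ≡⟨ binSum-tilted m (luckyRate k) x y y ⟩
    luckyRate k * ((ι m * y - (y + x) * y) * (y + x) ^ m)
      ≡⟨ cong (λ u → luckyRate k * ((u * y - (y + x) * y) * (y + x) ^ m)) (begin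
           ι m                  ≡⟨ cong ι (trans (sym (ℕ.+-identityʳ m)) (trans e (ℕ.+-comm (suc N) (suc k)))) ⟩
           ι (suc k ℕ.+ suc N)  ≡⟨ ι-+ (suc k) (suc N) ⟩
           y + x                ∎) ⟩
    luckyRate k * (((y + x) * y - (y + x) * y) * (y + x) ^ m)
      ≡⟨ vanish (luckyRate k) (y + x) y ((y + x) ^ m) ⟩
    (y + x) * 0ℚ ∎)
    where
    vanish : ∀ g z y p → g * ((z * y - z * y) * p) ≡ z * 0ℚ
    vanish = solve-∀ ℚ-ring

-- The number of parking functions with a given lucky spot

luckyFill∞ : ℕ → ℕ → ℚ
luckyFill∞ k s = lucky∞ (empty k) s - luckyGap∞ 0 (empty k) s

correction : ℕ → ℕ → ℚ
correction k s = if does (s ℕ.<? k) then luckyFill∞ k s * (ι k - ι s) else 0ℚ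

-- For s > k the closed forms hold. At s = k, which they do not cover, the weight s - k is 0. For s
-- < k the true count is 0, and `correction` removes what the closed form adds.
luckyFill-correction : ∀ k s →
  luckyFill (empty k) s * (ι s - ι k) ≡ luckyFill∞ k s * (ι s - ι k) + correction k s
luckyFill-correction k s with ℕ.<-cmp s k
... | tri< s<k _ _ = begin
  luckyFill (empty k) s * (ι s - ι k)
    ≡⟨ cong (_* (ι s - ι k)) (luckyFill-small (empty k) s (subst (s ℕ.≤_) (sym (free-empty k)) (ℕ.<⇒≤ s<k))) ⟩
  0ℚ * (ι s - ι k)
    ≡⟨ cancel (ι s) (ι k) (luckyFill∞ k s) ⟩
  luckyFill∞ k s * (ι s - ι k) + luckyFill∞ k s * (ι k - ι s)
    ≡⟨ cong (λ t → luckyFill∞ k s * (ι s - ι k) + (if t then luckyFill∞ k s * (ι k - ι s) else 0ℚ)) (dec-true (s ℕ.<? k) s<k) ⟨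
  luckyFill∞ k s * (ι s - ι k) + correction k s ∎
  where
  open ≡-Reasoning
  cancel : ∀ s k w → 0ℚ * (s - k) ≡ w * (s - k) + w * (k - s)
  cancel = solve-∀ ℚ-ring
... | tri≈ ¬s<k refl _ = begin
  luckyFill (empty s) s * (ι s - ι s)
    ≡⟨ cancel (ι s) (luckyFill (empty s) s) (luckyFill∞ s s) ⟩
  luckyFill∞ s s * (ι s - ι s) + 0ℚ
    ≡⟨ cong (λ t → luckyFill∞ s s * (ι s - ι s) + (if t then luckyFill∞ s s * (ι s - ι s) else 0ℚ)) (dec-false (s ℕ.<? s) ¬s<k) ⟨
  luckyFill∞ s s * (ι s - ι s) + correction s s ∎
  where
  open ≡-Reasoning
  cancel : ∀ s v w → v * (s - s) ≡ w * (s - s) + 0ℚ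
  cancel = solve-∀ ℚ-ring
... | tri> ¬s<k _ k<s = begin
  luckyFill (empty k) s * (ι s - ι k)
    ≡⟨ cong (_* (ι s - ι k)) (trans (add-sub (luckyFill (empty k) s) (luckyGap 0 (empty k) s))
         (cong₂ _-_ (trans (sym (lucky≡luckyFill+luckyGap (empty k) s)) (lucky-empty k s k<s))
                    (luckyGap-empty k 0 s (ℕ.m≤n⇒m≤n+o 0 (ℕ.<⇒≤ k<s))))) ⟩
  luckyFill∞ k s * (ι s - ι k)
    ≡⟨ +-identityʳ _ ⟨
  luckyFill∞ k s * (ι s - ι k) + 0ℚ
    ≡⟨ cong (λ t → luckyFill∞ k s * (ι s - ι k) + (if t then luckyFill∞ k s * (ι k - ι s) else 0ℚ)) (dec-false (s ℕ.<? k) ¬s<k) ⟨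
  luckyFill∞ k s * (ι s - ι k) + correction k s ∎
  where
  open ≡-Reasoning
  add-sub : ∀ a b → a ≡ (a + b) - b
  add-sub = solve-∀ ℚ-ring

module _ (k N : ℕ) where

  private
    n p : ℕ
    n = k ℕ.+ suc N
    p = k ℕ.+ N
    x y z L R : ℚ
    x = ι (suc N)
    y = ι (suc k)
    z = ι (suc n)
    L = luckyParkings (k ↑ʳ zero) (empty n) n
    R = binSum n (λ s b → correction k s * x ^ b)

  -- The factor x clears the denominator in `exactFill-empty` for the N spots to the right of the
  -- cut.
  luckyParkings-weighted : x * L ≡ binSum n (λ s b → luckyFill (empty k) s * ((ι s - ι k) * x ^ b))
  luckyParkings-weighted = begin
    x * L
      ≡⟨ cong (λ o → x * luckyParkings (k ↑ʳ zero) o n) (empty-++ k N) ⟨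
    x * luckyParkings (k ↑ʳ zero) (empty k ++ outside ∷ empty N) n
      ≡⟨ cong (x *_) (luckyParkings-untaken n (empty k) (empty N)
           (sym (cong₂ (λ a b → a ℕ.+ suc b) (free-empty k) (free-empty N)))) ⟩
    x * binSum n (λ s b → luckyFill (empty k) s * exactFill (s ℕ.∸ suc (free (empty k))) (empty N) b)
      ≡⟨ binSum-*ˡ n x (λ s b → luckyFill (empty k) s * exactFill (s ℕ.∸ suc (free (empty k))) (empty N) b) ⟨
    binSum n (λ s b → x * (luckyFill (empty k) s * exactFill (s ℕ.∸ suc (free (empty k))) (empty N) b))
      ≡⟨ binSum-cong n (λ s b e → trans
           (cong (λ u → x * (luckyFill (empty k) s * exactFill (s ℕ.∸ suc u) (empty N) b)) (free-empty k)) (term s b e)) ⟩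
    binSum n (λ s b → luckyFill (empty k) s * ((ι s - ι k) * x ^ b)) ∎
    where
    open ≡-Reasoning
    swap : ∀ x w g → x * (w * g) ≡ w * (x * g)
    swap = solve-∀ ℚ-ring
    add-sub : ∀ a b → b ≡ (a + b) - a
    add-sub = solve-∀ ℚ-ring
    term : ∀ s b → s ℕ.+ b ≡ n →
      x * (luckyFill (empty k) s * exactFill (s ℕ.∸ suc k) (empty N) b) ≡ luckyFill (empty k) s * ((ι s - ι k) * x ^ b)
    term s b e with s ℕ.≤? k
    -- Here the truncated `s ∸ suc k` does not count overflowing cars, but too few cars reach the
    -- left part and `luckyFill` vanishes.
    ... | yes s≤k = trans (cong (λ w → x * (w * exactFill (s ℕ.∸ suc k) (empty N) b)) w≡0)
      (trans (trans (swap x 0ℚ _) (*-zeroˡ (x * exactFill (s ℕ.∸ suc k) (empty N) b))) (sym (trans (cong (_* ((ι s - ι k) * x ^ b)) w≡0) (*-zeroˡ ((ι s - ι k) * x ^ b)))))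
      where
      w≡0 : luckyFill (empty k) s ≡ 0ℚ
      w≡0 = luckyFill-small (empty k) s (subst (s ℕ.≤_) (sym (free-empty k)) s≤k)
    ... | no s≰k = begin
      x * (luckyFill (empty k) s * exactFill f (empty N) b)
        ≡⟨ swap x (luckyFill (empty k) s) _ ⟩
      luckyFill (empty k) s * (x * exactFill f (empty N) b)
        ≡⟨ cong (luckyFill (empty k) s *_) (exactFill-empty N f b f+b≡N) ⟩
      luckyFill (empty k) s * (ι (suc f) * x ^ b)
        ≡⟨ cong (λ u → luckyFill (empty k) s * (u * x ^ b)) (begin
             ι (suc f)                  ≡⟨ add-sub (ι k) (ι (suc f)) ⟩
             (ι k + ι (suc f)) - ι k    ≡⟨ cong (_- ι k) (ι-+ k (suc f)) ⟨
             ι (k ℕ.+ suc f) - ι k      ≡⟨ cong (λ u → ι u - ι k) s≡ ⟩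
             ι s - ι k                  ∎) ⟩
      luckyFill (empty k) s * ((ι s - ι k) * x ^ b) ∎
      where
      f : ℕ
      f = s ℕ.∸ suc k
      s≡ : k ℕ.+ suc f ≡ s
      s≡ = trans (ℕ.+-suc k f) (ℕ.m+[n∸m]≡n (ℕ.≰⇒> s≰k))
      f+b≡N : f ℕ.+ b ≡ N
      f+b≡N = ℕ.suc-injective (ℕ.+-cancelˡ-≡ k (suc (f ℕ.+ b)) (suc N)
        (trans (sym (ℕ.+-assoc k (suc f) b)) (trans (cong (ℕ._+ b) s≡) e)))

  luckyParkings-closed : x * L ≡ luckyRate k * (x * z ^ p) + R
  luckyParkings-closed = begin
    x * L
      ≡⟨ luckyParkings-weighted ⟩
    binSum n (λ s b → luckyFill (empty k) s * ((ι s - ι k) * x ^ b))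
      ≡⟨ binSum-cong n (λ s b _ → term s b) ⟩
    binSum n (λ s b → lucky∞ (empty k) s * ((ι s - ι k) * x ^ b)
                    + (- 1ℚ * (luckyGap∞ 0 (empty k) s * ((ι (s ℕ.+ 0) - ι k) * x ^ b)) + correction k s * x ^ b))
      ≡⟨ trans (binSum-+ n (λ s b → lucky∞ (empty k) s * ((ι s - ι k) * x ^ b)) _)
           (cong (_+_ M) (trans (binSum-+ n (λ s b → - 1ℚ * (luckyGap∞ 0 (empty k) s * ((ι (s ℕ.+ 0) - ι k) * x ^ b))) _)
             (cong (_+ R) (binSum-*ˡ n (- 1ℚ) (λ s b → luckyGap∞ 0 (empty k) s * ((ι (s ℕ.+ 0) - ι k) * x ^ b)))))) ⟩
    M + (- 1ℚ * binSum n (λ s b → luckyGap∞ 0 (empty k) s * ((ι (s ℕ.+ 0) - ι k) * x ^ b)) + R)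
      ≡⟨ cong₂ (λ u v → u + (- 1ℚ * v + R)) main (luckyGap∞-cancels k 0 n N
           (trans (ℕ.+-identityʳ n) (ℕ.+-comm k (suc N)))) ⟩
    luckyRate k * (x * z ^ p) + (- 1ℚ * 0ℚ + R)
      ≡⟨ cong (_+_ (luckyRate k * (x * z ^ p))) (+-identityˡ R) ⟩
    luckyRate k * (x * z ^ p) + R ∎
    where
    open ≡-Reasoning
    M : ℚ
    M = binSum n (λ s b → lucky∞ (empty k) s * ((ι s - ι k) * x ^ b))
    expand : ∀ w t q → w * (t * q) ≡ (w * t) * q
    expand = solve-∀ ℚ-ring
    split : ∀ l g t c q → ((l - g) * t + c) * q ≡ l * (t * q) + (- 1ℚ * (g * (t * q)) + c * q)
    split = solve-∀ ℚ-ring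
    term : ∀ s b → luckyFill (empty k) s * ((ι s - ι k) * x ^ b)
      ≡ lucky∞ (empty k) s * ((ι s - ι k) * x ^ b)
        + (- 1ℚ * (luckyGap∞ 0 (empty k) s * ((ι (s ℕ.+ 0) - ι k) * x ^ b)) + correction k s * x ^ b)
    term s b = begin
      luckyFill (empty k) s * ((ι s - ι k) * x ^ b)
        ≡⟨ expand (luckyFill (empty k) s) (ι s - ι k) (x ^ b) ⟩
      luckyFill (empty k) s * (ι s - ι k) * x ^ b
        ≡⟨ cong (_* x ^ b) (luckyFill-correction k s) ⟩
      (luckyFill∞ k s * (ι s - ι k) + correction k s) * x ^ b
        ≡⟨ split (lucky∞ (empty k) s) (luckyGap∞ 0 (empty k) s) (ι s - ι k) (correction k s) (x ^ b) ⟩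
      lucky∞ (empty k) s * ((ι s - ι k) * x ^ b)
        + (- 1ℚ * (luckyGap∞ 0 (empty k) s * ((ι s - ι k) * x ^ b)) + correction k s * x ^ b)
        ≡⟨ cong (λ u → lucky∞ (empty k) s * ((ι s - ι k) * x ^ b)
             + (- 1ℚ * (luckyGap∞ 0 (empty k) s * ((ι u - ι k) * x ^ b)) + correction k s * x ^ b)) (ℕ.+-identityʳ s) ⟨
      lucky∞ (empty k) s * ((ι s - ι k) * x ^ b)
        + (- 1ℚ * (luckyGap∞ 0 (empty k) s * ((ι (s ℕ.+ 0) - ι k) * x ^ b)) + correction k s * x ^ b) ∎
    y+x≡z : y + x ≡ z
    y+x≡z = sym (ι-+ (suc k) (suc N))
    -- With n = k + x and y = 1 + k, the factor n y - (y + x) k from `binSum-tilted` collapses to x.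
    slope : ∀ k x → (k + x) * (1ℚ + k) - ((1ℚ + k) + x) * k ≡ x
    slope = solve-∀ ℚ-ring
    reorder : ∀ g x z q → g * (x * (z * q)) ≡ z * (g * (x * q))
    reorder = solve-∀ ℚ-ring
    main : M ≡ luckyRate k * (x * z ^ p)
    main = *-cancelˡ-pos z {{ι-pos n}} (begin
      z * M
        ≡⟨ cong (_* M) y+x≡z ⟨
      (y + x) * M
        ≡⟨ binSum-tilted n (luckyRate k) x y (ι k) ⟩
      luckyRate k * ((ι n * y - (y + x) * ι k) * (y + x) ^ n)
        ≡⟨ cong₂ (λ u v → luckyRate k * (u * v))
             (trans (cong₂ (λ a b → a * b - (b + x) * ι k) (ι-+ k (suc N)) (ι-suc k)) (slope (ι k) x))
             (cong₂ _^_ y+x≡z (ℕ.+-suc k N)) ⟩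
      luckyRate k * (x * (z * z ^ p))
        ≡⟨ reorder (luckyRate k) x z (z ^ p) ⟩
      z * (luckyRate k * (x * z ^ p)) ∎)

-- The lucky probability in closed form

^-distrib-* : ∀ a b n → (a * b) ^ n ≡ a ^ n * b ^ n
^-distrib-* a b zero    = refl
^-distrib-* a b (suc n) = trans (cong (_*_ (a * b)) (^-distrib-* a b n)) (interchange a b (a ^ n) (b ^ n))
  where
  interchange : ∀ a b p q → (a * b) * (p * q) ≡ (a * p) * (b * q)
  interchange = solve-∀ ℚ-ring

^-inverse : ∀ a b n → a * b ≡ 1ℚ → a ^ n * b ^ n ≡ 1ℚ
^-inverse a b n ab≡1 = trans (sym (^-distrib-* a b n)) (trans (cong (_^ n) ab≡1) (1^ n))

partialSum : (ℕ → ℚ) → ℕ → ℚ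
partialSum f zero    = 0ℚ
partialSum f (suc m) = partialSum f m + f m

partialSum-cong : ∀ {f g : ℕ → ℚ} m → (∀ s → f s ≡ g s) → partialSum f m ≡ partialSum g m
partialSum-cong zero    f≡g = refl
partialSum-cong (suc m) f≡g = cong₂ _+_ (partialSum-cong m f≡g) (f≡g m)

partialSum-+ : ∀ f g m → partialSum (λ s → f s + g s) m ≡ partialSum f m + partialSum g m
partialSum-+ f g zero    = refl
partialSum-+ f g (suc m) = trans (cong (_+ (f m + g m)) (partialSum-+ f g m)) (+-interchange (partialSum f m) (partialSum g m) (f m) (g m))

partialSum-head : ∀ f m → partialSum f (suc m) ≡ f 0 + partialSum (λ s → f (suc s)) m
partialSum-head f zero    = +-comm 0ℚ (f 0)
partialSum-head f (suc m) = trans (cong (_+ f (suc m)) (partialSum-head f m)) (+-assoc (f 0) _ (f (suc m)))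

partialSum-0 : ∀ {f} m → (∀ s → f s ≡ 0ℚ) → partialSum f m ≡ 0ℚ
partialSum-0 zero    f≡0 = refl
partialSum-0 (suc m) f≡0 = cong₂ _+_ (partialSum-0 m f≡0) (f≡0 m)

partialSum-truncate : ∀ {f} k → (∀ s → k ℕ.≤ s → f s ≡ 0ℚ) → ∀ d → partialSum f (k ℕ.+ d) ≡ partialSum f k
partialSum-truncate {f} k f≡0 zero    = cong (partialSum f) (ℕ.+-identityʳ k)
partialSum-truncate {f} k f≡0 (suc d) = trans (cong (partialSum f) (ℕ.+-suc k d))
  (trans (cong₂ _+_ (partialSum-truncate k f≡0 d) (f≡0 (k ℕ.+ d) (ℕ.m≤m+n k d))) (+-identityʳ _))

choose : ℕ → ℕ → ℚ
choose m       zero    = 1ℚ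
choose zero    (suc s) = 0ℚ
choose (suc m) (suc s) = choose m s + choose m (suc s)

-- `choose` vanishes beyond m, so any bound M > m will do. This freedom lets the sum later be
-- truncated to a number of terms independent of m.
binSum≡partialSum : ∀ m M φ → m ℕ.< M → binSum m (λ s _ → φ s) ≡ partialSum (λ s → choose m s * φ s) M
binSum≡partialSum zero    (suc M) φ m<M = sym (trans (partialSum-head (λ s → choose 0 s * φ s) M)
  (trans (cong₂ _+_ (*-identityˡ (φ 0)) (partialSum-0 M (λ s → *-zeroˡ (φ (suc s))))) (+-identityʳ (φ 0))))
binSum≡partialSum (suc m) (suc M) φ (s≤s m<M) = begin
  binSum m (λ s _ → φ (suc s)) + binSum m (λ s _ → φ s)
    ≡⟨ cong₂ _+_ (binSum≡partialSum m M (λ s → φ (suc s)) m<M) (binSum≡partialSum m (suc M) φ (ℕ.m≤n⇒m≤1+n m<M)) ⟩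
  partialSum (λ s → choose m s * φ (suc s)) M + partialSum (λ s → choose m s * φ s) (suc M)
    ≡⟨ cong (_+_ (partialSum (λ s → choose m s * φ (suc s)) M)) (partialSum-head (λ s → choose m s * φ s) M) ⟩
  A + (φ₀ + C)
    ≡⟨ swap A φ₀ C ⟩
  φ₀ + (A + C)
    ≡⟨ cong (_+_ φ₀) (partialSum-+ (λ s → choose m s * φ (suc s)) (λ s → choose m (suc s) * φ (suc s)) M) ⟨
  φ₀ + partialSum (λ s → choose m s * φ (suc s) + choose m (suc s) * φ (suc s)) M
    ≡⟨ cong (_+_ φ₀) (partialSum-cong M (λ s → sym (*-distribʳ-+ (φ (suc s)) (choose m s) (choose m (suc s))))) ⟩
  φ₀ + partialSum (λ s → choose (suc m) (suc s) * φ (suc s)) M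
    ≡⟨ partialSum-head (λ s → choose (suc m) s * φ s) M ⟨
  partialSum (λ s → choose (suc m) s * φ s) (suc M) ∎
  where
  open ≡-Reasoning
  φ₀ A C : ℚ
  φ₀ = 1ℚ * φ 0
  A = partialSum (λ s → choose m s * φ (suc s)) M
  C = partialSum (λ s → choose m (suc s) * φ (suc s)) M
  swap : ∀ a b c → a + (b + c) ≡ b + (a + c)
  swap = solve-∀ ℚ-ring

choose-suc : ∀ m s → choose m (suc s) * ι (suc s) ≡ choose m s * (ι m - ι s)
choose-suc zero    zero    = refl
choose-suc zero    (suc s) = trans (*-zeroˡ (ι (suc (suc s)))) (sym (*-zeroˡ (ι 0 - ι (suc s))))
choose-suc (suc m) zero    = trans (cong (_* ι 1) (+-comm 1ℚ (choose m 1)))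
  (trans (distrib (choose m 1)) (trans (cong (_+ 1ℚ) (choose-suc m 0)) (trans (collect (ι m)) (cong (λ u → 1ℚ * (u - 0ℚ)) (sym (ι-suc m))))))
  where
  distrib : ∀ c → (c + 1ℚ) * 1ℚ ≡ c * 1ℚ + 1ℚ
  distrib = solve-∀ ℚ-ring
  collect : ∀ m → 1ℚ * (m - 0ℚ) + 1ℚ ≡ 1ℚ * ((1ℚ + m) - 0ℚ)
  collect = solve-∀ ℚ-ring
choose-suc (suc m) (suc s) = begin
  (choose m (suc s) + choose m (suc (suc s))) * ι (suc (suc s))
    ≡⟨ *-distribʳ-+ (ι (suc (suc s))) (choose m (suc s)) _ ⟩
  choose m (suc s) * ι (suc (suc s)) + choose m (suc (suc s)) * ι (suc (suc s))
    ≡⟨ cong₂ (λ u v → choose m (suc s) * u + v) (ι-suc (suc s)) (choose-suc m (suc s)) ⟩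
  choose m (suc s) * (1ℚ + ι (suc s)) + choose m (suc s) * (ι m - ι (suc s))
    ≡⟨ collect (choose m (suc s)) (ι (suc s)) (ι m) ⟩
  choose m (suc s) * ι (suc s) + choose m (suc s) * ((1ℚ + ι m) - ι (suc s))
    ≡⟨ cong₂ (λ u v → u + choose m (suc s) * (v - ι (suc s))) (choose-suc m s) (sym (ι-suc m)) ⟩
  choose m s * (ι m - ι s) + choose m (suc s) * (ι (suc m) - ι (suc s))
    ≡⟨ cong (λ u → choose m s * u + choose m (suc s) * (ι (suc m) - ι (suc s)))
         (trans (sub-suc (ι m) (ι s)) (sym (cong₂ _-_ (ι-suc m) (ι-suc s)))) ⟩
  choose m s * (ι (suc m) - ι (suc s)) + choose m (suc s) * (ι (suc m) - ι (suc s))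
    ≡⟨ *-distribʳ-+ (ι (suc m) - ι (suc s)) (choose m s) (choose m (suc s)) ⟨
  (choose m s + choose m (suc s)) * (ι (suc m) - ι (suc s)) ∎
  where
  open ≡-Reasoning
  collect : ∀ c s m → c * (1ℚ + s) + c * (m - s) ≡ c * s + c * ((1ℚ + m) - s)
  collect = solve-∀ ℚ-ring
  sub-suc : ∀ a b → a - b ≡ (1ℚ + a) - (1ℚ + b)
  sub-suc = solve-∀ ℚ-ring

choose-recip : ∀ m s → choose m (suc s) ≡ choose m s * ((ι m - ι s) * recip s)
choose-recip m s = begin
  choose m (suc s)                              ≡⟨ *-identityʳ (choose m (suc s)) ⟨
  choose m (suc s) * 1ℚ                         ≡⟨ cong (choose m (suc s) *_) (trans (*-comm (ι (suc s)) (recip s)) (recip-* s)) ⟨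
  choose m (suc s) * (ι (suc s) * recip s)      ≡⟨ *-assoc (choose m (suc s)) (ι (suc s)) (recip s) ⟨
  choose m (suc s) * ι (suc s) * recip s        ≡⟨ cong (_* recip s) (choose-suc m s) ⟩
  choose m s * (ι m - ι s) * recip s            ≡⟨ *-assoc (choose m s) (ι m - ι s) (recip s) ⟩
  choose m s * ((ι m - ι s) * recip s)          ∎
  where open ≡-Reasoning

module _ (k N : ℕ) where

  private
    n p : ℕ
    n = k ℕ.+ suc N
    p = k ℕ.+ N
    x z P L lp T : ℚ
    x = ι (suc N)
    z = ι (suc n)
    P = z ^ p
    L = luckyParkings (k ↑ʳ zero) (empty n) n
    lp = luckyProbability (suc k) n
    T = binSum n (λ s _ → correction k s * recip N ^ s)

  luckyProbability-* : lp * P ≡ L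
  luckyProbability-* = begin
    lp * z ^ p
      ≡⟨ cong (λ e → lp * z ^ e) (cong ℕ.pred (ℕ.+-suc k N)) ⟨
    lp * z ^ (n ℕ.∸ 1)
      ≡⟨ cong (lp *_) (ι-^ (suc n) (n ℕ.∸ 1)) ⟨
    lp * ι (suc n ℕ.^ (n ℕ.∸ 1))
      ≡⟨ /-*-cancel (ℕ.sum (List.map (λ i → q n i (suc k)) (allFin n))) (suc n ℕ.^ (n ℕ.∸ 1)) {{ℕ.m^n≢0 (suc n) (n ℕ.∸ 1)}} ⟩
    ι (ℕ.sum (List.map (λ i → q n i (suc k)) (allFin n)))
      ≡⟨ cong (λ j → ι (ℕ.sum (List.map (λ i → q n i j) (allFin n)))) label≡ ⟨
    ι (ℕ.sum (List.map (λ i → q n i (label j)) (allFin n)))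
      ≡⟨ sum-q j ⟩
    L ∎
    where
    open ≡-Reasoning
    j : Fin n
    j = k ↑ʳ zero
    label≡ : label j ≡ suc k
    label≡ = cong suc (trans (Fin.toℕ-↑ʳ k (zero {N})) (ℕ.+-identityʳ k))

  -- Pulling out x^n turns x^b into x^(-s). The growing part becomes one power with an exponential
  -- limit, and T keeps only k nonzero terms, each convergent as N grows.
  correction-scaled : binSum n (λ s b → correction k s * x ^ b) ≡ x ^ n * T
  correction-scaled = trans (binSum-cong n step) (binSum-*ˡ n (x ^ n) (λ s _ → correction k s * recip N ^ s))
    where
    open ≡-Reasoning
    rotate : ∀ c p q r → c * q * (p * r) ≡ (p * q) * (c * r)
    rotate = solve-∀ ℚ-ring
    ^-+ : ∀ a b → x ^ (a ℕ.+ b) ≡ x ^ a * x ^ b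
    ^-+ zero    b = sym (*-identityˡ (x ^ b))
    ^-+ (suc a) b = trans (cong (x *_) (^-+ a b)) (sym (*-assoc x (x ^ a) (x ^ b)))
    step : ∀ s b → s ℕ.+ b ≡ n → correction k s * x ^ b ≡ x ^ n * (correction k s * recip N ^ s)
    step s b e = begin
      correction k s * x ^ b
        ≡⟨ *-identityʳ (correction k s * x ^ b) ⟨
      correction k s * x ^ b * 1ℚ
        ≡⟨ cong (correction k s * x ^ b *_) (^-inverse x (recip N) s (trans (*-comm x (recip N)) (recip-* N))) ⟨
      correction k s * x ^ b * (x ^ s * recip N ^ s)
        ≡⟨ rotate (correction k s) (x ^ s) (x ^ b) (recip N ^ s) ⟩
      (x ^ s * x ^ b) * (correction k s * recip N ^ s)
        ≡⟨ cong (_* (correction k s * recip N ^ s)) (trans (cong (x ^_) (sym e)) (^-+ s b)) ⟨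
      x ^ n * (correction k s * recip N ^ s) ∎

  luckyProbability-closed : lp ≡ luckyRate k + (x * recip n) ^ p * T
  luckyProbability-closed = begin
    lp
      ≡⟨ unit lp (recip n ^ p * P) (^-inverse (recip n) z p (recip-* n)) ⟨
    lp * (recip n ^ p * P)
      ≡⟨ swap lp (recip n ^ p) P ⟩
    recip n ^ p * (lp * P)
      ≡⟨ cong (recip n ^ p *_) cancelled ⟩
    recip n ^ p * (luckyRate k * P + x ^ p * T)
      ≡⟨ regroup (recip n ^ p) (luckyRate k) P (x ^ p) T ⟩
    luckyRate k * (recip n ^ p * P) + (x ^ p * recip n ^ p) * T
      ≡⟨ cong₂ (λ u v → u + v * T) (unit (luckyRate k) _ (^-inverse (recip n) z p (recip-* n))) (sym (^-distrib-* x (recip n) p)) ⟩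
    luckyRate k + (x * recip n) ^ p * T ∎
    where
    open ≡-Reasoning
    unit : ∀ u v → v ≡ 1ℚ → u * v ≡ u
    unit u v refl = *-identityʳ u
    swap : ∀ l r p → l * (r * p) ≡ r * (l * p)
    swap = solve-∀ ℚ-ring
    regroup : ∀ r g p q t → r * (g * p + q * t) ≡ g * (r * p) + (q * r) * t
    regroup = solve-∀ ℚ-ring
    factor : ∀ g x p q t → g * (x * p) + x * q * t ≡ x * (g * p + q * t)
    factor = solve-∀ ℚ-ring
    cancelled : lp * P ≡ luckyRate k * P + x ^ p * T
    cancelled = *-cancelˡ-pos x {{ι-pos N}} (begin
      x * (lp * P)
        ≡⟨ cong (x *_) luckyProbability-* ⟩
      x * L
        ≡⟨ luckyParkings-closed k N ⟩
      luckyRate k * (x * P) + binSum n (λ s b → correction k s * x ^ b)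
        ≡⟨ cong (_+_ (luckyRate k * (x * P))) (trans correction-scaled (cong (λ e → x ^ e * T) (ℕ.+-suc k N))) ⟩
      luckyRate k * (x * P) + x * x ^ p * T
        ≡⟨ factor (luckyRate k) x P (x ^ p) T ⟩
      x * (luckyRate k * P + x ^ p * T) ∎)

  correction-sum : T ≡ partialSum (λ s → choose n s * (correction k s * recip N ^ s)) k
  correction-sum = trans
    (binSum≡partialSum n (k ℕ.+ suc (suc N)) (λ s → correction k s * recip N ^ s) (ℕ.+-monoʳ-< k (ℕ.n<1+n (suc N))))
    (partialSum-truncate k (λ s k≤s → trans
      (cong (λ t → choose n s * ((if t then luckyFill∞ k s * (ι k - ι s) else 0ℚ) * recip N ^ s)) (dec-false (s ℕ.<? k) (ℕ.≤⇒≯ k≤s)))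
      (vanish (choose n s) (recip N ^ s))) (suc (suc N)))
    where
    vanish : ∀ c r → c * (0ℚ * r) ≡ 0ℚ
    vanish = solve-∀ ℚ-ring

-- Inequalities in ℚ

≤-by-nonNeg : ∀ {p q} → 0ℚ ≤ q - p → p ≤ q
≤-by-nonNeg {p} {q} h = subst (p ≤_) (cancel p q) (subst (_≤ p + (q - p)) (+-identityʳ p) (+-monoʳ-≤ p h))
  where
  cancel : ∀ p q → p + (q - p) ≡ q
  cancel = solve-∀ ℚ-ring

*-mono-≤-nonNeg : ∀ {p p′ q q′} → 0ℚ ≤ q → 0ℚ ≤ p′ → p ≤ p′ → q ≤ q′ → p * q ≤ p′ * q′
*-mono-≤-nonNeg {p} {p′} {q} {q′} 0≤q 0≤p′ p≤p′ q≤q′ =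
  ≤-trans (*-monoʳ-≤-nonNeg q {{nonNegative 0≤q}} p≤p′) (*-monoˡ-≤-nonNeg p′ {{nonNegative 0≤p′}} q≤q′)

*-nonNeg : ∀ {p q} → 0ℚ ≤ p → 0ℚ ≤ q → 0ℚ ≤ p * q
*-nonNeg {p} {q} 0≤p 0≤q = subst (_≤ p * q) (*-zeroˡ q) (*-monoʳ-≤-nonNeg q {{nonNegative 0≤q}} 0≤p)

ι-≥0 : ∀ n → 0ℚ ≤ ι n
ι-≥0 n = nonNegative⁻¹ (ι n) {{ι-nonNeg n}}

ι-mono : ∀ {m n} → m ℕ.≤ n → ι m ≤ ι n
ι-mono {m} {n} m≤n = subst (ι m ≤_) (trans (sym (ι-+ m (n ℕ.∸ m))) (cong ι (ℕ.m+[n∸m]≡n m≤n)))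
  (subst (_≤ ι m + ι (n ℕ.∸ m)) (+-identityʳ (ι m)) (+-monoʳ-≤ (ι m) (ι-≥0 (n ℕ.∸ m))))

recip-≥0 : ∀ n → 0ℚ ≤ recip n
recip-≥0 n = nonNegative⁻¹ (recip n) {{normalize-nonNeg 1 (suc n)}}

ι*recip≤1 : ∀ {m n} → m ℕ.≤ suc n → ι m * recip n ≤ 1ℚ
ι*recip≤1 {m} {n} m≤n = subst (ι m * recip n ≤_) (trans (*-comm (ι (suc n)) (recip n)) (recip-* n))
  (*-monoʳ-≤-nonNeg (recip n) {{nonNegative (recip-≥0 n)}} (ι-mono m≤n))

-- Null and eventually bounded sequences

record Null (f : ℕ → ℚ) : Set where
  constructor mkNull
  field
    small : ∀ ε → 0ℚ < ε → ∃[ N ] (∀ n → N ℕ.≤ n → ∣ f n ∣ < ε)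

record EventuallyBounded (f : ℕ → ℚ) : Set where
  constructor mkBounded
  field
    bound   : ℚ
    0<bound : 0ℚ < bound
    bounded : ∃[ N ] (∀ n → N ℕ.≤ n → ∣ f n ∣ ≤ bound)

Null-0 : Null (λ _ → 0ℚ)
Null-0 = mkNull λ ε 0<ε → 0 , λ _ _ → 0<ε

Null-cong : ∀ {f g} → (∀ n → f n ≡ g n) → Null f → Null g
Null-cong f≡g (mkNull f→0) = mkNull λ ε 0<ε → let N , h = f→0 ε 0<ε in
  N , λ n N≤n → subst (λ z → ∣ z ∣ < ε) (f≡g n) (h n N≤n)

Null-+ : ∀ {f g} → Null f → Null g → Null (λ n → f n + g n)
Null-+ {f} {g} (mkNull f→0) (mkNull g→0) = mkNull λ ε 0<ε →
  let M , hf = f→0 (½ * ε) (0<½*ε 0<ε)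
      N , hg = g→0 (½ * ε) (0<½*ε 0<ε)
  in M ℕ.⊔ N , λ n h → ≤-<-trans (∣p+q∣≤∣p∣+∣q∣ (f n) (g n))
       (subst (∣ f n ∣ + ∣ g n ∣ <_) (halves ε) (+-mono-< (hf n (ℕ.m⊔n≤o⇒m≤o M N h)) (hg n (ℕ.m⊔n≤o⇒n≤o M N h))))

Null-* : ∀ {b f} → EventuallyBounded b → Null f → Null (λ n → b n * f n)
Null-* {b} {f} (mkBounded B 0<B (M , hb)) (mkNull f→0) = mkNull λ ε 0<ε →
  let N , hf = f→0 (1/ B * ε) (positive⁻¹ (1/ B * ε) {{pos*pos⇒pos (1/ B) ε {{positive 0<ε}}}})
      open ≤-Reasoning
  in M ℕ.⊔ N , λ n h → begin-strict
    ∣ b n * f n ∣        ≡⟨ ∣p*q∣≡∣p∣*∣q∣ (b n) (f n) ⟩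
    ∣ b n ∣ * ∣ f n ∣    ≤⟨ *-monoʳ-≤-nonNeg ∣ f n ∣ {{∣-∣-nonNeg (f n)}} (hb n (ℕ.m⊔n≤o⇒m≤o M N h)) ⟩
    B * ∣ f n ∣          <⟨ *-monoʳ-<-pos B (hf n (ℕ.m⊔n≤o⇒n≤o M N h)) ⟩
    B * (1/ B * ε)       ≡⟨ *-assoc B (1/ B) ε ⟨
    B * 1/ B * ε         ≡⟨ cong (_* ε) (*-inverseʳ B) ⟩
    1ℚ * ε               ≡⟨ *-identityˡ ε ⟩
    ε                    ∎
  where
  instance
    B>0 : Positive B
    B>0 = positive 0<B
    B≢0 : NonZero B
    B≢0 = pos⇒nonZero B
    B⁻¹>0 : Positive (1/ B)
    B⁻¹>0 = 1/pos⇒pos B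

≤1+ : ∀ p → p ≤ 1ℚ + p
≤1+ p = subst (_≤ 1ℚ + p) (+-identityˡ p) (+-monoˡ-≤ p (nonNegative⁻¹ 1ℚ))

0<1+∣_∣ : ∀ p → 0ℚ < 1ℚ + ∣ p ∣
0<1+∣ p ∣ = positive⁻¹ (1ℚ + ∣ p ∣) {{pos+nonNeg⇒pos 1ℚ ∣ p ∣ {{∣-∣-nonNeg p}}}}

bounded-const : ∀ c → EventuallyBounded (λ _ → c)
bounded-const c = mkBounded (1ℚ + ∣ c ∣) 0<1+∣ c ∣ (0 , λ _ _ → ≤1+ ∣ c ∣)

Null⇒bounded : ∀ {f} → Null f → EventuallyBounded f
Null⇒bounded (mkNull f→0) = let N , h = f→0 1ℚ (positive⁻¹ 1ℚ) in
  mkBounded 1ℚ (positive⁻¹ 1ℚ) (N , λ n N≤n → <⇒≤ (h n N≤n))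

Null-scale : ∀ c {f} → Null f → Null (λ n → c * f n)
Null-scale c = Null-* (bounded-const c)

inverse-< : ∀ r x ε .{{_ : Positive r}} → r * x ≡ 1ℚ → 1ℚ < x * ε → r < ε
inverse-< r x ε rx≡1 1<xε = begin-strict
  r              ≡⟨ *-identityʳ r ⟨
  r * 1ℚ         <⟨ *-monoʳ-<-pos r 1<xε ⟩
  r * (x * ε)    ≡⟨ *-assoc r x ε ⟨
  r * x * ε      ≡⟨ cong (_* ε) rx≡1 ⟩
  1ℚ * ε         ≡⟨ *-identityˡ ε ⟩
  ε              ∎
  where open ≤-Reasoning

Null-recip : Null recip
Null-recip = mkNull λ ε 0<ε → let d , 1<dε = archimedean 1ℚ ε 0<ε in d , λ n d≤n →
  subst (_< ε) (sym (0≤p⇒∣p∣≡p (recip-≥0 n)))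
    (inverse-< (recip n) (ι (suc n)) ε {{normalize-pos 1 (suc n)}} (recip-* n)
      (<-≤-trans 1<dε (*-monoʳ-≤-nonNeg ε {{nonNegative (<⇒≤ 0<ε)}} (ι-mono (s≤s d≤n)))))

Null-reindex : ∀ {f} (g : ℕ → ℕ) → (∀ n → n ℕ.≤ g n) → Null f → Null (λ n → f (g n))
Null-reindex g n≤gn (mkNull f→0) = mkNull λ ε 0<ε → let N , h = f→0 ε 0<ε in N , λ n N≤n → h (g n) (ℕ.≤-trans N≤n (n≤gn n))

Null-*-tends : ∀ (f g : ℕ → ℚ) a b → Null (λ n → f n - a) → Null (λ n → g n - b) → Null (λ n → f n * g n - a * b)
Null-*-tends f g a b f→a g→b = Null-cong (λ n → expand (f n) (g n) a b)
  (Null-+ (Null-* (Null⇒bounded f→a) g→b) (Null-+ (Null-scale a g→b) (Null-scale b f→a)))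
  where
  expand : ∀ f g a b → (f - a) * (g - b) + (a * (g - b) + b * (f - a)) ≡ f * g - a * b
  expand = solve-∀ ℚ-ring

-- The exponential limit

expSum≡partialSum : ∀ x m → expSum x m ≡ partialSum (expTerm x) m
expSum≡partialSum x zero    = refl
expSum≡partialSum x (suc m) = cong (_+ expTerm x m) (expSum≡partialSum x m)

partialSum-mono-dist : ∀ {f g h} m → (∀ s → s ℕ.< m → ∣ f s - g s ∣ ≤ h s) →
  ∣ partialSum f m - partialSum g m ∣ ≤ partialSum h m
partialSum-mono-dist         zero    _   = ≤-refl
partialSum-mono-dist {f} {g} {h} (suc m) f~g = begin
  ∣ (F + f m) - (G + g m) ∣       ≡⟨ cong ∣_∣ (regroup F (f m) G (g m)) ⟩
  ∣ (F - G) + (f m - g m) ∣       ≤⟨ ∣p+q∣≤∣p∣+∣q∣ (F - G) (f m - g m) ⟩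
  ∣ F - G ∣ + ∣ f m - g m ∣       ≤⟨ +-mono-≤ (partialSum-mono-dist m (λ s s<m → f~g s (ℕ.m≤n⇒m≤1+n s<m))) (f~g m ℕ.≤-refl) ⟩
  partialSum h m + h m            ∎
  where
  open ≤-Reasoning
  F G : ℚ
  F = partialSum f m
  G = partialSum g m
  regroup : ∀ a b c d → (a + b) - (c + d) ≡ (a - c) + (b - d)
  regroup = solve-∀ ℚ-ring

partialSum-*ʳ : ∀ f c m → partialSum (λ s → f s * c) m ≡ partialSum f m * c
partialSum-*ʳ f c zero    = sym (*-zeroˡ c)
partialSum-*ʳ f c (suc m) = trans (cong (_+ f m * c) (partialSum-*ʳ f c m)) (sym (*-distribʳ-+ c (partialSum f m) (f m)))

1+ι≤2^ : ∀ s → 1ℚ + ι s ≤ ι 2 ^ s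
1+ι≤2^ zero    = ≤-refl
1+ι≤2^ (suc s) = begin
  1ℚ + ι (suc s)                      ≡⟨ cong (_+_ 1ℚ) (ι-suc s) ⟩
  1ℚ + (1ℚ + ι s)                     ≤⟨ +-monoˡ-≤ (1ℚ + ι s) (subst (_≤ 1ℚ + ι s) (+-identityʳ 1ℚ) (+-monoʳ-≤ 1ℚ (ι-≥0 s))) ⟩
  (1ℚ + ι s) + (1ℚ + ι s)             ≤⟨ +-mono-≤ (1+ι≤2^ s) (1+ι≤2^ s) ⟩
  ι 2 ^ s + ι 2 ^ s                   ≡⟨ double (ι 2 ^ s) ⟩
  ι 2 * ι 2 ^ s                       ∎
  where
  open ≤-Reasoning
  double : ∀ p → p + p ≡ (1ℚ + 1ℚ) * p
  double = solve-∀ ℚ-ring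

-- (m)_s / m^s for m = suc n
fallingRatio : ℕ → ℕ → ℚ
fallingRatio n zero    = 1ℚ
fallingRatio n (suc s) = fallingRatio n s * (1ℚ - ι s * recip n)

choose-expTerm : ∀ n y s → choose (suc n) s * (y * recip n) ^ s ≡ expTerm y s * fallingRatio n s
choose-expTerm n y zero    = refl
choose-expTerm n y (suc s) = begin
  choose (suc n) (suc s) * (y * r * (y * r) ^ s)
    ≡⟨ cong (_* (y * r * (y * r) ^ s)) (choose-recip (suc n) s) ⟩
  choose (suc n) s * ((ι (suc n) - ι s) * recip s) * (y * r * (y * r) ^ s)
    ≡⟨ regroup (choose (suc n) s) (ι (suc n)) (ι s) (recip s) y r ((y * r) ^ s) ⟩
  choose (suc n) s * (y * r) ^ s * ((y * recip s) * (r * ι (suc n) - ι s * r))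
    ≡⟨ cong₂ (λ u v → u * ((y * recip s) * (v - ι s * r))) (choose-expTerm n y s) (recip-* n) ⟩
  expTerm y s * fallingRatio n s * ((y * recip s) * (1ℚ - ι s * r))
    ≡⟨ interchange (expTerm y s) (fallingRatio n s) (y * recip s) (1ℚ - ι s * r) ⟩
  expTerm y (suc s) * fallingRatio n (suc s) ∎
  where
  open ≡-Reasoning
  r : ℚ
  r = recip n
  regroup : ∀ c m s q y r p → c * ((m - s) * q) * (y * r * p) ≡ c * p * ((y * q) * (r * m - s * r))
  regroup = solve-∀ ℚ-ring
  interchange : ∀ a b c d → a * b * (c * d) ≡ a * c * (b * d)
  interchange = solve-∀ ℚ-ring

-- Each new factor 1 - t with t = s/(n + 1) loses at most t. The loss is bounded crudely by 2^s/(n +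
-- 1): doubling the bound pays for the next factor, and 2^s merges with the terms y^s/s! into a
-- series for exp (2 |y|).
fallingRatio-bounds : ∀ n s → s ℕ.≤ suc n →
  0ℚ ≤ fallingRatio n s × fallingRatio n s ≤ 1ℚ × 1ℚ ≤ fallingRatio n s + ι 2 ^ s * recip n
fallingRatio-bounds n zero    h = nonNegative⁻¹ 1ℚ , ≤-refl ,
  subst (_≤ 1ℚ + 1ℚ * recip n) (+-identityʳ 1ℚ) (+-monoʳ-≤ 1ℚ (subst (0ℚ ≤_) (sym (*-identityˡ (recip n))) (recip-≥0 n)))
fallingRatio-bounds n (suc s) h = let 0≤β , β≤1 , 1≤β+ = fallingRatio-bounds n s (ℕ.<⇒≤ h) in
  step (fallingRatio n s) (ι s * recip n) (ι 2 ^ s) (recip n) (*-nonNeg (ι-≥0 s) (recip-≥0 n)) (ι*recip≤1 (ℕ.<⇒≤ h))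
    (*-monoʳ-≤-nonNeg (recip n) {{nonNegative (recip-≥0 n)}} (≤-trans (≤1+ (ι s)) (1+ι≤2^ s))) 0≤β β≤1 1≤β+
  where
  step : ∀ β t p r → 0ℚ ≤ t → t ≤ 1ℚ → t ≤ p * r → 0ℚ ≤ β → β ≤ 1ℚ → 1ℚ ≤ β + p * r →
    0ℚ ≤ β * (1ℚ - t) × β * (1ℚ - t) ≤ 1ℚ × 1ℚ ≤ β * (1ℚ - t) + (1ℚ + 1ℚ) * p * r
  step β t p r 0≤t t≤1 t≤pr 0≤β β≤1 1≤β+ = *-nonNeg 0≤β 0≤1-t , ≤-trans β′≤β β≤1 , (begin
    1ℚ                                     ≤⟨ 1≤β+ ⟩
    β + p * r                              ≤⟨ +-monoˡ-≤ (p * r) β≤β′+t ⟩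
    (β * (1ℚ - t) + t) + p * r             ≤⟨ +-monoˡ-≤ (p * r) (+-monoʳ-≤ (β * (1ℚ - t)) t≤pr) ⟩
    (β * (1ℚ - t) + p * r) + p * r         ≡⟨ double (β * (1ℚ - t)) p r ⟩
    β * (1ℚ - t) + (1ℚ + 1ℚ) * p * r       ∎)
    where
    open ≤-Reasoning
    0≤1-t : 0ℚ ≤ 1ℚ - t
    0≤1-t = subst (_≤ 1ℚ - t) (+-inverseʳ t) (+-monoˡ-≤ (- t) t≤1)
    β′≤β : β * (1ℚ - t) ≤ β
    β′≤β = ≤-by-nonNeg (subst (0ℚ ≤_) (identity β t) (*-nonNeg 0≤β 0≤t))
      where
      identity : ∀ β t → β * t ≡ β - β * (1ℚ - t)
      identity = solve-∀ ℚ-ring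
    β≤β′+t : β ≤ β * (1ℚ - t) + t
    β≤β′+t = ≤-by-nonNeg (subst (0ℚ ≤_) (identity β t)
      (*-nonNeg (subst (_≤ 1ℚ - β) (+-inverseʳ β) (+-monoˡ-≤ (- β) β≤1)) 0≤t))
      where
      identity : ∀ β t → (1ℚ - β) * t ≡ (β * (1ℚ - t) + t) - β
      identity = solve-∀ ℚ-ring
    double : ∀ b p r → (b + p * r) + p * r ≡ b + (1ℚ + 1ℚ) * p * r
    double = solve-∀ ℚ-ring

∣expTerm∣ : ∀ y s → ∣ expTerm y s ∣ * ι 2 ^ s ≡ expTerm (ι 2 * ∣ y ∣) s
∣expTerm∣ y zero    = refl
∣expTerm∣ y (suc s) = begin
  ∣ expTerm y s * (y * recip s) ∣ * (ι 2 * ι 2 ^ s)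
    ≡⟨ cong (_* (ι 2 * ι 2 ^ s)) (trans (∣p*q∣≡∣p∣*∣q∣ (expTerm y s) (y * recip s))
         (cong (∣ expTerm y s ∣ *_) (trans (∣p*q∣≡∣p∣*∣q∣ y (recip s)) (cong (∣ y ∣ *_) (0≤p⇒∣p∣≡p (recip-≥0 s)))))) ⟩
  ∣ expTerm y s ∣ * (∣ y ∣ * recip s) * (ι 2 * ι 2 ^ s)
    ≡⟨ regroup ∣ expTerm y s ∣ ∣ y ∣ (recip s) (ι 2) (ι 2 ^ s) ⟩
  ∣ expTerm y s ∣ * ι 2 ^ s * (ι 2 * ∣ y ∣ * recip s)
    ≡⟨ cong (_* (ι 2 * ∣ y ∣ * recip s)) (∣expTerm∣ y s) ⟩
  expTerm (ι 2 * ∣ y ∣) (suc s) ∎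
  where
  open ≡-Reasoning
  regroup : ∀ e y r t p → e * (y * r) * (t * p) ≡ e * p * (t * y * r)
  regroup = solve-∀ ℚ-ring

-- The binomial expansion has n + 2 terms, and its term s is y^s/s! times `fallingRatio n s`.
-- Comparing term by term leaves errors that sum to a partial sum for exp (2 |y|), divided by n + 1.
compound-interest : ∀ n y → ∣ (1ℚ + y * recip n) ^ suc n - expSum y (suc (suc n)) ∣ ≤ expSum (ι 2 * ∣ y ∣) (suc (suc n)) * recip n
compound-interest n y = begin
  ∣ (1ℚ + w) ^ suc n - expSum y M ∣
    ≡⟨ cong₂ (λ u v → ∣ u - v ∣) expanded (expSum≡partialSum y M) ⟩
  ∣ partialSum (λ s → expTerm y s * fallingRatio n s) M - partialSum (expTerm y) M ∣
    ≤⟨ partialSum-mono-dist M (λ s s<M → close s (ℕ.s≤s⁻¹ s<M)) ⟩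
  partialSum (λ s → expTerm (ι 2 * ∣ y ∣) s * recip n) M
    ≡⟨ trans (partialSum-*ʳ (expTerm (ι 2 * ∣ y ∣)) (recip n) M) (cong (_* recip n) (sym (expSum≡partialSum (ι 2 * ∣ y ∣) M))) ⟩
  expSum (ι 2 * ∣ y ∣) M * recip n ∎
  where
  open ≤-Reasoning
  w : ℚ
  w = y * recip n
  M : ℕ
  M = suc (suc n)
  expanded : (1ℚ + w) ^ suc n ≡ partialSum (λ s → expTerm y s * fallingRatio n s) M
  expanded = trans (cong (_^ suc n) (+-comm 1ℚ w)) (trans (sym (binomial-theorem (suc n) 1ℚ w))
    (trans (binSum-cong (suc n) (λ s b _ → trans (cong (w ^ s *_) (1^ b)) (*-identityʳ (w ^ s))))
    (trans (binSum≡partialSum (suc n) M (w ^_) (ℕ.n<1+n (suc n))) (partialSum-cong M (choose-expTerm n y)))))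
  near : ∀ e β p r → 0ℚ ≤ β × β ≤ 1ℚ × 1ℚ ≤ β + p * r → ∣ e * β - e ∣ ≤ ∣ e ∣ * p * r
  near e β p r (0≤β , β≤1 , 1≤β+) = begin
    ∣ e * β - e ∣                    ≡⟨ cong ∣_∣ (factor e β) ⟩
    ∣ e * - (1ℚ - β) ∣               ≡⟨ ∣p*q∣≡∣p∣*∣q∣ e (- (1ℚ - β)) ⟩
    ∣ e ∣ * ∣ - (1ℚ - β) ∣           ≡⟨ cong (∣ e ∣ *_) (trans (∣-p∣≡∣p∣ (1ℚ - β)) (0≤p⇒∣p∣≡p 0≤1-β)) ⟩
    ∣ e ∣ * (1ℚ - β)                 ≤⟨ *-monoˡ-≤-nonNeg ∣ e ∣ {{∣-∣-nonNeg e}} (≤-by-nonNeg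
                                          (subst (0ℚ ≤_) (rearrange β (p * r))
                                            (subst (_≤ (β + p * r) - 1ℚ) (+-inverseʳ 1ℚ) (+-monoˡ-≤ (- 1ℚ) 1≤β+)))) ⟩
    ∣ e ∣ * (p * r)                  ≡⟨ *-assoc ∣ e ∣ p r ⟨
    ∣ e ∣ * p * r                    ∎
    where
    0≤1-β : 0ℚ ≤ 1ℚ - β
    0≤1-β = subst (_≤ 1ℚ - β) (+-inverseʳ β) (+-monoˡ-≤ (- β) β≤1)
    factor : ∀ e b → e * b - e ≡ e * - (1ℚ - b)
    factor = solve-∀ ℚ-ring
    rearrange : ∀ b c → (b + c) - 1ℚ ≡ c - (1ℚ - b)
    rearrange = solve-∀ ℚ-ring
  close : ∀ s → s ℕ.≤ suc n → ∣ expTerm y s * fallingRatio n s - expTerm y s ∣ ≤ expTerm (ι 2 * ∣ y ∣) s * recip n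
  close s s≤ = subst (λ z → ∣ expTerm y s * fallingRatio n s - expTerm y s ∣ ≤ z * recip n) (∣expTerm∣ y s)
    (near (expTerm y s) (fallingRatio n s) (ι 2 ^ s) (recip n) (fallingRatio-bounds n s s≤))

cauchy⇒bounded : ∀ {f} → IsCauchy f → EventuallyBounded f
cauchy⇒bounded {f} c = let N , h = c 1ℚ (positive⁻¹ 1ℚ) in mkBounded (1ℚ + ∣ f N ∣) 0<1+∣ f N ∣ (N , λ n N≤n →
  let open ≤-Reasoning in begin
  ∣ f n ∣                    ≡⟨ cong ∣_∣ (via (f n) (f N)) ⟩
  ∣ (f n - f N) + f N ∣      ≤⟨ ∣p+q∣≤∣p∣+∣q∣ (f n - f N) (f N) ⟩
  ∣ f n - f N ∣ + ∣ f N ∣    ≤⟨ +-monoˡ-≤ ∣ f N ∣ (<⇒≤ (h n N N≤n ℕ.≤-refl)) ⟩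
  1ℚ + ∣ f N ∣               ∎)
  where
  via : ∀ a b → a ≡ (a - b) + b
  via = solve-∀ ℚ-ring

Null-dominated : ∀ {f g} → (∀ n → ∣ f n ∣ ≤ ∣ g n ∣) → Null g → Null f
Null-dominated f≤g (mkNull g→0) = mkNull λ ε 0<ε → let N , h = g→0 ε 0<ε in N , λ n N≤n → ≤-<-trans (f≤g n) (h n N≤n)

bounded-reindex : ∀ {f} (g : ℕ → ℕ) → (∀ n → n ℕ.≤ g n) → EventuallyBounded f → EventuallyBounded (λ n → f (g n))
bounded-reindex g n≤gn (mkBounded C 0<C (N , h)) = mkBounded C 0<C (N , λ n N≤n → h (g n) (ℕ.≤-trans N≤n (n≤gn n)))

-- The error bound is a null sequence, since the partial sums for exp (2 |y|) are Cauchy and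
-- therefore eventually bounded.
exp-limit : ∀ y → Null (λ n → (1ℚ + y * recip n) ^ suc n - expSum y (suc (suc n)))
exp-limit y = Null-dominated
  (λ n → ≤-trans (compound-interest n y) (p≤∣p∣ (expSum (ι 2 * ∣ y ∣) (suc (suc n)) * recip n)))
  (Null-* (bounded-reindex {expSum (ι 2 * ∣ y ∣)} (λ n → suc (suc n)) (λ n → ℕ.m≤n+m n 2) (cauchy⇒bounded (cauchy (exp (ι 2 * ∣ y ∣))))) Null-recip)
  where
  p≤∣p∣ : ∀ p → p ≤ ∣ p ∣
  p≤∣p∣ p with ≤-total 0ℚ p
  ... | inj₁ 0≤p = ≤-reflexive (sym (0≤p⇒∣p∣≡p 0≤p))
  ... | inj₂ p≤0 = ≤-trans p≤0 (0≤∣p∣ p)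

^-bounded : ∀ a n → 0ℚ ≤ a → a ≤ 1ℚ → 0ℚ ≤ a ^ n × a ^ n ≤ 1ℚ
^-bounded a zero    0≤a a≤1 = nonNegative⁻¹ 1ℚ , ≤-refl
^-bounded a (suc n) 0≤a a≤1 = let 0≤aⁿ , aⁿ≤1 = ^-bounded a n 0≤a a≤1 in
  *-nonNeg 0≤a 0≤aⁿ , *-mono-≤-nonNeg 0≤aⁿ (nonNegative⁻¹ 1ℚ) a≤1 aⁿ≤1

-- The limit of the proportion of lucky spots

module _ (k : ℕ) where

  private
    T ratio : ℕ → ℚ
    T N = binSum (k ℕ.+ suc N) (λ s _ → correction k s * recip N ^ s)
    ratio N = ι (suc N) * recip (suc (k ℕ.+ N))
    y : ℚ
    y = - ι (suc k)

  -- The limit of T: `expTerm 1ℚ s` is 1/s!, the limit of C(n, s)/x^s.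
  luckyExpRate : ℚ
  luckyExpRate = partialSum (λ s → expTerm 1ℚ s * correction k s) k

  -- Passing from s to s + 1 multiplies by (n - s)/x = 1 + (k - s)/x, which tends to 1, and by 1/(s
  -- + 1).
  choose-tends : ∀ s → Null (λ N → choose (k ℕ.+ suc N) s * recip N ^ s - expTerm 1ℚ s)
  choose-tends zero    = Null-0
  choose-tends (suc s) = Null-cong (λ N → cong (_- expTerm 1ℚ (suc s)) (sym (term N)))
    (Null-*-tends (λ N → choose (k ℕ.+ suc N) s * recip N ^ s) (λ N → (1ℚ + (ι k - ι s) * recip N) * recip s)
      (expTerm 1ℚ s) (1ℚ * recip s) (choose-tends s)
      (Null-cong (λ N → factor (ι k - ι s) (recip s) (recip N)) (Null-scale ((ι k - ι s) * recip s) Null-recip)))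
    where
    open ≡-Reasoning
    factor : ∀ c q r → (c * q) * r ≡ (1ℚ + c * r) * q - 1ℚ * q
    factor = solve-∀ ℚ-ring
    regroup : ∀ c k x s q r p → c * (((k + x) - s) * q) * (r * p) ≡ c * p * ((r * x + (k - s) * r) * q)
    regroup = solve-∀ ℚ-ring
    term : ∀ N → choose (k ℕ.+ suc N) (suc s) * recip N ^ suc s
      ≡ (choose (k ℕ.+ suc N) s * recip N ^ s) * ((1ℚ + (ι k - ι s) * recip N) * recip s)
    term N = begin
      choose n (suc s) * (recip N * recip N ^ s)
        ≡⟨ cong (_* (recip N * recip N ^ s)) (choose-recip n s) ⟩
      choose n s * ((ι n - ι s) * recip s) * (recip N * recip N ^ s)
        ≡⟨ cong (λ u → choose n s * ((u - ι s) * recip s) * (recip N * recip N ^ s)) (ι-+ k (suc N)) ⟩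
      choose n s * (((ι k + ι (suc N)) - ι s) * recip s) * (recip N * recip N ^ s)
        ≡⟨ regroup (choose n s) (ι k) (ι (suc N)) (ι s) (recip s) (recip N) (recip N ^ s) ⟩
      choose n s * recip N ^ s * ((recip N * ι (suc N) + (ι k - ι s) * recip N) * recip s)
        ≡⟨ cong (λ u → choose n s * recip N ^ s * ((u + (ι k - ι s) * recip N) * recip s)) (recip-* N) ⟩
      choose n s * recip N ^ s * ((1ℚ + (ι k - ι s) * recip N) * recip s) ∎
      where
      n : ℕ
      n = k ℕ.+ suc N

  correction-tends : Null (λ N → T N - luckyExpRate)
  correction-tends = Null-cong (λ N → cong (_- luckyExpRate) (sym (correction-sum k N))) (sums k)
    where
    regroup : ∀ a b c d → (a - b) + (c - d) ≡ (a + c) - (b + d)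
    regroup = solve-∀ ℚ-ring
    factor : ∀ w c r e → w * (c * r - e) ≡ c * (w * r) - e * w
    factor = solve-∀ ℚ-ring
    sums : ∀ m → Null (λ N → partialSum (λ s → choose (k ℕ.+ suc N) s * (correction k s * recip N ^ s)) m
                           - partialSum (λ s → expTerm 1ℚ s * correction k s) m)
    sums zero    = Null-0
    sums (suc m) = Null-cong
      (λ N → trans (cong (_+_ (partialSum (λ s → choose (k ℕ.+ suc N) s * (correction k s * recip N ^ s)) m
                           - partialSum (λ s → expTerm 1ℚ s * correction k s) m))
                   (factor (correction k m) (choose (k ℕ.+ suc N) m) (recip N ^ m) (expTerm 1ℚ m)))
        (regroup (partialSum (λ s → choose (k ℕ.+ suc N) s * (correction k s * recip N ^ s)) m)
                 (partialSum (λ s → expTerm 1ℚ s * correction k s) m)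
                 (choose (k ℕ.+ suc N) m * (correction k m * recip N ^ m)) _))
      (Null-+ (sums m) (Null-scale (correction k m) (choose-tends m)))

  private
    ratio≡ : ∀ N → ratio N ≡ 1ℚ + y * recip (suc (k ℕ.+ N))
    ratio≡ N = begin
      ι (suc N) * r                                ≡⟨ expand (ι (suc N)) (ι (suc k)) r ⟩
      r * (ι (suc k) + ι (suc N)) + y * r          ≡⟨ cong (λ u → r * u + y * r) (ι-+ (suc k) (suc N)) ⟨
      r * ι (suc (k ℕ.+ suc N)) + y * r            ≡⟨ cong (λ u → r * ι (suc u) + y * r) (ℕ.+-suc k N) ⟩
      r * ι (suc (suc (k ℕ.+ N))) + y * r          ≡⟨ cong (_+ y * r) (recip-* (suc (k ℕ.+ N))) ⟩
      1ℚ + y * r                                   ∎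
      where
      open ≡-Reasoning
      r : ℚ
      r = recip (suc (k ℕ.+ N))
      expand : ∀ x k r → x * r ≡ r * (k + x) + - k * r
      expand = solve-∀ ℚ-ring

    ratio-bounded : EventuallyBounded (λ N → ratio N ^ (k ℕ.+ N))
    ratio-bounded = mkBounded 1ℚ (positive⁻¹ 1ℚ) (0 , λ N _ →
      let 0≤ , ≤1 = ^-bounded (ratio N) (k ℕ.+ N) (*-nonNeg (ι-≥0 (suc N)) (recip-≥0 (suc (k ℕ.+ N))))
                      (ι*recip≤1 (s≤s (ℕ.m≤n⇒m≤1+n (ℕ.m≤n+m N k))))
      in subst (_≤ 1ℚ) (sym (0≤p⇒∣p∣≡p 0≤)) ≤1)

    n≤shift : ∀ N → N ℕ.≤ suc (k ℕ.+ N)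
    n≤shift N = ℕ.m≤n⇒m≤1+n (ℕ.m≤n+m N k)

    Null-recip-shift : Null (λ N → recip (suc (k ℕ.+ N)))
    Null-recip-shift = Null-reindex (λ N → suc (k ℕ.+ N)) n≤shift Null-recip

  -- With n = k + N + 1 the exponent here is n - 1, whereas `exp-limit` provides n + 1. For w = y/(n
  -- + 1), the two missing factors 1 + w change the power p by -(2 + w) w p, which is null because p
  -- is bounded.
  ratio-tends : Null (λ N → ratio N ^ (k ℕ.+ N) - expSum y (suc (suc (suc (k ℕ.+ N)))))
  ratio-tends = Null-cong
    (λ N → trans (identity (y * recip (suc (k ℕ.+ N))) ((1ℚ + y * recip (suc (k ℕ.+ N))) ^ (k ℕ.+ N)) (expSum y (suc (suc (suc (k ℕ.+ N)))))) (cong (λ u → u ^ (k ℕ.+ N) - expSum y (suc (suc (suc (k ℕ.+ N))))) (sym (ratio≡ N))))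
    (Null-+ (Null-* (bounded-cong (λ N → cong (_^ (k ℕ.+ N)) (ratio≡ N)) ratio-bounded) (Null-* bounded-shift small))
            (Null-reindex (λ N → suc (k ℕ.+ N)) n≤shift (exp-limit y)))
    where
    small : Null (λ N → y * recip (suc (k ℕ.+ N)))
    small = Null-scale y Null-recip-shift
    bounded-cong : ∀ {f g} → (∀ n → f n ≡ g n) → EventuallyBounded f → EventuallyBounded g
    bounded-cong f≡g (mkBounded C 0<C (M , h)) = mkBounded C 0<C (M , λ n M≤n → subst (λ z → ∣ z ∣ ≤ C) (f≡g n) (h n M≤n))
    bounded-shift : EventuallyBounded (λ N → - (ι 2 + y * recip (suc (k ℕ.+ N))))
    bounded-shift = let mkBounded C 0<C (M , h) = Null⇒bounded small in
      mkBounded (ι 2 + C) (<-≤-trans 0<C (subst (_≤ ι 2 + C) (+-identityˡ C) (+-monoˡ-≤ C (ι-≥0 2)))) (M ,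
      λ N M≤N → subst (_≤ ι 2 + C) (sym (∣-p∣≡∣p∣ (ι 2 + y * recip (suc (k ℕ.+ N)))))
        (≤-trans (∣p+q∣≤∣p∣+∣q∣ (ι 2) (y * recip (suc (k ℕ.+ N)))) (+-monoʳ-≤ (ι 2) (h N M≤N))))
    identity : ∀ w p e → p * (- (1ℚ + 1ℚ + w) * w) + ((1ℚ + w) * ((1ℚ + w) * p) - e) ≡ p - e
    identity = solve-∀ ℚ-ring

  luckyProbability-tends : Null (λ N → luckyProbability (suc k) (suc (k ℕ.+ N))
    - (luckyRate k + luckyExpRate * expSum y (suc (suc (suc (k ℕ.+ N))))))
  luckyProbability-tends = Null-cong
    (λ N → trans (regroup (ratio N ^ (k ℕ.+ N)) (T N) luckyExpRate (expSum y (suc (suc (suc (k ℕ.+ N))))) (luckyRate k))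
      (cong (_- (luckyRate k + luckyExpRate * expSum y (suc (suc (suc (k ℕ.+ N)))))) (sym (closed N))))
    (Null-+ (Null-* ratio-bounded correction-tends) (Null-scale luckyExpRate ratio-tends))
    where
    regroup : ∀ p t σ e γ → p * (t - σ) + σ * (p - e) ≡ (γ + p * t) - (γ + σ * e)
    regroup = solve-∀ ℚ-ring
    closed : ∀ N → luckyProbability (suc k) (suc (k ℕ.+ N)) ≡ luckyRate k + ratio N ^ (k ℕ.+ N) * T N
    closed N = subst (λ n → luckyProbability (suc k) n ≡ luckyRate k + (ι (suc N) * recip n) ^ (k ℕ.+ N) * T N)
      (ℕ.+-suc k N) (luckyProbability-closed k N)

  -- Since the approximations of L are the comparison sequence itself, the Cauchy property of L
  -- handles the passage from the index e to m. The gap demanded by `<ᴿ` is ½ ε, and the two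
  -- distances take a quarter of ε each.
  luckyProbability-limit : ∀ L → (∀ m → luckyRate k + luckyExpRate * expSum y m ≡ approx L m) →
    (λ n → fromℚ (luckyProbability (suc k) n)) ⟶ L
  luckyProbability-limit L L≡ ε 0<ε =
    let M , L-cauchy = cauchy L (½ * (½ * ε)) 0<¼ε
        N₀ , lp-near = Null.small luckyProbability-tends (½ * (½ * ε)) 0<¼ε
    in suc (k ℕ.+ (M ℕ.⊔ N₀)) , λ n n≥ → ½ * ε , 0<½*ε 0<ε , M , λ m m≥M →
      let N = n ℕ.∸ suc k
          e = suc (suc (suc (k ℕ.+ N)))
          n≡ : suc (k ℕ.+ N) ≡ n
          n≡ = ℕ.m+[n∸m]≡n (ℕ.≤-trans (s≤s (ℕ.m≤m+n k (M ℕ.⊔ N₀))) n≥)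
          N≥ : M ℕ.⊔ N₀ ℕ.≤ N
          N≥ = subst (ℕ._≤ N) (ℕ.m+n∸m≡n (suc k) (M ℕ.⊔ N₀)) (ℕ.∸-monoˡ-≤ (suc k) n≥)
          near = lp-near N (ℕ.m⊔n≤o⇒n≤o M N₀ N≥)
          tail = L-cauchy e m (ℕ.≤-trans (ℕ.m⊔n≤o⇒m≤o M N₀ N≥) (ℕ.≤-trans (n≤shift N) (ℕ.m≤n+m (suc (k ℕ.+ N)) 2))) m≥M
      in combine (luckyProbability (suc k) n) (approx L e) (approx L m)
           (subst (λ u → ∣ u ∣ < ½ * (½ * ε)) (cong₂ _-_ (cong (luckyProbability (suc k)) n≡) (L≡ e)) near) tail
    where
    0<¼ε : 0ℚ < ½ * (½ * ε)
    0<¼ε = 0<½*ε (0<½*ε 0<ε)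
    combine : ∀ p a b → ∣ p - a ∣ < ½ * (½ * ε) → ∣ a - b ∣ < ½ * (½ * ε) → ∣ p + - 1ℚ * b ∣ + ½ * ε ≤ ε
    combine p a b near tail = begin
      ∣ p + - 1ℚ * b ∣ + ½ * ε                   ≡⟨ cong (λ u → ∣ u ∣ + ½ * ε) (via p a b) ⟩
      ∣ (p - a) + (a - b) ∣ + ½ * ε              ≤⟨ +-monoˡ-≤ (½ * ε) (∣p+q∣≤∣p∣+∣q∣ (p - a) (a - b)) ⟩
      (∣ p - a ∣ + ∣ a - b ∣) + ½ * ε            ≤⟨ +-monoˡ-≤ (½ * ε) (+-mono-≤ (<⇒≤ near) (<⇒≤ tail)) ⟩
      (½ * (½ * ε) + ½ * (½ * ε)) + ½ * ε        ≡⟨ cong (_+ ½ * ε) (halves (½ * ε)) ⟩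
      ½ * ε + ½ * ε                              ≡⟨ halves ε ⟩
      ε                                          ∎
      where
      open ≤-Reasoning
      via : ∀ p a b → p + - 1ℚ * b ≡ (p - a) + (a - b)
      via = solve-∀ ℚ-ring

mainTheorem9 : ((λ n → fromℚ (luckyProbability 1 n)) ⟶ fromℚ 1ℚ)
    × ((λ n → fromℚ (luckyProbability 2 n)) ⟶ fromℚ (+ 3 / 4) -ᴿ (+ 1 / 4) · exp (- (+ 2 / 1)))
    × ((λ n → fromℚ (luckyProbability 3 n)) ⟶ fromℚ (+ 2 / 3) -ᴿ (+ 2 / 3) · exp (- (+ 3 / 1)))
    × ((λ n → fromℚ (luckyProbability 4 n)) ⟶ fromℚ (+ 5 / 8) -ᴿ (+ 13 / 8) · exp (- (+ 4 / 1)))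
    × ((λ n → fromℚ (luckyProbability 5 n)) ⟶ fromℚ (+ 3 / 5) -ᴿ (+ 59 / 15) · exp (- (+ 5 / 1)))
mainTheorem9 =
    -- For k = 0 the sum `luckyExpRate` is empty, so no exponential remains.
    luckyProbability-limit 0 (fromℚ 1ℚ) (λ m → trans (cong (_+_ 1ℚ) (*-zeroˡ (expSum (- (+ 1 / 1)) m))) (+-identityʳ 1ℚ))
  -- From here on, `luckyRate k` and `luckyExpRate k` evaluate by computation to the stated
  -- constants; `minus` only moves the sign to where `-ᴿ` puts it.
  , luckyProbability-limit 1 (fromℚ (+ 3 / 4) -ᴿ (+ 1 / 4) · exp (- (+ 2 / 1))) (λ m → minus (+ 3 / 4) (+ 1 / 4) (expSum (- (+ 2 / 1)) m))
  , luckyProbability-limit 2 (fromℚ (+ 2 / 3) -ᴿ (+ 2 / 3) · exp (- (+ 3 / 1))) (λ m → minus (+ 2 / 3) (+ 2 / 3) (expSum (- (+ 3 / 1)) m))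
  , luckyProbability-limit 3 (fromℚ (+ 5 / 8) -ᴿ (+ 13 / 8) · exp (- (+ 4 / 1))) (λ m → minus (+ 5 / 8) (+ 13 / 8) (expSum (- (+ 4 / 1)) m))
  , luckyProbability-limit 4 (fromℚ (+ 3 / 5) -ᴿ (+ 59 / 15) · exp (- (+ 5 / 1))) (λ m → minus (+ 3 / 5) (+ 59 / 15) (expSum (- (+ 5 / 1)) m))
  where
  minus : ∀ a b e → a + - b * e ≡ a + - 1ℚ * (b * e)
  minus = solve-∀ ℚ-ring
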